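{- Let $P(x)\in\mathbb{Z}[x]$ be irreducible over $\mathbb{Q}$ of degree $d\geq 2$. Let $r\geq 1$ and let $A_1,\dots,A_r$ be fixed positive integers. For each $i\in\{1,\dots,r\}$ let $H^{(i)}$ be one of the following sequences, indexed by positive integers $n$ (the choice may differ from one $i$ to another): $A_i^{n}[1,\dots,n]$, $A_i^{n}n!$, $A_i^{n}n!!$, $A_i^{p_n}\,p_n\#$, $A_i^{n}\,p_n\#$, or $A_i^{n}\,n\#$. Then the Diophantine equation $$P(x)=\prod_{i=1}^r H^{(i)}_{n_i}$$ has only finitely many solutions $(x,n_1,\dots,n_r)$ with $x\in\mathbb{Z}$ and $n_1,\dots,n_r$ positive integers.
   Context: $[1,\dots,n]$ denotes the least common multiple of $1,2,\dots,n$. $n!!$ denotes the double factorial $n(n-2)(n-4)\cdots$ (ending in $1$ or $2$). $n\#$ denotes the primorial, the product of all primes $\leq n$. $p_n$ denotes the $n$-th prime, and $p_n\#$ is the product of the first $n$ primes. -}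

module Defs where

open import Algebra.Bundles.Raw using (RawSemiring)
import Algebra.Definitions.RawSemiring as RawSemiringDefs
open import Data.Fin.Base using (Fin)
open import Data.Integer.Base as ℤ using (ℤ; +_)
open import Data.List.Base using (List; []; _∷_; map; foldr; filter; upTo; tabulate)
open import Data.List.Membership.Propositional using (_∈_)
open import Data.List.Relation.Unary.All using (All; _∷_)
open import Data.Nat.Base
open import Data.Nat.Divisibility using (_∣_; ∣-trans; m∣m*n; ∣m+n∣m⇒∣n; ∣1⇒≡1; m≤n⇒m!∣n!)
open import Data.Nat.ListAction using (product)
open import Data.Nat.LCM using (lcm)
open import Data.Nat.Primality using (Prime; prime?; ¬prime[0]; ¬prime[1])
open import Data.Nat.Primality.Factorisation using (factorise)
open import Data.Nat.Properties
open import Data.Product.Base using (∃; ∃-syntax; _×_; _,_; proj₁)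
open import Data.Rational.Base as ℚ using (ℚ)
open import Data.Sum.Base using (inj₁; inj₂)
open import Data.Vec.Base using (Vec; lookup)
import Data.Vec.Relation.Unary.All as Vec
open import Level using (Level)
open import Relation.Binary.PropositionalEquality using (_≡_; refl; sym; subst)
open import Relation.Nullary using (yes; no; contradiction)
open import Relation.Unary using (Pred; _⊆_)

-- A polynomial is the list of its coefficients, constant term first.
-- Trailing zeros are allowed, so equality of polynomials is _≈ₚ_, not _≡_.

module Polynomial {c ℓ : Level} (R : RawSemiring c ℓ) where

  open RawSemiring R renaming (_+_ to _+ᴿ_; _*_ to _*ᴿ_)

  coeff : List Carrier → ℕ → Carrier
  coeff []      _       = 0#
  coeff (a ∷ _) zero    = a
  coeff (_ ∷ p) (suc k) = coeff p k

  infix  4 _≈ₚ_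
  infixl 6 _+ₚ_
  infixl 7 _*ₚ_

  _≈ₚ_ : List Carrier → List Carrier → Set ℓ
  p ≈ₚ q = ∀ k → coeff p k ≈ coeff q k

  _+ₚ_ : List Carrier → List Carrier → List Carrier
  []      +ₚ q       = q
  p       +ₚ []      = p
  (a ∷ p) +ₚ (b ∷ q) = (a +ᴿ b) ∷ (p +ₚ q)

  _*ₚ_ : List Carrier → List Carrier → List Carrier
  []      *ₚ q = []
  (a ∷ p) *ₚ q = map (a *ᴿ_) q +ₚ (0# ∷ (p *ₚ q))

  eval : List Carrier → Carrier → Carrier
  eval []      x = 0#
  eval (a ∷ p) x = a +ᴿ x *ᴿ eval p x

  HasDegree : List Carrier → ℕ → Set ℓ
  HasDegree p d = coeff p d ≉ 0# × (∀ k → d < k → coeff p k ≈ 0#)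

  rawSemiring : RawSemiring c ℓ
  rawSemiring = record
    { Carrier = List Carrier
    ; _≈_     = _≈ₚ_
    ; _+_     = _+ₚ_
    ; _*_     = _*ₚ_
    ; 0#      = []
    ; 1#      = 1# ∷ []
    }

ℤ[x] : Set
ℤ[x] = List ℤ

open Polynomial ℤ.+-*-rawSemiring public using (eval; HasDegree)

toℚ[x] : ℤ[x] → List ℚ
toℚ[x] = map (ℚ._/ 1)

IrreducibleOverℚ : ℤ[x] → Set
IrreducibleOverℚ P = Irreducible (toℚ[x] P)
  where open RawSemiringDefs (Polynomial.rawSemiring ℚ.+-*-rawSemiring) using (Irreducible)

lcmUpTo : ℕ → ℕ
lcmUpTo n = foldr lcm 1 (map suc (upTo n))

infix 8 _!!

_!! : ℕ → ℕ
0           !! = 1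
1           !! = 1
suc (suc n) !! = suc (suc n) * n !!

primorial : ℕ → ℕ
primorial n = product (filter prime? (upTo (suc n)))

-- The least prime in (n , n + k], given that n + k is prime.

private
  searchPrime : ∀ n k → Prime (n + k) → 0 < k →
                ∃[ p ] n < p × Prime p × (∀ q → n < q → Prime q → p ≤ q)
  searchPrime n (suc k) pr _ with prime? (suc n)
  ... | yes prime[1+n] = suc n , ≤-refl , prime[1+n] , λ _ n<q _ → n<q
  ... | no ¬prime[1+n] with k
  ...   | zero   = contradiction (subst Prime (+-comm n 1) pr) ¬prime[1+n]
  ...   | suc k′ with searchPrime (suc n) (suc k′) (subst Prime (+-suc n (suc k′)) pr) z<s
  ...     | p , 1+n<p , prime[p] , least = p , <-trans (n<1+n n) 1+n<p , prime[p] , least′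
    where
    least′ : ∀ q → n < q → Prime q → p ≤ q
    least′ q n<q prime[q] with m≤n⇒m<n∨m≡n n<q
    ... | inj₁ 1+n<q = least q 1+n<q prime[q]
    ... | inj₂ refl  = contradiction prime[q] ¬prime[1+n]

  primeFactor : ∀ n → 1 < n → ∃[ p ] Prime p × p ∣ n
  primeFactor n@(suc _) 1<n with factorise n
  ... | record { factors = []     ; isFactorisation = eq } =
    contradiction (subst (1 <_) eq 1<n) (<-irrefl refl)
  ... | record { factors = p ∷ ps ; isFactorisation = eq ; factorsPrime = prime[p] ∷ _ } =
    p , prime[p] , subst (p ∣_) (sym eq) (m∣m*n (product ps))

  m∣n! : ∀ m n → 0 < m → m ≤ n → m ∣ n !
  m∣n! (suc m) n _ m≤n = ∣-trans (m∣m*n (m !)) (m≤n⇒m!∣n! m≤n)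

  primeAbove : ∀ n → ∃[ p ] n < p × Prime p
  primeAbove n with primeFactor (n ! + 1) (+-monoˡ-≤ 1 (1≤n! n))
  ... | zero  , prime[0] , _ = contradiction prime[0] ¬prime[0]
  ... | p@(suc _) , prime[p] , p∣n!+1 with n <? p
  ...   | yes n<p = p , n<p , prime[p]
  ...   | no  n≮p = contradiction (subst Prime (∣1⇒≡1 p∣1) prime[p]) ¬prime[1]
    where
    p∣1 : p ∣ 1
    p∣1 = ∣m+n∣m⇒∣n p∣n!+1 (m∣n! p n z<s (≮⇒≥ n≮p))

leastPrimeAbove : ∀ n → ∃[ p ] n < p × Prime p × (∀ q → n < q → Prime q → p ≤ q)
leastPrimeAbove n with primeAbove n
... | p , n<p , prime[p] =
  searchPrime n (p ∸ n) (subst Prime (sym (m+[n∸m]≡n (<⇒≤ n<p))) prime[p]) (m<n⇒0<n∸m n<p)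

-- Indexed so that nthPrime 1 = 2; nthPrime 0 only starts the recursion.

nthPrime : ℕ → ℕ
nthPrime zero    = 0
nthPrime (suc n) = proj₁ (leastPrimeAbove (nthPrime n))

data Kind : Set where
  A^n·[1…n] A^n·n! A^n·n!! A^pₙ·pₙ# A^n·pₙ# A^n·n# : Kind

-- primorial (nthPrime n) is the product of the first n primes.

H : Kind → ℕ → ℕ → ℕ
H A^n·[1…n] A n = A ^ n * lcmUpTo n
H A^n·n!    A n = A ^ n * n !
H A^n·n!!   A n = A ^ n * n !!
H A^pₙ·pₙ#  A n = A ^ nthPrime n * primorial (nthPrime n)
H A^n·pₙ#   A n = A ^ n * primorial (nthPrime n)
H A^n·n#    A n = A ^ n * primorial n

IsSolution : ∀ {r} → ℤ[x] → (Fin r → Kind) → (Fin r → ℕ) → Pred (ℤ × Vec ℕ r) _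
IsSolution P κ A (x , n) =
  Vec.All (0 <_) n × eval P x ≡ + product (tabulate λ i → H (κ i) (A i) (lookup n i))

-- The list may also contain elements outside S.

FinitelyMany : ∀ {a ℓ} {X : Set a} → Pred X ℓ → Set _
FinitelyMany S = ∃[ xs ] S ⊆ (_∈ xs)

{-# OPTIONS --safe #-}
-- It suffices to find an odd prime q modulo which P has no root: each of the six sequences is divisible by q from
-- n = 2q on, so every solution has all nᵢ < 2q.
--
-- Suppose that P has a root modulo every odd prime, and let α be a root of P, made integral. An ideal (m, α − r) of
-- ℤ[α], where r is a root modulo m, contains a nonzero element with coordinates ≪ m^(1/d), by pigeonhole. An element
-- of that size has index ≪ m, so it lies in only one such ideal if all primes dividing m are large. Hence the number
-- of pairs (m, r) with m ~ X is ≪ X, whereas a set of primes with two roots and reciprocal sum s produces ≫ sX pairs: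
-- the primes T modulo which P has two roots have a bounded reciprocal sum.
--
-- On the other hand let R be a domain, finitely generated as a ℤ-module, with two roots α ≠ β of P. A residue field of
-- R over p is 𝔽ₚ, in which case p ∈ T, or has at least p² elements. Consider the elements b ≡ 1 mod z! of a box of
-- side Y in R, shifted so that no b is a unit. Each lies in a prime ideal over some p > z. A prime ideal with N residue
-- classes contains ≪ Y^D / N + 1 of the b, so if the reciprocal sums over T were bounded, there would not be enough
-- primes for all Y^D of them.
module Submission where

open import Defs
open import Algebra.Bundles using (CommutativeRing; RawRing)
open import Data.Empty using (⊥)
open import Data.Fin.Base as Fin using (Fin; zero; suc; toℕ; fromℕ<)
import Data.Fin.Properties as Fin
open import Data.Integer.Base as ℤ using (ℤ; +_; -[1+_]; ∣_∣)
import Data.Integer.Properties as ℤ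
open import Data.List.Base as List using (List; []; _∷_; map; length; _++_)
open import Data.Maybe.Base using (Maybe; just; nothing)
open import Data.Nat.Base as ℕ using (ℕ; zero; suc; _≤_; _<_; z≤n; s≤s)
import Data.Nat.Properties as ℕ
open import Data.Product.Base using (Σ; ∃; ∃₂; ∃-syntax; _×_; _,_; proj₁; proj₂)
open import Data.Sum.Base using (_⊎_; inj₁; inj₂)
open import Function.Base using (_∘_; id; _$_; case_of_)
open import Level using (0ℓ)
open import Relation.Binary.PropositionalEquality as ≡ using (_≡_; _≢_; refl; cong; cong₂; subst; module ≡-Reasoning)
open import Relation.Nullary using (¬_; Dec; yes; no; contradiction)
import Algebra.Solver.Ring as RingSolver
import Algebra.Solver.Ring.AlmostCommutativeRing as ACR
import Relation.Binary.Reasoning.Setoid as SetoidReasoning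
import Algebra.Properties.Semiring.Sum as Sum
import Data.Integer.DivMod as ℤ
import Data.Integer.Tactic.RingSolver as ℤSolver
import Data.Nat.Tactic.RingSolver as ℕSolver
open import Data.Nat.Base using (_^_; NonZero)
import Algebra.Properties.AbelianGroup as AbelianGroup
open import Data.Rational.Base as ℚ using (ℚ)
import Data.Rational.Properties as ℚ
import Data.Rational.Unnormalised.Base as ℚᵘ
import Data.Rational.Unnormalised.Properties as ℚᵘ
import Algebra.Definitions.RawSemiring as RawSemiringDefinitions
import Algebra.Definitions.RawMagma as RawMagmaDefinitions
import Data.Nat.Divisibility as ℕ
import Data.Nat.DivMod as ℕ
import Data.Nat.Coprimality as Coprimality
import Data.Nat.Primality as ℕ
open import Data.Nat.Primality using (Prime)
import Data.Integer.Divisibility.Signed as ℤ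
import Data.Nat.Primality.Factorisation as Factorisation
import Data.Nat.ListAction as ℕ
import Data.Nat.ListAction.Properties as ℕ
import Data.Nat.LCM as ℕ
import Data.Nat.GCD as ℕ
open import Data.List.Membership.Propositional using (_∈_)
import Data.List.Membership.Propositional.Properties as ∈
import Data.List.Properties as List
open import Data.List.Relation.Unary.All as All using (All; []; _∷_)
import Data.List.Relation.Unary.All.Properties as All
open import Data.List.Relation.Unary.Any as Any using (here; there)
open import Data.Vec.Base as Vec using (Vec; []; _∷_)
open import Relation.Nullary.Decidable using (_×-dec_; ¬?)
open import Data.List.Relation.Unary.AllPairs as AllPairs using (AllPairs; []; _∷_)
import Data.List.Relation.Unary.AllPairs.Properties as AllPairs
open import Data.Sum.Base using ([_,_]′)
open import Data.Nat.Base using (_!)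
open import Data.Unit.Base using (⊤; tt)

-- Polynomial rings and quotient rings

-- Behind the two counts stands the simple pole at 1 of a Dedekind zeta function. For the field of α
-- it says that P has one root modulo p on average, so that a root modulo every prime leaves little
-- room for second roots. For the field of R it says that prime ideals of degree one abound, and
-- modulo each of them both α and β become integers. Only the upper inequality of the first
-- statement and the lower one of the second are needed, and lattices provide them. The irreducible
-- factors of P over the field of α are not at hand, so R is not built as a field extension: the
-- cofactor of X - α is adjoined as it stands, and the ring obtained is divided by a prime ideal
-- without nonzero integers. Norms and factorisations of ideals are avoided as well: the size of A/J
-- is only ever bounded, through incongruent families. The constants of the lower bound grow with
-- z!, so a single sparse tail of T does not suffice: a second, sparser one is chosen after z.

record ℤ-Algebra : Set₁ where
  field
    commRing : CommutativeRing 0ℓ 0ℓ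
  open CommutativeRing commRing public
    renaming (zero to *-zero; refl to ≈-refl; sym to ≈-sym; trans to ≈-trans)
  field
    -- The ring determines this map, but as a field it can be chosen to compute: the identity on ℤ,
    -- constant lists on polynomials.
    ι   : ℤ → Carrier
    ι-+ : ∀ m n → ι (m ℤ.+ n) ≈ ι m + ι n
    ι-* : ∀ m n → ι (m ℤ.* n) ≈ ι m * ι n
    ι-‿ : ∀ m → ι (ℤ.- m) ≈ - ι m
    ι-0 : ι (+ 0) ≈ 0#
    ι-1 : ι (+ 1) ≈ 1#

  ≡⇒≈ : ∀ {x y} → x ≡ y → x ≈ y
  ≡⇒≈ refl = ≈-refl

  -- The solver's constants 0 and 1 should reify to 0# and 1#, not to ι (+ 0) and ι (+ 1).
  literal : ℤ → Carrier
  literal (+ 0) = 0#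
  literal (+ 1) = 1#
  literal n     = ι n

  literal≈ι : ∀ n → literal n ≈ ι n
  literal≈ι (+ 0)             = ≈-sym ι-0
  literal≈ι (+ 1)             = ≈-sym ι-1
  literal≈ι (+ suc (suc n))   = ≈-refl
  literal≈ι (-[1+ n ])        = ≈-refl

module Solver (A : ℤ-Algebra) where
  open ℤ-Algebra A
  private
    viaι₂ : (f : ℤ → ℤ → ℤ) (g : Carrier → Carrier → Carrier) →
            (∀ {a b c d} → a ≈ b → c ≈ d → g a c ≈ g b d) →
            (∀ m n → ι (f m n) ≈ g (ι m) (ι n)) → ∀ m n → literal (f m n) ≈ g (literal m) (literal n)
    viaι₂ f g g-cong eq m n = ≈-trans (literal≈ι (f m n)) (≈-trans (eq m n)
      (≈-sym (g-cong (literal≈ι m) (literal≈ι n))))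

    morphism : ℤ.+-*-rawRing ACR.-Raw-AlmostCommutative⟶ ACR.fromCommutativeRing commRing
    morphism = record
      { ⟦_⟧    = literal
      ; +-homo = viaι₂ ℤ._+_ _+_ +-cong ι-+
      ; *-homo = viaι₂ ℤ._*_ _*_ *-cong ι-*
      ; -‿homo = λ m → ≈-trans (literal≈ι (ℤ.- m)) (≈-trans (ι-‿ m) (≈-sym (-‿cong (literal≈ι m))))
      ; 0-homo = ≈-refl
      ; 1-homo = ≈-refl
      }

    literal≟ : ∀ m n → Maybe (literal m ≈ literal n)
    literal≟ m n with m ℤ.≟ n
    ... | yes m≡n = just (≡⇒≈ (cong literal m≡n))
    ... | no  _   = nothing

  open RingSolver ℤ.+-*-rawRing (ACR.fromCommutativeRing commRing) morphism literal≟ public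
    using (solve; _:+_; _:*_; _:-_; :-_; _:=_; con)

module PolyRing (A : ℤ-Algebra) where
  open ℤ-Algebra A
  open Solver A
  open SetoidReasoning setoid
  open Polynomial (RawRing.rawSemiring rawRing) public
    using (coeff; _≈ₚ_; _+ₚ_; _*ₚ_) renaming (eval to evalₚ)

  infix 4 _≋_
  -- A record, so that the compared lists can be inferred.
  record _≋_ (p q : List Carrier) : Set where
    constructor mk
    field at : p ≈ₚ q
  open _≋_ public

  infix 8 -ₚ_
  -ₚ_ : List Carrier → List Carrier
  -ₚ_ = map (λ a → - a)

  coeff-+ : ∀ p q k → coeff (p +ₚ q) k ≈ coeff p k + coeff q k
  coeff-+ []      q       k       = ≈-sym (+-identityˡ _)
  coeff-+ (a ∷ p) []      k       = ≈-sym (+-identityʳ _)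
  coeff-+ (a ∷ p) (b ∷ q) zero    = ≈-refl
  coeff-+ (a ∷ p) (b ∷ q) (suc k) = coeff-+ p q k

  coeff-scale : ∀ a q k → coeff (map (a *_) q) k ≈ a * coeff q k
  coeff-scale a []      k       = ≈-sym (zeroʳ a)
  coeff-scale a (b ∷ q) zero    = ≈-refl
  coeff-scale a (b ∷ q) (suc k) = coeff-scale a q k

  coeff-neg : ∀ p k → coeff (-ₚ p) k ≈ - coeff p k
  coeff-neg []      k       = solve 0 (con (+ 0) := :- con (+ 0)) ≈-refl
  coeff-neg (a ∷ p) zero    = ≈-refl
  coeff-neg (a ∷ p) (suc k) = coeff-neg p k

  ≋-refl : ∀ {p} → p ≋ p
  ≋-refl = mk λ _ → ≈-refl

  ≋-sym : ∀ {p q} → p ≋ q → q ≋ p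
  ≋-sym (mk e) = mk λ k → ≈-sym (e k)

  ≋-trans : ∀ {p q r} → p ≋ q → q ≋ r → p ≋ r
  ≋-trans (mk e) (mk f) = mk λ k → ≈-trans (e k) (f k)

  ∷-cong : ∀ {a b p q} → a ≈ b → p ≋ q → a ∷ p ≋ b ∷ q
  ∷-cong e (mk f) = mk λ { zero → e ; (suc k) → f k }

  ∷≋[] : ∀ {a p} → a ≈ 0# → p ≋ [] → a ∷ p ≋ []
  ∷≋[] e (mk f) = mk λ { zero → e ; (suc k) → f k }

  tail≋ : ∀ {a b p q} → a ∷ p ≋ b ∷ q → p ≋ q
  tail≋ (mk e) = mk λ k → e (suc k)

  +ₚ-cong : ∀ {p p′ q q′} → p ≋ p′ → q ≋ q′ → p +ₚ q ≋ p′ +ₚ q′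
  +ₚ-cong {p} {p′} {q} {q′} (mk e) (mk f) = mk λ k → begin
    coeff (p +ₚ q) k         ≈⟨ coeff-+ p q k ⟩
    coeff p k + coeff q k    ≈⟨ +-cong (e k) (f k) ⟩
    coeff p′ k + coeff q′ k  ≈⟨ coeff-+ p′ q′ k ⟨
    coeff (p′ +ₚ q′) k       ∎

  scale-cong : ∀ {a b p q} → a ≈ b → p ≋ q → map (a *_) p ≋ map (b *_) q
  scale-cong {a} {b} {p} {q} e (mk f) = mk λ k →
    ≈-trans (coeff-scale a p k) (≈-trans (*-cong e (f k)) (≈-sym (coeff-scale b q k)))

  +ₚ-assoc : ∀ p q r → (p +ₚ q) +ₚ r ≋ p +ₚ (q +ₚ r)
  +ₚ-assoc p q r = mk λ k → begin
    coeff ((p +ₚ q) +ₚ r) k                ≈⟨ coeff-+ (p +ₚ q) r k ⟩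
    coeff (p +ₚ q) k + coeff r k           ≈⟨ +-congʳ (coeff-+ p q k) ⟩
    (coeff p k + coeff q k) + coeff r k    ≈⟨ +-assoc _ _ _ ⟩
    coeff p k + (coeff q k + coeff r k)    ≈⟨ +-congˡ (coeff-+ q r k) ⟨
    coeff p k + coeff (q +ₚ r) k           ≈⟨ coeff-+ p (q +ₚ r) k ⟨
    coeff (p +ₚ (q +ₚ r)) k                ∎

  +ₚ-comm : ∀ p q → p +ₚ q ≋ q +ₚ p
  +ₚ-comm p q = mk λ k → ≈-trans (coeff-+ p q k) (≈-trans (+-comm _ _) (≈-sym (coeff-+ q p k)))

  +ₚ-identityʳ : ∀ p → p +ₚ [] ≋ p
  +ₚ-identityʳ p = mk λ k → ≈-trans (coeff-+ p [] k) (+-identityʳ _)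

  -ₚ-inverseʳ : ∀ p → p +ₚ -ₚ p ≋ []
  -ₚ-inverseʳ p = mk λ k →
    ≈-trans (coeff-+ p (-ₚ p) k) (≈-trans (+-congˡ (coeff-neg p k)) (-‿inverseʳ _))

  +ₚ-swap : ∀ p q r s → (p +ₚ q) +ₚ (r +ₚ s) ≋ (p +ₚ r) +ₚ (q +ₚ s)
  +ₚ-swap p q r s = mk λ k → begin
    coeff ((p +ₚ q) +ₚ (r +ₚ s)) k  ≈⟨ expand p q r s k ⟩
    (coeff p k + coeff q k) + (coeff r k + coeff s k)
      ≈⟨ solve 4 (λ x y z w → (x :+ y) :+ (z :+ w) := (x :+ z) :+ (y :+ w)) ≈-refl _ _ _ _ ⟩
    (coeff p k + coeff r k) + (coeff q k + coeff s k) ≈⟨ expand p r q s k ⟨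
    coeff ((p +ₚ r) +ₚ (q +ₚ s)) k ∎
    where
    expand : ∀ p q r s k → coeff ((p +ₚ q) +ₚ (r +ₚ s)) k ≈ (coeff p k + coeff q k) + (coeff r k + coeff s k)
    expand p q r s k = ≈-trans (coeff-+ (p +ₚ q) (r +ₚ s) k) (+-cong (coeff-+ p q k) (coeff-+ r s k))

  scale-+ₚ : ∀ a p q → map (a *_) (p +ₚ q) ≋ map (a *_) p +ₚ map (a *_) q
  scale-+ₚ a p q = mk λ k → begin
    coeff (map (a *_) (p +ₚ q)) k             ≈⟨ coeff-scale a (p +ₚ q) k ⟩
    a * coeff (p +ₚ q) k                      ≈⟨ *-congˡ (coeff-+ p q k) ⟩
    a * (coeff p k + coeff q k)               ≈⟨ distribˡ a _ _ ⟩
    a * coeff p k + a * coeff q k             ≈⟨ +-cong (coeff-scale a p k) (coeff-scale a q k) ⟨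
    coeff (map (a *_) p) k + coeff (map (a *_) q) k ≈⟨ coeff-+ (map (a *_) p) (map (a *_) q) k ⟨
    coeff (map (a *_) p +ₚ map (a *_) q) k    ∎

  scale-scale : ∀ a b p → map (a *_) (map (b *_) p) ≋ map ((a * b) *_) p
  scale-scale a b p = mk λ k → begin
    coeff (map (a *_) (map (b *_) p)) k ≈⟨ coeff-scale a (map (b *_) p) k ⟩
    a * coeff (map (b *_) p) k          ≈⟨ *-congˡ (coeff-scale b p k) ⟩
    a * (b * coeff p k)                 ≈⟨ *-assoc a b _ ⟨
    (a * b) * coeff p k                 ≈⟨ coeff-scale (a * b) p k ⟨
    coeff (map ((a * b) *_) p) k        ∎

  scale-one : ∀ {a} → a ≈ 1# → ∀ p → map (a *_) p ≋ p
  scale-one e p = mk λ k → ≈-trans (coeff-scale _ p k) (≈-trans (*-congʳ e) (*-identityˡ _))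

  scale-zero : ∀ {a} → a ≈ 0# → ∀ p → map (a *_) p ≋ []
  scale-zero e p = mk λ k → ≈-trans (coeff-scale _ p k) (≈-trans (*-congʳ e) (zeroˡ _))

  0∷[] : 0# ∷ [] ≋ []
  0∷[] = ∷≋[] ≈-refl ≋-refl

  shift-+ₚ : ∀ p q → 0# ∷ (p +ₚ q) ≋ (0# ∷ p) +ₚ (0# ∷ q)
  shift-+ₚ p q = ∷-cong (≈-sym (+-identityˡ 0#)) ≋-refl

  *ₚ-zeroʳ : ∀ p → p *ₚ [] ≋ []
  *ₚ-zeroʳ []      = ≋-refl
  *ₚ-zeroʳ (a ∷ p) = ∷≋[] ≈-refl (*ₚ-zeroʳ p)

  *ₚ-congˡ : ∀ p {q q′} → q ≋ q′ → p *ₚ q ≋ p *ₚ q′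
  *ₚ-congˡ []      e = ≋-refl
  *ₚ-congˡ (a ∷ p) e = +ₚ-cong (scale-cong ≈-refl e) (∷-cong ≈-refl (*ₚ-congˡ p e))

  -- The mirror image of the recursion that defines `_*ₚ_`; commutativity then follows by induction
  -- on the left factor.
  *ₚ-∷ : ∀ p b q → p *ₚ (b ∷ q) ≋ map (b *_) p +ₚ (0# ∷ p *ₚ q)
  *ₚ-∷ []      b q = ≋-sym 0∷[]
  *ₚ-∷ (a ∷ p) b q = ∷-cong (+-congʳ (*-comm a b)) (≋-trans (+ₚ-cong (≋-refl {map (a *_) q}) (*ₚ-∷ p b q))
    (≋-trans (≋-sym (+ₚ-assoc (map (a *_) q) (map (b *_) p) (0# ∷ p *ₚ q)))
    (≋-trans (+ₚ-cong (+ₚ-comm (map (a *_) q) (map (b *_) p)) ≋-refl)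
      (+ₚ-assoc (map (b *_) p) (map (a *_) q) (0# ∷ p *ₚ q)))))

  *ₚ-comm : ∀ p q → p *ₚ q ≋ q *ₚ p
  *ₚ-comm []      q = ≋-sym (*ₚ-zeroʳ q)
  *ₚ-comm (a ∷ p) q = ≋-trans (+ₚ-cong (≋-refl {map (a *_) q}) (∷-cong ≈-refl (*ₚ-comm p q))) (≋-sym (*ₚ-∷ q a p))

  -- Equal polynomials may be lists of different lengths, which hampers an induction on the left
  -- factor; commutativity moves that factor to the right.
  *ₚ-cong : ∀ {p p′ q q′} → p ≋ p′ → q ≋ q′ → p *ₚ q ≋ p′ *ₚ q′
  *ₚ-cong {p} {p′} {q} {q′} e f = ≋-trans (*ₚ-congˡ p f) (≋-trans (*ₚ-comm p q′)
    (≋-trans (*ₚ-congˡ q′ e) (*ₚ-comm q′ p′)))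

  *ₚ-distribˡ : ∀ p q r → p *ₚ (q +ₚ r) ≋ p *ₚ q +ₚ p *ₚ r
  *ₚ-distribˡ []      q r = ≋-refl
  *ₚ-distribˡ (a ∷ p) q r =
    ≋-trans (+ₚ-cong (scale-+ₚ a q r) (≋-trans (∷-cong ≈-refl (*ₚ-distribˡ p q r)) (shift-+ₚ (p *ₚ q) (p *ₚ r))))
            (+ₚ-swap (map (a *_) q) (map (a *_) r) (0# ∷ p *ₚ q) (0# ∷ p *ₚ r))

  *ₚ-distribʳ : ∀ r p q → (p +ₚ q) *ₚ r ≋ p *ₚ r +ₚ q *ₚ r
  *ₚ-distribʳ r p q = ≋-trans (*ₚ-comm (p +ₚ q) r) (≋-trans (*ₚ-distribˡ r p q)
    (+ₚ-cong (*ₚ-comm r p) (*ₚ-comm r q)))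

  scale-*ₚ : ∀ a p q → map (a *_) p *ₚ q ≋ map (a *_) (p *ₚ q)
  scale-*ₚ a []      q = ≋-refl
  scale-*ₚ a (b ∷ p) q = ≋-trans
    (+ₚ-cong (≋-sym (scale-scale a b q))
             (∷-cong (≈-sym (zeroʳ a)) (scale-*ₚ a p q)))
    (≋-sym (scale-+ₚ a (map (b *_) q) (0# ∷ p *ₚ q)))

  shift-*ₚ : ∀ p q → (0# ∷ p) *ₚ q ≋ 0# ∷ (p *ₚ q)
  shift-*ₚ p q = +ₚ-cong (scale-zero ≈-refl q) ≋-refl

  *ₚ-assoc : ∀ p q r → (p *ₚ q) *ₚ r ≋ p *ₚ (q *ₚ r)
  *ₚ-assoc []      q r = ≋-refl
  *ₚ-assoc (a ∷ p) q r = ≋-trans (*ₚ-distribʳ r (map (a *_) q) (0# ∷ p *ₚ q))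
    (+ₚ-cong (scale-*ₚ a q r) (≋-trans (shift-*ₚ (p *ₚ q) r) (∷-cong ≈-refl (*ₚ-assoc p q r))))

  const-*ₚ : ∀ a q → (a ∷ []) *ₚ q ≋ map (a *_) q
  const-*ₚ a q = ≋-trans (+ₚ-cong (≋-refl {map (a *_) q}) 0∷[]) (+ₚ-identityʳ _)

  *ₚ-identityˡ : ∀ q → (1# ∷ []) *ₚ q ≋ q
  *ₚ-identityˡ q = ≋-trans (const-*ₚ 1# q) (scale-one ≈-refl q)

  commutativeRing : CommutativeRing 0ℓ 0ℓ
  commutativeRing = record
    { Carrier = List Carrier ; _≈_ = _≋_ ; _+_ = _+ₚ_ ; _*_ = _*ₚ_ ; -_ = -ₚ_ ; 0# = [] ; 1# = 1# ∷ []
    ; isCommutativeRing = record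
      { isRing = record
        { +-isAbelianGroup = record
          { isGroup = record
            { isMonoid = record
              { isSemigroup = record
                { isMagma = record
                  { isEquivalence = record { refl = ≋-refl ; sym = ≋-sym ; trans = ≋-trans }
                  ; ∙-cong = +ₚ-cong }
                ; assoc = +ₚ-assoc }
              ; identity = (λ p → ≋-refl) , +ₚ-identityʳ }
            ; inverse = (λ p → ≋-trans (+ₚ-comm (-ₚ p) p) (-ₚ-inverseʳ p)) , -ₚ-inverseʳ
            ; ⁻¹-cong = λ { {p} {q} (mk e) → mk λ k →
                ≈-trans (coeff-neg p k) (≈-trans (-‿cong (e k)) (≈-sym (coeff-neg q k))) } }
          ; comm = +ₚ-comm }
        ; *-cong = *ₚ-cong
        ; *-assoc = *ₚ-assoc
        ; *-identity = *ₚ-identityˡ , λ q → ≋-trans (*ₚ-comm q (1# ∷ [])) (*ₚ-identityˡ q)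
        ; distrib = *ₚ-distribˡ , *ₚ-distribʳ }
      ; *-comm = *ₚ-comm } }

  algebra : ℤ-Algebra
  algebra = record
    { commRing = commutativeRing
    ; ι    = λ n → ι n ∷ []
    ; ι-+  = λ m n → ∷-cong (ι-+ m n) ≋-refl
    ; ι-*  = λ m n → ≋-trans (∷-cong (ι-* m n) ≋-refl) (≋-sym (const-*ₚ (ι m) (ι n ∷ [])))
    ; ι-‿  = λ m → ∷-cong (ι-‿ m) ≋-refl
    ; ι-0  = ∷≋[] ι-0 ≋-refl
    ; ι-1  = ∷-cong ι-1 ≋-refl }

module Ideals (A : ℤ-Algebra) where
  open ℤ-Algebra A
  open Solver A

  record Ideal : Set₁ where
    infix 4 _∈I
    field
      _∈I  : Carrier → Set
      resp : ∀ {x y} → x ≈ y → x ∈I → y ∈I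
      0∈   : 0# ∈I
      +∈   : ∀ {x y} → x ∈I → y ∈I → x + y ∈I
      *∈   : ∀ r {x} → x ∈I → r * x ∈I

    neg∈ : ∀ {x} → x ∈I → - x ∈I
    neg∈ {x} x∈ = resp (solve 1 (λ x → :- con (+ 1) :* x := :- x) ≈-refl x) (*∈ (- 1#) x∈)

    -∈ : ∀ {x y} → x ∈I → y ∈I → x - y ∈I
    -∈ x∈ y∈ = +∈ x∈ (neg∈ y∈)

    *∈ʳ : ∀ {x} → x ∈I → ∀ r → x * r ∈I
    *∈ʳ {x} x∈ r = resp (*-comm r x) (*∈ r x∈)

  zeroIdeal : Ideal
  zeroIdeal = record
    { _∈I  = _≈ 0#
    ; resp = λ x≈y x≈0 → ≈-trans (≈-sym x≈y) x≈0
    ; 0∈   = ≈-refl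
    ; +∈   = λ x≈0 y≈0 → ≈-trans (+-cong x≈0 y≈0) (+-identityˡ 0#)
    ; *∈   = λ r x≈0 → ≈-trans (*-congˡ x≈0) (zeroʳ r) }

  principal : Carrier → Ideal
  principal f = record
    { _∈I  = λ x → ∃[ h ] x ≈ h * f
    ; resp = λ { e (h , eq) → h , ≈-trans (≈-sym e) eq }
    ; 0∈   = 0# , ≈-sym (zeroˡ f)
    ; +∈   = λ { (h , e) (k , e′) → h + k , ≈-trans (+-cong e e′) (≈-sym (distribʳ f h k)) }
    ; *∈   = λ { r (h , e) → r * h , ≈-trans (*-congˡ e) (≈-sym (*-assoc r h f)) } }

  module _ (J : Ideal) where
    open Ideal J

    infix 4 _≈[]_
    record _≈[]_ (x y : Carrier) : Set where
      constructor mk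
      field diff : x - y ∈I
    open _≈[]_ public

    ≈⇒≈[] : ∀ {x y} → x ≈ y → x ≈[] y
    ≈⇒≈[] {x} {y} e = mk (resp (≈-sym (≈-trans (+-congʳ e) (-‿inverseʳ y))) 0∈)

    quotientRing : CommutativeRing 0ℓ 0ℓ
    quotientRing = record
      { Carrier = Carrier ; _≈_ = _≈[]_ ; _+_ = _+_ ; _*_ = _*_ ; -_ = -_ ; 0# = 0# ; 1# = 1#
      ; isCommutativeRing = record
        { isRing = record
          { +-isAbelianGroup = record
            { isGroup = record
              { isMonoid = record
                { isSemigroup = record
                  { isMagma = record
                    { isEquivalence = record
                      { refl = ≈⇒≈[] ≈-refl
                      ; sym = λ { {x} {y} (mk d) → mk (resp
                          (solve 2 (λ x y → :- (x :- y) := y :- x) ≈-refl x y) (neg∈ d)) }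
                      ; trans = λ { {x} {y} {z} (mk d) (mk e) → mk (resp
                          (solve 3 (λ x y z → (x :- y) :+ (y :- z) := x :- z) ≈-refl x y z) (+∈ d e)) } }
                    ; ∙-cong = λ { {x} {y} {u} {v} (mk d) (mk e) → mk (resp
                        (solve 4 (λ x y u v → (x :- y) :+ (u :- v) := (x :+ u) :- (y :+ v)) ≈-refl x y u v)
                        (+∈ d e)) } }
                  ; assoc = λ x y z → ≈⇒≈[] (+-assoc x y z) }
                ; identity = (λ x → ≈⇒≈[] (+-identityˡ x)) , (λ x → ≈⇒≈[] (+-identityʳ x)) }
              ; inverse = (λ x → ≈⇒≈[] (-‿inverseˡ x)) , (λ x → ≈⇒≈[] (-‿inverseʳ x))
              ; ⁻¹-cong = λ { {x} {y} (mk d) → mk (resp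
                  (solve 2 (λ x y → :- (x :- y) := :- x :- :- y) ≈-refl x y) (neg∈ d)) } }
            ; comm = λ x y → ≈⇒≈[] (+-comm x y) }
          ; *-cong = λ { {x} {y} {u} {v} (mk d) (mk e) → mk (resp
              (solve 4 (λ x y u v → u :* (x :- y) :+ y :* (u :- v) := x :* u :- y :* v) ≈-refl x y u v)
              (+∈ (*∈ u d) (*∈ y e))) }
          ; *-assoc = λ x y z → ≈⇒≈[] (*-assoc x y z)
          ; *-identity = (λ x → ≈⇒≈[] (*-identityˡ x)) , (λ x → ≈⇒≈[] (*-identityʳ x))
          ; distrib = (λ x y z → ≈⇒≈[] (distribˡ x y z)) , (λ x y z → ≈⇒≈[] (distribʳ x y z)) }
        ; *-comm = λ x y → ≈⇒≈[] (*-comm x y) } }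

    quotient : ℤ-Algebra
    quotient = record
      { commRing = quotientRing ; ι = ι
      ; ι-+ = λ m n → ≈⇒≈[] (ι-+ m n) ; ι-* = λ m n → ≈⇒≈[] (ι-* m n) ; ι-‿ = λ m → ≈⇒≈[] (ι-‿ m)
      ; ι-0 = ≈⇒≈[] ι-0 ; ι-1 = ≈⇒≈[] ι-1 }

    ≈[]0⇒∈ : ∀ {x} → x ≈[] 0# → x ∈I
    ≈[]0⇒∈ {x} (mk d) = resp (solve 1 (λ x → x :- con (+ 0) := x) ≈-refl x) d

    ∈⇒≈[]0 : ∀ {x} → x ∈I → x ≈[] 0#
    ∈⇒≈[]0 {x} d = mk (resp (solve 1 (λ x → x := x :- con (+ 0)) ≈-refl x) d)

ℤ-algebra : ℤ-Algebra
ℤ-algebra = record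
  { commRing = ℤ.+-*-commutativeRing ; ι = id
  ; ι-+ = λ _ _ → refl ; ι-* = λ _ _ → refl ; ι-‿ = λ _ → refl ; ι-0 = refl ; ι-1 = refl }

-- Degrees, division and evaluation of polynomials

module PolyProperties (A : ℤ-Algebra) where
  open ℤ-Algebra A
  open Solver A
  open PolyRing A
  private module P = ℤ-Algebra algebra
  open SetoidReasoning setoid

  Vanishes : List Carrier → ℕ → Set
  Vanishes p k = ∀ j → k ≤ j → coeff p j ≈ 0#

  vanishes-length : ∀ p → Vanishes p (length p)
  vanishes-length []      j       _         = ≈-refl
  vanishes-length (a ∷ p) (suc j) (s≤s len≤j) = vanishes-length p j len≤j

  vanishes-tail : ∀ {a p n} → Vanishes (a ∷ p) (suc n) → Vanishes p n
  vanishes-tail van j n≤j = van (suc j) (s≤s n≤j)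

  vanishes-mono : ∀ {p m n} → m ≤ n → Vanishes p m → Vanishes p n
  vanishes-mono m≤n van j n≤j = van j (ℕ.≤-trans m≤n n≤j)

  vanishes0⇒≋[] : ∀ {p} → Vanishes p 0 → p ≋ []
  vanishes0⇒≋[] van = mk λ k → van k z≤n

  coeff-*-∷ : ∀ b v f k → coeff ((b ∷ v) *ₚ f) k ≈ b * coeff f k + coeff (0# ∷ v *ₚ f) k
  coeff-*-∷ b v f k = ≈-trans (coeff-+ (map (b *_) f) (0# ∷ v *ₚ f) k) (+-congʳ (coeff-scale b f k))

  coeff-top : ∀ v f n e → Vanishes v (suc n) → Vanishes f (suc e) →
              coeff (v *ₚ f) (n ℕ.+ e) ≈ coeff v n * coeff f e
  coeff-top []      f n       e van-v van-f = ≈-sym (zeroˡ _)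
  coeff-top (b ∷ v) f zero    e van-v van-f = begin
    coeff ((b ∷ v) *ₚ f) e                      ≈⟨ coeff-*-∷ b v f e ⟩
    b * coeff f e + coeff (0# ∷ v *ₚ f) e       ≈⟨ +-congˡ (at shifted e) ⟩
    b * coeff f e + 0#                          ≈⟨ +-identityʳ _ ⟩
    b * coeff f e                               ∎
    where
    shifted : 0# ∷ v *ₚ f ≋ []
    shifted = ∷≋[] ≈-refl (*ₚ-cong {v} {[]} {f} {f} (vanishes0⇒≋[] (vanishes-tail van-v)) ≋-refl)
  coeff-top (b ∷ v) f (suc n) e van-v van-f = begin
    coeff ((b ∷ v) *ₚ f) (suc n ℕ.+ e)                  ≈⟨ coeff-*-∷ b v f (suc n ℕ.+ e) ⟩
    b * coeff f (suc n ℕ.+ e) + coeff (v *ₚ f) (n ℕ.+ e)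
      ≈⟨ +-cong (*-congˡ (van-f (suc (n ℕ.+ e)) (s≤s (ℕ.m≤n+m e n)))) (coeff-top v f n e (vanishes-tail van-v) van-f) ⟩
    b * 0# + coeff v n * coeff f e                      ≈⟨ solve 2 (λ b c → b :* con (+ 0) :+ c := c) ≈-refl b _ ⟩
    coeff v n * coeff f e                               ∎

  -- The product has the entry `coeff v n * coeff f e` in place n + e as long as v vanishes beyond
  -- n, so the entries of v vanish one after the other from the top.
  cancel-lead : ∀ f e → Vanishes f (suc e) → (∀ x → x * coeff f e ≈ 0# → x ≈ 0#) →
                ∀ v → Vanishes (v *ₚ f) e → v ≋ []
  cancel-lead f e van-f cancel v van = vanishes0⇒≋[] (go (length v) (vanishes-length v))
    where
    go : ∀ n → Vanishes v n → Vanishes v 0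
    go zero    van-v = van-v
    go (suc n) van-v = go n λ j n≤j → case ℕ.m≤n⇒m<n∨m≡n n≤j of λ where
      (inj₁ n<j)  → van-v j n<j
      (inj₂ refl) → cancel _ (≈-trans (≈-sym (coeff-top v f n e van-v van-f)) (van (n ℕ.+ e) (ℕ.m≤n+m e n)))

  X^_·_ : ℕ → List Carrier → List Carrier
  X^ zero  · p = p
  X^ suc l · p = 0# ∷ (X^ l · p)

  coeff-X^ : ∀ l p j → coeff (X^ l · p) (l ℕ.+ j) ≡ coeff p j
  coeff-X^ zero    p j = refl
  coeff-X^ (suc l) p j = coeff-X^ l p j

  X^-*ₚ : ∀ l p → (X^ l · (1# ∷ [])) *ₚ p ≋ X^ l · p
  X^-*ₚ zero    p = *ₚ-identityˡ p
  X^-*ₚ (suc l) p = ≋-trans (shift-*ₚ (X^ l · (1# ∷ [])) p) (∷-cong ≈-refl (X^-*ₚ l p))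

  power : Carrier → ℕ → Carrier
  power a zero    = 1#
  power a (suc l) = power a l * a

  -- Each of the `l` steps multiplies h by the leading coefficient of g instead of dividing by it.
  -- This serves both Euclid's algorithm over ℤ and, for monic g, honest division.
  pseudoDivide : ∀ g k → Vanishes g (suc k) → ∀ l h → Vanishes h (k ℕ.+ l) →
                 ∃₂ λ q r → Vanishes r k × (power (coeff g k) l ∷ []) *ₚ h ≋ q *ₚ g +ₚ r
  pseudoDivide g k van-g zero    h van-h =
    [] , h , (λ j k≤j → van-h j (ℕ.≤-trans (ℕ.≤-reflexive (ℕ.+-identityʳ k)) k≤j)) , *ₚ-identityˡ h
  pseudoDivide g k van-g (suc l) h van-h = q +ₚ ((c ∷ []) *ₚ (b ∷ []) *ₚ x) , r , van-r , identity
    where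
    a b c : Carrier
    a = coeff g k
    -- The highest coefficient that h can have, so that a h - b X^l g vanishes one place earlier.
    b = coeff h (k ℕ.+ l)
    c = power a l
    x h′ : List Carrier
    x = X^ l · (1# ∷ [])
    h′ = (a ∷ []) *ₚ h +ₚ -ₚ ((b ∷ []) *ₚ (x *ₚ g))
    coeff-const-* : ∀ a p j → coeff ((a ∷ []) *ₚ p) j ≈ a * coeff p j
    coeff-const-* a p j = ≈-trans (at (const-*ₚ a p) j) (coeff-scale a p j)
    coeff-h′ : ∀ i → coeff h′ (l ℕ.+ i) ≈ a * coeff h (l ℕ.+ i) - b * coeff g i
    coeff-h′ i = begin
      coeff h′ (l ℕ.+ i) ≈⟨ coeff-+ ((a ∷ []) *ₚ h) _ (l ℕ.+ i) ⟩
      coeff ((a ∷ []) *ₚ h) (l ℕ.+ i) + coeff (-ₚ ((b ∷ []) *ₚ (x *ₚ g))) (l ℕ.+ i)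
        ≈⟨ +-cong (coeff-const-* a h (l ℕ.+ i)) (≈-trans (coeff-neg ((b ∷ []) *ₚ (x *ₚ g)) (l ℕ.+ i)) (-‿cong
             (≈-trans (coeff-const-* b (x *ₚ g) (l ℕ.+ i)) (*-congˡ (≈-trans (at (X^-*ₚ l g) (l ℕ.+ i)) (≡⇒≈ (coeff-X^ l g i))))))) ⟩
      a * coeff h (l ℕ.+ i) - b * coeff g i ∎
    van-h′ : Vanishes h′ (k ℕ.+ l)
    van-h′ j k+l≤j with ℕ.m≤n⇒∃[o]m+o≡n k+l≤j
    ... | zero , refl = ≈-trans (≡⇒≈ (cong (coeff h′) (ℕ.+-identityʳ (k ℕ.+ l))))
      (≈-trans (≡⇒≈ (cong (coeff h′) (ℕ.+-comm k l))) (≈-trans (coeff-h′ k)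
        (≈-trans (+-congʳ (*-congˡ (≡⇒≈ (cong (coeff h) (ℕ.+-comm l k)))))
          (solve 2 (λ a b → a :* b :- b :* a := con (+ 0)) ≈-refl a b))))
    ... | suc o , refl = ≈-trans (≡⇒≈ (cong (coeff h′) reassoc)) (≈-trans (coeff-h′ (k ℕ.+ suc o))
      (≈-trans (+-cong (*-congˡ (van-h _ (ℕ.≤-trans
                  (ℕ.≤-reflexive (ℕ.+-suc k l)) (ℕ.≤-trans (ℕ.m≤m+n (suc (k ℕ.+ l)) o) (ℕ.≤-reflexive (≡.trans (≡.sym (ℕ.+-suc (k ℕ.+ l) o)) reassoc))))))
                (-‿cong (*-congˡ (van-g (k ℕ.+ suc o) (ℕ.≤-trans (ℕ.m≤m+n (suc k) o) (ℕ.≤-reflexive (≡.sym (ℕ.+-suc k o))))))))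
        (solve 2 (λ a b → a :* con (+ 0) :- b :* con (+ 0) := con (+ 0)) ≈-refl a b)))
      where
      reassoc : k ℕ.+ l ℕ.+ suc o ≡ l ℕ.+ (k ℕ.+ suc o)
      reassoc = ≡.trans (cong (ℕ._+ suc o) (ℕ.+-comm k l)) (ℕ.+-assoc l k (suc o))
    rec : ∃₂ λ q r → Vanishes r k × (c ∷ []) *ₚ h′ ≋ q *ₚ g +ₚ r
    rec = pseudoDivide g k van-g l h′ van-h′
    q r : List Carrier
    q = proj₁ rec
    r = proj₁ (proj₂ rec)
    van-r : Vanishes r k
    van-r = proj₁ (proj₂ (proj₂ rec))
    identity : (c * a ∷ []) *ₚ h ≋ (q +ₚ ((c ∷ []) *ₚ (b ∷ []) *ₚ x)) *ₚ g +ₚ r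
    identity = P.≈-trans (P.*-congʳ {h} (P.≈-sym (const-*ₚ c (a ∷ []))))
      (P.≈-trans (PS.solve 6 (λ c a b x g h → (c PS.:* a) PS.:* h PS.:=
                  c PS.:* (a PS.:* h PS.:- b PS.:* (x PS.:* g)) PS.:+ (c PS.:* b PS.:* x) PS.:* g)
                  P.≈-refl (c ∷ []) (a ∷ []) (b ∷ []) x g h)
      (P.≈-trans (P.+-congʳ {((c ∷ []) *ₚ (b ∷ []) *ₚ x) *ₚ g} (proj₂ (proj₂ (proj₂ rec))))
      (PS.solve 4 (λ q g r y → (q PS.:* g PS.:+ r) PS.:+ y PS.:* g PS.:= (q PS.:+ y) PS.:* g PS.:+ r)
        P.≈-refl q g r ((c ∷ []) *ₚ (b ∷ []) *ₚ x))))
      where module PS = Solver algebra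

  evalₚ-cong : ∀ {p q} x → p ≋ q → evalₚ p x ≈ evalₚ q x
  evalₚ-cong {[]}    {[]}    x e = ≈-refl
  evalₚ-cong {[]}    {b ∷ q} x e = ≈-sym (evalₚ-zero (b ∷ q) (≋-sym e))
    where
    evalₚ-zero : ∀ p → p ≋ [] → evalₚ p x ≈ 0#
    evalₚ-zero []      e = ≈-refl
    evalₚ-zero (a ∷ p) e = ≈-trans (+-cong (at e 0) (*-congˡ (evalₚ-zero p (mk λ k → at e (suc k)))))
      (solve 1 (λ x → con (+ 0) :+ x :* con (+ 0) := con (+ 0)) ≈-refl x)
  evalₚ-cong {a ∷ p} {[]}    x e =
    ≈-trans (+-cong (at e 0) (*-congˡ (evalₚ-cong {p} {[]} x (mk λ k → at e (suc k)))))
      (solve 1 (λ x → con (+ 0) :+ x :* con (+ 0) := con (+ 0)) ≈-refl x)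
  evalₚ-cong {a ∷ p} {b ∷ q} x e = +-cong (at e 0) (*-congˡ (evalₚ-cong {p} {q} x (tail≋ e)))

  evalₚ-+ : ∀ p q x → evalₚ (p +ₚ q) x ≈ evalₚ p x + evalₚ q x
  evalₚ-+ []      q       x = ≈-sym (+-identityˡ _)
  evalₚ-+ (a ∷ p) []      x = ≈-sym (+-identityʳ _)
  evalₚ-+ (a ∷ p) (b ∷ q) x = ≈-trans (+-congˡ (*-congˡ (evalₚ-+ p q x)))
    (solve 5 (λ a b x u v → (a :+ b) :+ x :* (u :+ v) := (a :+ x :* u) :+ (b :+ x :* v)) ≈-refl a b x _ _)

  evalₚ-scale : ∀ a p x → evalₚ (map (a *_) p) x ≈ a * evalₚ p x
  evalₚ-scale a []      x = ≈-sym (zeroʳ a)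
  evalₚ-scale a (b ∷ p) x = ≈-trans (+-congˡ (*-congˡ (evalₚ-scale a p x)))
    (solve 4 (λ a b x u → a :* b :+ x :* (a :* u) := a :* (b :+ x :* u)) ≈-refl a b x _)

  evalₚ-neg : ∀ p x → evalₚ (-ₚ p) x ≈ - evalₚ p x
  evalₚ-neg []      x = solve 0 (con (+ 0) := :- con (+ 0)) ≈-refl
  evalₚ-neg (b ∷ p) x = ≈-trans (+-congˡ (*-congˡ (evalₚ-neg p x)))
    (solve 3 (λ b x u → :- b :+ x :* :- u := :- (b :+ x :* u)) ≈-refl b x _)

  evalₚ-* : ∀ p q x → evalₚ (p *ₚ q) x ≈ evalₚ p x * evalₚ q x
  evalₚ-* []      q x = ≈-sym (zeroˡ _)
  evalₚ-* (a ∷ p) q x = begin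
    evalₚ (map (a *_) q +ₚ (0# ∷ p *ₚ q)) x           ≈⟨ evalₚ-+ (map (a *_) q) (0# ∷ p *ₚ q) x ⟩
    evalₚ (map (a *_) q) x + (0# + x * evalₚ (p *ₚ q) x)
      ≈⟨ +-cong (evalₚ-scale a q x) (+-congˡ (*-congˡ (evalₚ-* p q x))) ⟩
    a * evalₚ q x + (0# + x * (evalₚ p x * evalₚ q x))
      ≈⟨ solve 4 (λ a x u v → a :* v :+ (con (+ 0) :+ x :* (u :* v)) := (a :+ x :* u) :* v) ≈-refl a x _ _ ⟩
    (a + x * evalₚ p x) * evalₚ q x ∎

  -- The quotient by X - x, whose coefficients are the intermediate values of Horner's scheme.
  synthetic : List Carrier → Carrier → List Carrier
  synthetic []      x = []
  synthetic (a ∷ p) x = evalₚ p x ∷ synthetic p x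

  synthetic-division : ∀ p x → p ≋ (- x ∷ 1# ∷ []) *ₚ synthetic p x +ₚ (evalₚ p x ∷ [])
  synthetic-division []      x = ≋-sym (≋-trans (+ₚ-cong (*ₚ-zeroʳ (- x ∷ 1# ∷ [])) 0∷[]) ≋-refl)
  synthetic-division (a ∷ p) x = ≋-sym (≋-trans
    (+ₚ-cong (*ₚ-∷ (- x ∷ 1# ∷ []) (evalₚ p x) (synthetic p x)) (≋-refl {evalₚ (a ∷ p) x ∷ []}))
    (∷-cong (solve 3 (λ a x u → (u :* (:- x) :+ con (+ 0)) :+ (a :+ x :* u) := a) ≈-refl a x (evalₚ p x))
    (≋-trans (+ₚ-identityʳ _) (≋-trans (+ₚ-comm (evalₚ p x * 1# ∷ []) ((- x ∷ 1# ∷ []) *ₚ synthetic p x))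
    (≋-trans (+ₚ-cong (≋-refl {(- x ∷ 1# ∷ []) *ₚ synthetic p x}) (∷-cong (*-identityʳ (evalₚ p x)) (≋-refl {[]})))
      (≋-sym (synthetic-division p x)))))))

  evalₚ-factor : ∀ p x y → evalₚ p y ≈ (y - x) * evalₚ (synthetic p x) y + evalₚ p x
  evalₚ-factor []      x y = solve 2 (λ x y → con (+ 0) := (y :- x) :* con (+ 0) :+ con (+ 0)) ≈-refl x y
  evalₚ-factor (a ∷ p) x y = ≈-trans (+-congˡ (*-congˡ (evalₚ-factor p x y)))
    (solve 5 (λ a x y u v → a :+ y :* ((y :- x) :* u :+ v) := (y :- x) :* (v :+ y :* u) :+ (a :+ x :* v))
      ≈-refl a x y _ _)

  evalₚ-vanishes : ∀ p x → Vanishes p 0 → evalₚ p x ≈ 0#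
  evalₚ-vanishes p x van = evalₚ-cong {p} {[]} x (vanishes0⇒≋[] van)

  synthetic-vanishes : ∀ p x n → Vanishes p (suc n) → Vanishes (synthetic p x) n
  synthetic-vanishes []      x n       van j       n≤j = ≈-refl
  synthetic-vanishes (a ∷ p) x zero    van zero    n≤j = evalₚ-vanishes p x (vanishes-tail van)
  synthetic-vanishes (a ∷ p) x zero    van (suc j) n≤j =
    synthetic-vanishes p x 0 (λ i 1≤i → van (suc i) (s≤s z≤n)) j z≤n
  synthetic-vanishes (a ∷ p) x (suc n) van (suc j) (s≤s n≤j) =
    synthetic-vanishes p x n (vanishes-tail van) j n≤j

  synthetic-lead : ∀ p x n → Vanishes p (suc (suc n)) → coeff (synthetic p x) n ≈ coeff p (suc n)
  synthetic-lead []      x n       van = ≈-refl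
  synthetic-lead (a ∷ [])    x zero    van = ≈-refl
  synthetic-lead (a ∷ b ∷ p) x zero    van = ≈-trans
    (+-congˡ (*-congˡ (evalₚ-vanishes p x (vanishes-tail (vanishes-tail van)))))
    (solve 2 (λ b x → b :+ x :* con (+ 0) := b) ≈-refl b x)
  synthetic-lead (a ∷ p) x (suc n) van = synthetic-lead p x n (vanishes-tail van)

  derivative : List Carrier → List Carrier
  derivative []      = []
  derivative (a ∷ p) = p +ₚ (0# ∷ derivative p)

  -- The difference quotient at y = x; both sides obey the same recursion. It serves Hensel lifting,
  -- and it identifies the value of Q / (X - α) at α with Q′(α).
  evalₚ-derivative : ∀ p x → evalₚ (derivative p) x ≈ evalₚ (synthetic p x) x
  evalₚ-derivative []      x = ≈-refl
  evalₚ-derivative (a ∷ p) x = ≈-trans (evalₚ-+ p (0# ∷ derivative p) x)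
    (+-congˡ (≈-trans (+-identityˡ _) (*-congˡ (evalₚ-derivative p x))))

  coeff-derivative : ∀ p k → coeff (derivative p) k ≈ ι (+ suc k) * coeff p (suc k)
  coeff-derivative []      k       = ≈-sym (zeroʳ _)
  coeff-derivative (a ∷ p) zero    = ≈-trans (coeff-+ p (0# ∷ derivative p) 0)
    (≈-trans (+-identityʳ _) (≈-sym (≈-trans (*-congʳ ι-1) (*-identityˡ _))))
  coeff-derivative (a ∷ p) (suc k) = begin
    coeff (p +ₚ (0# ∷ derivative p)) (suc k)          ≈⟨ coeff-+ p (0# ∷ derivative p) (suc k) ⟩
    coeff p (suc k) + coeff (derivative p) k          ≈⟨ +-congˡ (coeff-derivative p k) ⟩
    coeff p (suc k) + ι (+ suc k) * coeff p (suc k)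
      ≈⟨ solve 2 (λ c n → c :+ n :* c := (con (+ 1) :+ n) :* c) ≈-refl _ _ ⟩
    (1# + ι (+ suc k)) * coeff p (suc k)              ≈⟨ *-congʳ (≈-trans (+-congʳ (≈-sym ι-1)) (≈-sym (ι-+ (+ 1) (+ suc k)))) ⟩
    ι (+ suc (suc k)) * coeff p (suc k)               ∎

  -- In a quotient of the polynomial ring this makes the class of X a root of every polynomial in
  -- the ideal.
  evalₚ-X : ∀ p → PolyRing.evalₚ algebra (map (_∷ []) p) (0# ∷ 1# ∷ []) ≋ p
  evalₚ-X []      = ≋-refl
  evalₚ-X (a ∷ p) = ≋-trans
    (+ₚ-cong (≋-refl {a ∷ []}) (≋-trans (shift-*ₚ (1# ∷ []) rest) (∷-cong ≈-refl (≋-trans (*ₚ-identityˡ rest) (evalₚ-X p)))))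
    (∷-cong (+-identityʳ a) ≋-refl)
    where rest = PolyRing.evalₚ algebra (map (_∷ []) p) (0# ∷ 1# ∷ [])

-- Pigeonhole principles and finitely generated ℤ-modules

pigeonhole-vectors : ∀ {N D m} → m ^ D < N → (f : Fin N → Fin D → Fin m) →
                     ∃₂ λ i j → i ≢ j × (∀ d → f i d ≡ f j d)
pigeonhole-vectors m^D<N f with Fin.pigeonhole m^D<N (Fin.funToFin ∘ f)
... | i , j , i<j , eq = i , j , Fin.<⇒≢ i<j , λ d →
  ≡.trans (≡.sym (Fin.finToFun-funToFin (f i) d))
    (≡.trans (cong (λ u → Fin.finToFun u d) eq) (Fin.finToFun-funToFin (f j) d))

shiftToFin : ∀ K (c : ℤ) → ∣ c ∣ ≤ K → Fin (suc (K ℕ.+ K))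
shiftToFin K c ∣c∣≤K = fromℕ< {∣ c ℤ.+ + K ∣} (s≤s (ℕ.≤-trans (ℤ.∣i+j∣≤∣i∣+∣j∣ c (+ K)) (ℕ.+-monoˡ-≤ K ∣c∣≤K)))

shiftToFin-injective : ∀ K {c d} (p : ∣ c ∣ ≤ K) (q : ∣ d ∣ ≤ K) →
                       shiftToFin K c p ≡ shiftToFin K d q → c ≡ d
shiftToFin-injective K {c} {d} p q eq = AbelianGroup.∙-cancelʳ ℤ.+-0-abelianGroup (+ K) c d (begin
  c ℤ.+ + K            ≡⟨ ℤ.0≤i⇒+∣i∣≡i (nonneg c p) ⟨
  + ∣ c ℤ.+ + K ∣      ≡⟨ cong +_ (≡.trans (≡.sym (Fin.toℕ-fromℕ< _)) (≡.trans (cong toℕ eq) (Fin.toℕ-fromℕ< _))) ⟩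
  + ∣ d ℤ.+ + K ∣      ≡⟨ ℤ.0≤i⇒+∣i∣≡i (nonneg d q) ⟩
  d ℤ.+ + K            ∎)
  where
  open ≡-Reasoning
  nonneg : ∀ c → ∣ c ∣ ≤ K → + 0 ℤ.≤ c ℤ.+ + K
  nonneg (+ n)    _   = ℤ.+≤+ z≤n
  nonneg -[1+ n ] n<K = subst (+ 0 ℤ.≤_) (≡.sym (ℤ.⊖-≥ n<K)) (ℤ.+≤+ z≤n)

pigeonhole-ℤ : ∀ {N D} K → suc (K ℕ.+ K) ^ D < N → (f : Fin N → Fin D → ℤ) →
               (∀ i d → ∣ f i d ∣ ≤ K) → ∃₂ λ i j → i ≢ j × (∀ d → f i d ≡ f j d)
pigeonhole-ℤ K small f bound with pigeonhole-vectors small (λ i d → shiftToFin K (f i d) (bound i d))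
... | i , j , i≢j , eq = i , j , i≢j , λ d → shiftToFin-injective K (bound i d) (bound j d) (eq d)

-- Ans plays the role of ⊥. For the goal "some odd prime p has no root of P modulo p" this makes excluded middle
-- available, and a proof of Cl A with A := Ans still yields the prime.
module Classical (Ans : Set) where

  Cl : ∀ {ℓ} → Set ℓ → Set ℓ
  Cl A = (A → Ans) → Ans

  lem : ∀ {ℓ} (A : Set ℓ) → Cl (A ⊎ (A → Ans))
  lem A k = k (inj₂ (k ∘ inj₁))

  -- Double negation commutes with finite products, so the classical choices for all elements of a
  -- counting argument can be made at once.
  finite-choice : ∀ {ℓ n} {B : Fin n → Set ℓ} → (∀ i → Cl (B i)) → Cl (∀ i → B i)
  finite-choice {n = zero}  f k = k λ ()
  finite-choice {n = suc n} f k = f zero λ b → finite-choice (f ∘ suc) λ bs →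
    k λ { zero → b ; (suc i) → bs i }

Nonzero : ∀ {D} → (Fin D → ℤ) → Set
Nonzero c = ∃[ i ] c i ≢ + 0

nonzero? : ∀ {D} (c : Fin D → ℤ) → Nonzero c ⊎ (∀ i → c i ≡ + 0)
nonzero? c with Fin.all? (λ i → c i ℤ.≟ + 0)
... | yes all = inj₂ all
... | no ¬all = inj₁ (Fin.¬∀⟶∃¬ _ _ (λ i → c i ℤ.≟ + 0) ¬all)

*≢0 : ∀ {m n} → m ≢ + 0 → n ≢ + 0 → m ℤ.* n ≢ + 0
*≢0 {m} m≢0 n≢0 eq = case ℤ.i*j≡0⇒i≡0∨j≡0 m eq of λ { (inj₁ e) → m≢0 e ; (inj₂ e) → n≢0 e }

sumℤ : ∀ {n} → (Fin n → ℤ) → ℤ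
sumℤ = Sum.sum ℤ.+-*-semiring

∣sumℤ∣≤ : ∀ {n} (f : Fin n → ℤ) K → (∀ i → ∣ f i ∣ ≤ K) → ∣ sumℤ f ∣ ≤ n ℕ.* K
∣sumℤ∣≤ {zero}  f K bound = z≤n
∣sumℤ∣≤ {suc n} f K bound = ℕ.≤-trans (ℤ.∣i+j∣≤∣i∣+∣j∣ (f zero) (sumℤ (f ∘ suc)))
  (ℕ.+-mono-≤ (bound zero) (∣sumℤ∣≤ (f ∘ suc) K (bound ∘ suc)))

maxOf : ∀ {n} (f : Fin n → ℕ) → ∃[ K ] ∀ i → f i ≤ K
maxOf {zero}  f = 0 , λ ()
maxOf {suc n} f with maxOf (f ∘ suc)
... | K , bound = f zero ℕ.⊔ K , λ { zero → ℕ.m≤m⊔n (f zero) K ; (suc i) → ℕ.≤-trans (bound i) (ℕ.m≤n⊔m (f zero) K) }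

module Combinations (A : ℤ-Algebra) where
  open ℤ-Algebra A
  open Solver A
  open SetoidReasoning setoid
  private module S = Sum semiring
  open S using (sum)

  comb : ∀ {D} → (Fin D → ℤ) → (Fin D → Carrier) → Carrier
  comb c e = sum (λ i → ι (c i) * e i)

  ι-cong : ∀ {m n} → m ≡ n → ι m ≈ ι n
  ι-cong eq = ≡⇒≈ (cong ι eq)

  comb-cong : ∀ {D} {c c′ : Fin D → ℤ} e → (∀ i → c i ≡ c′ i) → comb c e ≈ comb c′ e
  comb-cong e eq = S.sum-cong-≋ (λ i → *-congʳ (ι-cong (eq i)))

  comb-+ : ∀ {D} (c c′ : Fin D → ℤ) e → comb (λ i → c i ℤ.+ c′ i) e ≈ comb c e + comb c′ e
  comb-+ c c′ e = ≈-trans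
    (S.sum-cong-≋ (λ i → ≈-trans (*-congʳ (ι-+ (c i) (c′ i))) (distribʳ (e i) (ι (c i)) (ι (c′ i)))))
    (S.∑-distrib-+ (λ i → ι (c i) * e i) (λ i → ι (c′ i) * e i))

  comb-* : ∀ {D} n (c : Fin D → ℤ) e → comb (λ i → n ℤ.* c i) e ≈ ι n * comb c e
  comb-* n c e = ≈-trans
    (S.sum-cong-≋ (λ i → ≈-trans (*-congʳ (ι-* n (c i))) (*-assoc (ι n) (ι (c i)) (e i))))
    (≈-sym (S.*-distribˡ-sum (ι n) (λ i → ι (c i) * e i)))

  comb-neg : ∀ {D} (c : Fin D → ℤ) e → comb (λ i → ℤ.- c i) e ≈ - comb c e
  comb-neg c e = ≈-trans (comb-cong e (λ i → ≡.sym (ℤ.-1*i≡-i (c i))))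
    (≈-trans (comb-* (ℤ.- + 1) c e) (≈-trans (*-congʳ (≈-trans (ι-‿ (+ 1)) (-‿cong ι-1)))
      (solve 1 (λ x → :- con (+ 1) :* x := :- x) ≈-refl (comb c e))))

  comb-- : ∀ {D} (c c′ : Fin D → ℤ) e → comb (λ i → c i ℤ.- c′ i) e ≈ comb c e - comb c′ e
  comb-- c c′ e = ≈-trans (comb-+ c (λ i → ℤ.- c′ i) e) (+-congˡ (comb-neg c′ e))

  comb-0 : ∀ {D} (e : Fin D → Carrier) → comb (λ _ → + 0) e ≈ 0#
  comb-0 {zero}  e = ≈-refl
  comb-0 {suc D} e = ≈-trans (+-cong (≈-trans (*-congʳ ι-0) (zeroˡ _)) (comb-0 (e ∘ suc))) (+-identityˡ 0#)

  comb-sum : ∀ {D m} (c : Fin m → Fin D → ℤ) e →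
             comb (λ i → sumℤ (λ j → c j i)) e ≈ sum (λ j → comb (c j) e)
  comb-sum {m = zero}  c e = comb-0 e
  comb-sum {m = suc m} c e = ≈-trans (comb-+ (c zero) (λ i → sumℤ (λ j → c (suc j) i)) e)
    (+-congˡ (comb-sum (c ∘ suc) e))

  -- Peeling off one generator at a time matches the induction that extracts independent elements
  -- from the generators, and it passes to quotients constructor by constructor.
  data Span : List Carrier → Carrier → Set where
    []   : ∀ {x} → x ≈ 0# → Span [] x
    cons : ∀ {g gs x} c → Span gs (x - ι c * g) → Span (g ∷ gs) x

  Span-resp : ∀ {gs x y} → x ≈ y → Span gs x → Span gs y
  Span-resp e ([] x≈0)   = [] (≈-trans (≈-sym e) x≈0)
  Span-resp e (cons c s) = cons c (Span-resp (+-congʳ e) s)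

  Span-0 : ∀ gs → Span gs 0#
  Span-0 []       = [] ≈-refl
  Span-0 (g ∷ gs) = cons (+ 0) (Span-resp
    (≈-trans (solve 1 (λ g → con (+ 0) := con (+ 0) :- con (+ 0) :* g) ≈-refl g) (+-congˡ (-‿cong (*-congʳ (≈-sym ι-0)))))
    (Span-0 gs))

  Span-++ : ∀ {gs hs x y} → Span gs x → Span hs y → Span (gs ++ hs) (x + y)
  Span-++ {y = y} ([] x≈0) t = Span-resp (≈-trans (≈-sym (+-identityˡ y)) (+-congʳ (≈-sym x≈0))) t
  Span-++ {g ∷ gs} {x = x} {y} (cons c s) t =
    cons c (Span-resp (solve 3 (λ x y z → (x :- z) :+ y := (x :+ y) :- z) ≈-refl x y (ι c * g)) (Span-++ s t))

record FinitelyGenerated (A : ℤ-Algebra) : Set where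
  open Combinations A
  field
    generators : List (ℤ-Algebra.Carrier A)
    span       : ∀ x → Span generators x

ℤ-finitelyGenerated : FinitelyGenerated ℤ-algebra
ℤ-finitelyGenerated = record
  { generators = + 1 ∷ []
  ; span = λ x → cons x ([] (≡.trans (cong (λ y → x ℤ.- y) (ℤ.*-identityʳ x)) (ℤ.+-inverseʳ x))) }
  where open Combinations ℤ-algebra

module _ (A : ℤ-Algebra) (J : Ideals.Ideal A) where
  private
    B = Ideals.quotient A J
    module CA = Combinations A
    module CB = Combinations B

  Span-quotient : ∀ {gs x} → CA.Span gs x → CB.Span gs x
  Span-quotient (CA.[] e)     = CB.[] (Ideals.≈⇒≈[] A J e)
  Span-quotient (CA.cons c s) = CB.cons c (Span-quotient s)

  quotient-finitelyGenerated : FinitelyGenerated A → FinitelyGenerated B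
  quotient-finitelyGenerated fg = record
    { generators = FinitelyGenerated.generators fg
    ; span = λ x → Span-quotient (FinitelyGenerated.span fg x) }

-- Adjoining a root of a monic polynomial

module Adjoin (A : ℤ-Algebra) (f : List (ℤ-Algebra.Carrier A)) (e : ℕ) where
  open ℤ-Algebra A
  open PolyRing A hiding (algebra)
  open PolyProperties A
  private
    P = PolyRing.algebra A
    module P = ℤ-Algebra P

  fIdeal : Ideals.Ideal P
  fIdeal = Ideals.principal P f

  extension : ℤ-Algebra
  extension = Ideals.quotient P fIdeal

  module _ (monic : coeff f e ≈ 1#) (van-f : Vanishes f (suc e)) where

    divide : ∀ h → ∃₂ λ q r → Vanishes r e × h ≋ q *ₚ f +ₚ r
    divide h with pseudoDivide f e van-f (length h) h (vanishes-mono {h} (ℕ.m≤n+m (length h) e) (vanishes-length h))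
    ... | q , r , van-r , eq = q , r , van-r , ≋-trans (≋-sym
      (≋-trans (const-*ₚ _ h) (scale-one (power-one (length h)) h))) eq
      where
      power-one : ∀ l → power (coeff f e) l ≈ 1#
      power-one zero    = ≈-refl
      power-one (suc l) = ≈-trans (*-cong (power-one l) monic) (*-identityʳ 1#)

    cancel-monic : ∀ v → Vanishes (v *ₚ f) e → v ≋ []
    cancel-monic = cancel-lead f e van-f λ x x*1≈0 → ≈-trans (≈-sym (≈-trans (*-congˡ monic) (*-identityʳ x))) x*1≈0

    -- A nonzero multiple of a monic polynomial of degree e has a nonzero coefficient in some place
    -- from e on. In particular no nonzero integer dies in the extensions built below.
    vanishes∈⇒≋[] : ∀ {x} → Vanishes x e → Ideals.Ideal._∈I fIdeal x → x ≋ []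
    vanishes∈⇒≋[] {x} van (h , eq) = ≋-trans eq (*ₚ-cong {h} {[]} {f} {f}
      (cancel-monic h (λ j e≤j → ≈-trans (≈-sym (at eq j)) (van j e≤j))) ≋-refl)

    private
      module CP = Combinations P
      module CA = Combinations A

      powers : ℕ → List Carrier → List (List Carrier)
      powers zero    gs = []
      powers (suc n) gs = map (_∷ []) gs ++ map (0# ∷_) (powers n gs)

      Span-const : ∀ {gs x} → CA.Span gs x → CP.Span (map (_∷ []) gs) (x ∷ [])
      Span-const (CA.[] e) = CP.[] (∷≋[] e ≋-refl)
      Span-const {g ∷ gs} (CA.cons c s) = CP.cons c
        (CP.Span-resp (∷-cong (+-congˡ (-‿cong (≈-sym (+-identityʳ _)))) ≋-refl) (Span-const s))

      Span-shift : ∀ {gs x} → CP.Span gs x → CP.Span (map (0# ∷_) gs) (0# ∷ x)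
      Span-shift (CP.[] e) = CP.[] (∷≋[] ≈-refl e)
      Span-shift {g ∷ gs} {x} (CP.cons c s) = CP.cons c (CP.Span-resp
        ≋-sub
        (CP.Span-resp (shift-sub x ((ι c ∷ []) *ₚ g)) (Span-shift s)))
        where
        shift-sub : ∀ u v → 0# ∷ (u +ₚ -ₚ v) ≋ (0# ∷ u) +ₚ -ₚ (0# ∷ v)
        shift-sub u v = ∷-cong (≈-sym (-‿inverseʳ 0#)) ≋-refl
        ≋-sub : (0# ∷ x) +ₚ -ₚ (0# ∷ (ι c ∷ []) *ₚ g) ≋ (0# ∷ x) +ₚ -ₚ ((ι c ∷ []) *ₚ (0# ∷ g))
        ≋-sub = P.+-congˡ {0# ∷ x} (P.-‿cong (≋-trans
          (≋-sym (≋-trans (shift-*ₚ g (ι c ∷ [])) (∷-cong ≈-refl (*ₚ-comm g (ι c ∷ [])))))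
          (*ₚ-comm (0# ∷ g) (ι c ∷ []))))

      Span-powers : ∀ {gs} → (∀ x → CA.Span gs x) → ∀ n p → Vanishes p n → CP.Span (powers n gs) p
      Span-powers spanA zero    p       van = CP.[] (vanishes0⇒≋[] van)
      Span-powers spanA (suc n) []      van = CP.Span-0 _
      Span-powers spanA (suc n) (a ∷ p) van = CP.Span-resp
        (∷-cong (+-identityʳ a) (≋-refl {p}))
        (CP.Span-++ (Span-const (spanA a)) (Span-shift (Span-powers spanA n p (vanishes-tail van))))

    extension-finitelyGenerated : FinitelyGenerated A → FinitelyGenerated extension
    extension-finitelyGenerated fg = record
      { generators = powers e (FinitelyGenerated.generators fg)
      ; span = λ h → case divide h of λ where
          (q , r , van-r , eq) → Combinations.Span-resp extension
            (Ideals.mk (resp (PS.solve 2 (λ h r → PS.:- (h PS.:- r) PS.:= r PS.:- h) P.≈-refl h r)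
              (neg∈ (q , ≋-trans (P.+-congʳ { -ₚ r} eq)
                (PS.solve 2 (λ u r → u PS.:+ r PS.:- r PS.:= u) P.≈-refl (q *ₚ f) r)))))
            (Span-quotient P fIdeal (Span-powers (FinitelyGenerated.span fg) e r van-r)) }
      where
      module PS = Solver P
      open Ideals.Ideal fIdeal

-- Lattices of finite index

module Lattices (Ans : Set) (A : ℤ-Algebra) where
  open Classical Ans
  open ℤ-Algebra A
  open Solver A
  open Combinations A
  open Ideals A
  open SetoidReasoning setoid

  -- What is needed of an order in a number field: every nonzero element divides a nonzero integer.
  -- This replaces the norm and the field of fractions.
  record OrderLike : Set where
    field
      char0  : ∀ {n} → n ≢ + 0 → ι n ≈ 0# → Ans
      invert : ∀ x → Cl (x ≈ 0# ⊎ ∃₂ λ u n → n ≢ + 0 × u * x ≈ ι n)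

    torsionFree : ∀ {n x} → n ≢ + 0 → ι n * x ≈ 0# → Cl (x ≈ 0#)
    torsionFree {n} {x} n≢0 nx≈0 k = invert x λ where
      (inj₁ x≈0)                 → k x≈0
      (inj₂ (u , m , m≢0 , eq)) → char0 (*≢0 n≢0 m≢0) (begin
        ι (n ℤ.* m)     ≈⟨ ι-* n m ⟩
        ι n * ι m       ≈⟨ *-congˡ eq ⟨
        ι n * (u * x)   ≈⟨ solve 3 (λ n u x → n :* (u :* x) := u :* (n :* x)) ≈-refl (ι n) u x ⟩
        u * (ι n * x)   ≈⟨ *-congˡ nx≈0 ⟩
        u * 0#          ≈⟨ zeroʳ u ⟩
        0#              ∎)

  Independent : ∀ {D} → (Fin D → Carrier) → Set
  Independent e = ∀ c → Nonzero c → comb c e ≈ 0# → Ans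

  -- Independent elements that span a submodule of finite index. A basis of the whole ring would
  -- require the structure theory of ℤ-modules; instead the denominator Δ carries every element into
  -- the lattice.
  record Lattice : Set where
    field
      {D}         : ℕ
      e           : Fin D → Carrier
      independent : Independent e
      Δ           : ℤ
      Δ≢0         : Δ ≢ + 0
      coordΔ      : Carrier → Fin D → ℤ
      coordΔ-spec : ∀ x → ι Δ * x ≈ comb (coordΔ x) e

  private
    record SpanLattice (gs : List Carrier) : Set where
      field
        {D}         : ℕ
        e           : Fin D → Carrier
        independent : Independent e
        Δ           : ℤ
        Δ≢0         : Δ ≢ + 0
        coords      : ∀ {x} → Span gs x → ∃[ c ] ι Δ * x ≈ comb c e

    -- Each generator either has a nonzero multiple n g in the span so far, and Δ absorbs the factor
    -- n, or it is independent of that span and joins it.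
    spanLattice : ∀ gs → Cl (SpanLattice gs)
    spanLattice []       k = k record
      { D = 0 ; e = λ () ; independent = λ { c (() , _) } ; Δ = + 1 ; Δ≢0 = λ ()
      ; coords = λ { ([] x≈0) → (λ ()) , ≈-trans (*-congˡ x≈0) (zeroʳ _) } }
    spanLattice (g ∷ gs) k = spanLattice gs λ L → let open SpanLattice L in
      lem (∃₂ λ n c → n ≢ + 0 × ι n * g ≈ comb c e) λ where
        (inj₁ (n , c , n≢0 , ng≈c)) → k record
          { e = e ; independent = independent ; Δ = Δ ℤ.* n ; Δ≢0 = *≢0 Δ≢0 n≢0
          ; coords = λ { {x} (cons c₀ s) → let (d , eq) = coords s in
              (λ i → (Δ ℤ.* c₀) ℤ.* c i ℤ.+ n ℤ.* d i) , (begin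
                ι (Δ ℤ.* n) * x ≈⟨ *-congʳ (ι-* Δ n) ⟩
                ι Δ * ι n * x
                  ≈⟨ solve 5 (λ Δ n x c g → Δ :* n :* x := (Δ :* c) :* (n :* g) :+ n :* (Δ :* (x :- c :* g)))
                       ≈-refl (ι Δ) (ι n) x (ι c₀) g ⟩
                (ι Δ * ι c₀) * (ι n * g) + ι n * (ι Δ * (x - ι c₀ * g))
                  ≈⟨ +-cong (*-cong (≈-sym (ι-* Δ c₀)) ng≈c) (*-congˡ eq) ⟩
                ι (Δ ℤ.* c₀) * comb c e + ι n * comb d e
                  ≈⟨ +-cong (comb-* (Δ ℤ.* c₀) c e) (comb-* n d e) ⟨
                comb (λ i → (Δ ℤ.* c₀) ℤ.* c i) e + comb (λ i → n ℤ.* d i) e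
                  ≈⟨ comb-+ (λ i → (Δ ℤ.* c₀) ℤ.* c i) (λ i → n ℤ.* d i) e ⟨
                comb (λ i → (Δ ℤ.* c₀) ℤ.* c i ℤ.+ n ℤ.* d i) e ∎) } }
        (inj₂ outside) → k record
          { e = extend g e
          ; independent = λ c nz c≈0 → case c zero ℤ.≟ + 0 of λ where
              (yes c₀≡0) → independent (c ∘ suc)
                (case nz of λ { (zero , c₀≢0) → contradiction c₀≡0 c₀≢0 ; (suc i , cᵢ≢0) → i , cᵢ≢0 })
                (≈-trans (≈-sym (≈-trans (+-congʳ (≈-trans (*-congʳ (≈-trans (ι-cong c₀≡0) ι-0)) (zeroˡ g))) (+-identityˡ _))) c≈0)
              (no c₀≢0) → outside (c zero , (λ i → ℤ.- c (suc i)) , c₀≢0 , (begin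
                ι (c zero) * g
                  ≈⟨ solve 2 (λ u v → u := (u :+ v) :+ :- v) ≈-refl _ (comb (c ∘ suc) e) ⟩
                (ι (c zero) * g + comb (c ∘ suc) e) - comb (c ∘ suc) e ≈⟨ +-congʳ c≈0 ⟩
                0# - comb (c ∘ suc) e                         ≈⟨ +-identityˡ _ ⟩
                - comb (c ∘ suc) e                            ≈⟨ comb-neg (c ∘ suc) e ⟨
                comb (λ i → ℤ.- c (suc i)) e                  ∎))
          ; Δ = Δ ; Δ≢0 = Δ≢0
          ; coords = λ { {x} (cons c₀ s) → let (d , eq) = coords s in
              extend (Δ ℤ.* c₀) d , (begin
                ι Δ * x ≈⟨ solve 4 (λ Δ x c g → Δ :* x := (Δ :* c) :* g :+ Δ :* (x :- c :* g)) ≈-refl (ι Δ) x (ι c₀) g ⟩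
                (ι Δ * ι c₀) * g + ι Δ * (x - ι c₀ * g) ≈⟨ +-cong (*-congʳ (≈-sym (ι-* Δ c₀))) eq ⟩
                ι (Δ ℤ.* c₀) * g + comb d e ∎) } }
      where
      extend : ∀ {X : Set} {n} → X → (Fin n → X) → Fin (suc n) → X
      extend x f zero    = x
      extend x f (suc i) = f i

  lattice : FinitelyGenerated A → Cl Lattice
  lattice fg k = spanLattice (FinitelyGenerated.generators fg) λ L → let open SpanLattice L in k record
    { e = e ; independent = independent ; Δ = Δ ; Δ≢0 = Δ≢0
    ; coordΔ = λ x → proj₁ (coords (FinitelyGenerated.span fg x))
    ; coordΔ-spec = λ x → proj₂ (coords (FinitelyGenerated.span fg x)) }

  -- Such a family says that J has index at least N; indices enter the proof in no other way.
  Incongruent : ∀ {N} → Ideal → (Fin N → Carrier) → Set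
  Incongruent J w = ∀ i j → i ≢ j → Ideal._∈I J (w i - w j) → Ans

  module LatticeProperties (orderLike : OrderLike) (L : Lattice) where
    open OrderLike orderLike
    open Lattice L
    private module S = Sum semiring

    comb-linear : ∀ {m} t (v : Fin m → Carrier) (M : Fin m → Fin D → ℤ) → (∀ j → comb (M j) e ≈ t * v j) →
                  ∀ s → comb (λ i → sumℤ (λ j → s j ℤ.* M j i)) e ≈ t * comb s v
    comb-linear t v M eq s = begin
      comb (λ i → sumℤ (λ j → s j ℤ.* M j i)) e     ≈⟨ comb-sum (λ j i → s j ℤ.* M j i) e ⟩
      S.sum (λ j → comb (λ i → s j ℤ.* M j i) e)    ≈⟨ S.sum-cong-≋ (λ j → ≈-trans (comb-* (s j) (M j) e) (≈-trans (*-congˡ (eq j))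
        (solve 3 (λ s t v → s :* (t :* v) := t :* (s :* v)) ≈-refl (ι (s j)) t (v j)))) ⟩
      S.sum (λ j → t * (ι (s j) * v j))             ≈⟨ S.*-distribˡ-sum t (λ j → ι (s j) * v j) ⟨
      t * comb s v                                  ∎

    -- The structure constants of the multiplication, scaled by Δ because `e j * e k` may lie
    -- outside the lattice.
    γ : Fin D → Fin D → Fin D → ℤ
    γ j k = coordΔ (e j * e k)

    mulΔ : (s a : Fin D → ℤ) → Fin D → ℤ
    mulΔ s a i = sumℤ (λ j → s j ℤ.* sumℤ (λ k → a k ℤ.* γ j k i))

    mulΔ-spec : ∀ s a → comb (mulΔ s a) e ≈ ι Δ * (comb s e * comb a e)
    mulΔ-spec s a = ≈-trans
      (comb-linear (ι Δ * comb a e) e (λ j i → sumℤ (λ k → a k ℤ.* γ j k i)) (λ j →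
        ≈-trans (comb-linear (ι Δ * e j) e (γ j) (λ k → ≈-trans (≈-sym (coordΔ-spec (e j * e k))) (≈-sym (*-assoc (ι Δ) (e j) (e k)))) a)
          (solve 3 (λ Δ e a → (Δ :* e) :* a := (Δ :* a) :* e) ≈-refl (ι Δ) (e j) (comb a e))) s)
      (solve 3 (λ Δ s a → (Δ :* a) :* s := Δ :* (s :* a)) ≈-refl (ι Δ) (comb s e) (comb a e))

    Γ : ℕ
    Γ = proj₁ (maxOf λ j → proj₁ (maxOf λ k → proj₁ (maxOf λ i → ∣ γ j k i ∣)))

    γ≤Γ : ∀ j k i → ∣ γ j k i ∣ ≤ Γ
    γ≤Γ j k i = ℕ.≤-trans (proj₂ (maxOf λ i → ∣ γ j k i ∣) i)
      (ℕ.≤-trans (proj₂ (maxOf λ k → proj₁ (maxOf λ i → ∣ γ j k i ∣)) k)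
        (proj₂ (maxOf λ j → proj₁ (maxOf λ k → proj₁ (maxOf λ i → ∣ γ j k i ∣))) j))

    ∣mulΔ∣≤ : ∀ {s a S B} → (∀ i → ∣ s i ∣ ≤ S) → (∀ i → ∣ a i ∣ ≤ B) →
              ∀ i → ∣ mulΔ s a i ∣ ≤ D ℕ.* (S ℕ.* (D ℕ.* (B ℕ.* Γ)))
    ∣mulΔ∣≤ {s} {a} {S} {B} s≤S a≤B i = ∣sumℤ∣≤ _ _ λ j → ℕ.≤-trans (ℕ.≤-reflexive (ℤ.∣i*j∣≡∣i∣*∣j∣ (s j) _))
      (ℕ.*-mono-≤ (s≤S j) (∣sumℤ∣≤ _ _ λ k → ℕ.≤-trans (ℕ.≤-reflexive (ℤ.∣i*j∣≡∣i∣*∣j∣ (a k) _))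
        (ℕ.*-mono-≤ (a≤B k) (γ≤Γ j k i))))

    comb-injective : ∀ {c d} → comb c e ≈ comb d e → Cl (∀ i → c i ≡ d i)
    comb-injective {c} {d} eq k = case nonzero? (λ i → c i ℤ.- d i) of λ where
      (inj₁ nz)  → independent _ nz (≈-trans (comb-- c d e) (≈-trans (+-congʳ eq) (-‿inverseʳ _)))
      (inj₂ all) → k λ i → ℤ.i-j≡0⇒i≡j (c i) (d i) (all i)

    rank-positive : D ≡ 0 → Ans
    rank-positive D≡0 = char0 Δ≢0 (begin
      ι Δ                     ≈⟨ *-identityʳ (ι Δ) ⟨
      ι Δ * 1#                ≈⟨ coordΔ-spec 1# ⟩
      comb (coordΔ 1#) e      ≈⟨ empty D≡0 (coordΔ 1#) e ⟩
      0#                      ∎)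
      where
      empty : ∀ {n} → n ≡ 0 → (c : Fin n → ℤ) (v : Fin n → Carrier) → comb c v ≈ 0#
      empty refl c v = ≈-refl

    -- The integers of absolute value at most D²ΓB number 2D²ΓB + 1, which is at most (2D²Γ + 1)B.
    indexConstant : ℕ
    indexConstant = suc (2 ℕ.* (D ℕ.* (D ℕ.* Γ)))

    private
      -- Reducing w modulo a: w - q a is the product of a by an element of the unit cell, up to the factor n Δ.
      record Reduction (a : Fin D → ℤ) (B : ℕ) (w : Carrier) : Set where
        field
          q     : Carrier
          key   : Fin D → ℤ
          spec  : ι Δ * (w - q * comb a e) ≈ comb key e
          bound : ∀ i → ∣ key i ∣ ≤ D ℕ.* (D ℕ.* (B ℕ.* Γ))

      reduce : ∀ a B → (∀ i → ∣ a i ∣ ≤ B) → ∀ u n → n ≢ + 0 → u * comb a e ≈ ι n → ∀ w → Cl (Reduction a B w)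
      reduce a B a≤B u n n≢0 ua≈n w k =
        comb-injective {λ i → n′ ℤ.* key i} {mulΔ s a} key-mulΔ λ eq → k record
          { q = comb qs e ; key = key ; spec = coordΔ-spec y
          ; bound = λ i → ℕ.*-cancelˡ-≤ ∣ n′ ∣ (key≤ i (eq i)) }
        where
        n′ : ℤ
        n′ = n ℤ.* Δ
        instance
          n′-nonZero : ℤ.NonZero n′
          n′-nonZero = ℤ.≢-nonZero (*≢0 n≢0 Δ≢0)
        -- Since u a = n, the product n′ w equals (Δ u w) a. Dividing the coordinates t of Δ u w by
        -- n′ leaves n′ (w - q a) = s a with 0 ≤ s < ∣n′∣, and ∣n′∣ cancels from the bound on the
        -- coordinates of w - q a.
        t qs s : Fin D → ℤ
        t = coordΔ (u * w)
        qs i = t i ℤ./ n′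
        s i = + (t i ℤ.% n′)
        y : Carrier
        y = w - comb qs e * comb a e
        key : Fin D → ℤ
        key = coordΔ y
        t-split : comb t e ≈ comb s e + ι n′ * comb qs e
        t-split = begin
          comb t e ≈⟨ comb-cong e (λ i → ≡.trans (ℤ.a≡a%n+[a/n]*n (t i) n′) (cong (λ v → s i ℤ.+ v) (ℤ.*-comm (qs i) n′))) ⟩
          comb (λ i → s i ℤ.+ n′ ℤ.* qs i) e ≈⟨ comb-+ s (λ i → n′ ℤ.* qs i) e ⟩
          comb s e + comb (λ i → n′ ℤ.* qs i) e ≈⟨ +-congˡ (comb-* n′ qs e) ⟩
          comb s e + ι n′ * comb qs e ∎
        n′w : ι n′ * w ≈ (comb s e + ι n′ * comb qs e) * comb a e
        n′w = begin
          ι n′ * w                   ≈⟨ *-congʳ (≈-trans (ι-* n Δ) (*-congʳ (≈-sym ua≈n))) ⟩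
          (u * comb a e) * ι Δ * w
            ≈⟨ solve 4 (λ u a Δ w → (u :* a) :* Δ :* w := (Δ :* (u :* w)) :* a) ≈-refl u (comb a e) (ι Δ) w ⟩
          (ι Δ * (u * w)) * comb a e ≈⟨ *-congʳ (≈-trans (coordΔ-spec (u * w)) t-split) ⟩
          (comb s e + ι n′ * comb qs e) * comb a e ∎
        n′y : ι n′ * y ≈ comb s e * comb a e
        n′y = begin
          ι n′ * (w - comb qs e * comb a e)
            ≈⟨ solve 4 (λ n w q a → n :* (w :- q :* a) := n :* w :- n :* q :* a) ≈-refl (ι n′) w (comb qs e) (comb a e) ⟩
          ι n′ * w - ι n′ * comb qs e * comb a e ≈⟨ +-congʳ n′w ⟩
          (comb s e + ι n′ * comb qs e) * comb a e - ι n′ * comb qs e * comb a e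
            ≈⟨ solve 4 (λ n s q a → (s :+ n :* q) :* a :- n :* q :* a := s :* a) ≈-refl (ι n′) (comb s e) (comb qs e) (comb a e) ⟩
          comb s e * comb a e ∎
        key-mulΔ : comb (λ i → n′ ℤ.* key i) e ≈ comb (mulΔ s a) e
        key-mulΔ = begin
          comb (λ i → n′ ℤ.* key i) e ≈⟨ comb-* n′ key e ⟩
          ι n′ * comb key e           ≈⟨ *-congˡ (coordΔ-spec y) ⟨
          ι n′ * (ι Δ * y)            ≈⟨ solve 3 (λ n Δ y → n :* (Δ :* y) := Δ :* (n :* y)) ≈-refl (ι n′) (ι Δ) y ⟩
          ι Δ * (ι n′ * y)            ≈⟨ *-congˡ n′y ⟩
          ι Δ * (comb s e * comb a e) ≈⟨ mulΔ-spec s a ⟨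
          comb (mulΔ s a) e           ∎
        key≤ : ∀ i → n′ ℤ.* key i ≡ mulΔ s a i → ∣ n′ ∣ ℕ.* ∣ key i ∣ ≤ ∣ n′ ∣ ℕ.* (D ℕ.* (D ℕ.* (B ℕ.* Γ)))
        key≤ i eq = ℕ.≤-trans (ℕ.≤-reflexive (≡.trans (≡.sym (ℤ.∣i*j∣≡∣i∣*∣j∣ n′ (key i))) (cong ∣_∣ eq)))
          (ℕ.≤-trans (∣mulΔ∣≤ {s} {a} {∣ n′ ∣} {B} (λ j → ℕ.<⇒≤ (ℤ.n%d<d (t j) n′)) a≤B i)
            (ℕ.≤-reflexive (swap D ∣ n′ ∣ (D ℕ.* (B ℕ.* Γ)))))
          where
          swap : ∀ a b c → a ℕ.* (b ℕ.* c) ≡ b ℕ.* (a ℕ.* c)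
          swap = ℕSolver.solve-∀

    -- The index of J is at most that of the principal ideal of a, whose norm is ≪ B^D. Without
    -- norms: reduced modulo a, all w have their keys in a box of at most (indexConstant · B)^D
    -- points, and equal keys give equal residues, as there is no torsion.
    indexBound : ∀ J a B → 1 ≤ B → Nonzero a → (∀ i → ∣ a i ∣ ≤ B) → Ideal._∈I J (comb a e) →
                 ∀ {N} (w : Fin N → Carrier) → Incongruent J w → (indexConstant ℕ.* B) ^ D < N → Ans
    indexBound J a B 1≤B a≢0 a≤B a∈J {N} w incong small = invert (comb a e) λ where
        (inj₁ a≈0) → independent a a≢0 a≈0
        (inj₂ (u , n , n≢0 , ua≈n)) → finite-choice (λ i → reduce a B a≤B u n n≢0 ua≈n (w i)) λ red →
          let module R i = Reduction (red i)
              (i , j , i≢j , same) = pigeonhole-ℤ K small′ R.key R.bound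
          in torsionFree {Δ} {(w i - R.q i * comb a e) - (w j - R.q j * comb a e)} Δ≢0 (begin
               ι Δ * ((w i - R.q i * comb a e) - (w j - R.q j * comb a e))
                 ≈⟨ solve 3 (λ Δ x y → Δ :* (x :- y) := Δ :* x :- Δ :* y) ≈-refl (ι Δ) _ _ ⟩
               ι Δ * (w i - R.q i * comb a e) - ι Δ * (w j - R.q j * comb a e)
                 ≈⟨ +-cong (R.spec i) (-‿cong (R.spec j)) ⟩
               comb (R.key i) e - comb (R.key j) e ≈⟨ +-congʳ (comb-cong e same) ⟩
               comb (R.key j) e - comb (R.key j) e ≈⟨ -‿inverseʳ _ ⟩
               0# ∎) λ diff≈0 → incong i j i≢j (resp (begin
                 (R.q i - R.q j) * comb a e ≈⟨ +-identityˡ _ ⟨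
                 0# + (R.q i - R.q j) * comb a e ≈⟨ +-congʳ diff≈0 ⟨
                 ((w i - R.q i * comb a e) - (w j - R.q j * comb a e)) + (R.q i - R.q j) * comb a e
                   ≈⟨ solve 5 (λ x y q r a → ((x :- q :* a) :- (y :- r :* a)) :+ (q :- r) :* a := x :- y) ≈-refl
                        (w i) (w j) (R.q i) (R.q j) (comb a e) ⟩
                 w i - w j ∎) (*∈ (R.q i - R.q j) a∈J))
      where
      open Ideal J
      K : ℕ
      K = D ℕ.* (D ℕ.* (B ℕ.* Γ))
      small′ : suc (K ℕ.+ K) ^ D < N
      small′ = ℕ.≤-<-trans (ℕ.^-monoˡ-≤ D (ℕ.≤-trans (ℕ.+-monoˡ-≤ (K ℕ.+ K) 1≤B)
        (ℕ.≤-reflexive (identity D B Γ)))) small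
        where
        identity : ∀ D B Γ → B ℕ.+ (D ℕ.* (D ℕ.* (B ℕ.* Γ)) ℕ.+ D ℕ.* (D ℕ.* (B ℕ.* Γ))) ≡
                   suc (2 ℕ.* (D ℕ.* (D ℕ.* Γ))) ℕ.* B
        identity = ℕSolver.solve-∀

-- Prime ideals without Zorn's lemma

^-distrib-* : ∀ a b n → (a ℕ.* b) ^ n ≡ a ^ n ℕ.* b ^ n
^-distrib-* a b zero    = refl
^-distrib-* a b (suc n) = ≡.trans (cong (λ z → a ℕ.* b ℕ.* z) (^-distrib-* a b n)) (identity a b (a ^ n) (b ^ n))
  where
  identity : ∀ a b x y → a ℕ.* b ℕ.* (x ℕ.* y) ≡ a ℕ.* x ℕ.* (b ℕ.* y)
  identity = ℕSolver.solve-∀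

-- Numbers below Y^D serve as the points of the box [0, Y)^D.
digits : ∀ {Y D} → Fin (Y ^ D) → Fin D → ℕ
digits i d = toℕ (Fin.finToFun i d)

digits-injective : ∀ {Y D} {i j : Fin (Y ^ D)} → (∀ d → digits {Y} {D} i d ≡ digits {Y} {D} j d) → i ≡ j
digits-injective {Y} {D} {i} {j} same = ≡.trans (≡.sym (Fin.funToFin-finToFin {D} {Y} i))
  (≡.trans (funToFin-cong {D} {Y} (λ d → Fin.toℕ-injective (same d))) (Fin.funToFin-finToFin {D} {Y} j))
  where
  funToFin-cong : ∀ {m n} {f g : Fin m → Fin n} → (∀ d → f d ≡ g d) → Fin.funToFin f ≡ Fin.funToFin g
  funToFin-cong {zero}  eq = refl
  funToFin-cong {suc m} eq = cong₂ Fin.combine (eq zero) (funToFin-cong (λ d → eq (suc d)))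

private
  -- N is kept abstract: it is a large power, which must not be unfolded.
  integer-dependence′ : ∀ {D} (v : Fin (suc D) → Fin D → ℤ) V N → (∀ j i → ∣ v j i ∣ ≤ V) →
                        suc (2 ℕ.* (suc D ℕ.* V)) ^ D ≤ N →
                        ∃[ c ] Nonzero c × ∀ i → sumℤ (λ j → c j ℤ.* v j i) ≡ + 0
  integer-dependence′ {D} v V N v≤V W^D≤N = conclude (pigeonhole-ℤ K small values values≤K)
    where
    W K : ℕ
    W = suc (2 ℕ.* (suc D ℕ.* V))
    K = suc D ℕ.* (N ℕ.* V)
    dig : Fin (suc N ^ suc D) → Fin (suc D) → ℕ
    dig = digits {suc N} {suc D}
    values : Fin (suc N ^ suc D) → Fin D → ℤ
    values m i = sumℤ (λ j → + dig m j ℤ.* v j i)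
    values≤K : ∀ m i → ∣ values m i ∣ ≤ K
    values≤K m i = ∣sumℤ∣≤ (λ j → + dig m j ℤ.* v j i) (N ℕ.* V) λ j → ℕ.≤-trans (ℕ.≤-reflexive (ℤ.∣i*j∣≡∣i∣*∣j∣ (+ dig m j) (v j i)))
      (ℕ.*-mono-≤ (ℕ.≤-pred (Fin.toℕ<n (Fin.finToFun {suc N} {suc D} m j))) (v≤V j i))
    identity : ∀ D N V → suc (D ℕ.* (N ℕ.* V) ℕ.+ D ℕ.* (N ℕ.* V)) ℕ.+ (N ℕ.+ 2 ℕ.* (D ℕ.* V)) ≡
                         suc (2 ℕ.* (D ℕ.* V)) ℕ.* suc N
    identity = ℕSolver.solve-∀
    range : suc (K ℕ.+ K) ≤ W ℕ.* suc N
    range = ℕ.≤-trans (ℕ.m≤m+n (suc (K ℕ.+ K)) (N ℕ.+ 2 ℕ.* (suc D ℕ.* V)))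
      (ℕ.≤-reflexive (identity (suc D) N V))
    -- Siegel's pigeonhole: (2K + 1)^D ≤ W^D (N + 1)^D < (N + 1)^(D + 1), so two digit vectors give
    -- the same values, and their difference is the dependence.
    small : suc (K ℕ.+ K) ^ D < suc N ^ suc D
    small = ℕ.≤-<-trans (ℕ.^-monoˡ-≤ D range) (ℕ.≤-<-trans (ℕ.≤-reflexive (^-distrib-* W (suc N) D))
      (ℕ.*-monoˡ-< (suc N ^ D) ⦃ ℕ.m^n≢0 (suc N) D ⦄ (s≤s W^D≤N)))
    conclude : (∃₂ λ m n → m ≢ n × (∀ i → values m i ≡ values n i)) →
               ∃[ c ] Nonzero c × ∀ i → sumℤ (λ j → c j ℤ.* v j i) ≡ + 0
    conclude (m , n , m≢n , same) = c , nonzero , λ i → ≡.trans (sub i) (ℤ.i≡j⇒i-j≡0 (same i))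
      where
      c : Fin (suc D) → ℤ
      c j = + dig m j ℤ.- + dig n j
      nonzero : Nonzero c
      nonzero with nonzero? c
      ... | inj₁ nz  = nz
      ... | inj₂ all = contradiction (digits-injective {suc N} {suc D} λ d → ℤ.+-injective (ℤ.i-j≡0⇒i≡j _ _ (all d))) m≢n
      sub : ∀ i → sumℤ (λ j → c j ℤ.* v j i) ≡ values m i ℤ.- values n i
      sub i = ≡.trans (Combinations.comb-+ ℤ-algebra (λ j → + dig m j) (λ j → ℤ.- + dig n j) (λ j → v j i))
        (cong (λ z → values m i ℤ.+ z) (Combinations.comb-neg ℤ-algebra (λ j → + dig n j) (λ j → v j i)))

abstract
  integer-dependence : ∀ {D} (v : Fin (suc D) → Fin D → ℤ) →
                       ∃[ c ] Nonzero c × ∀ i → sumℤ (λ j → c j ℤ.* v j i) ≡ + 0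
  integer-dependence v = integer-dependence′ v _ _
    (λ j i → ℕ.≤-trans (proj₂ (maxOf λ i → ∣ v j i ∣) i) (proj₂ (maxOf λ j → proj₁ (maxOf λ i → ∣ v j i ∣)) j)) ℕ.≤-refl

module GeneratorCoordinates (A : ℤ-Algebra) (fg : FinitelyGenerated A) where
  open ℤ-Algebra A
  open Solver A
  open Combinations A
  open FinitelyGenerated fg

  coord : ∀ {gs x} → Span gs x → ∃[ c ] x ≈ comb c (List.lookup gs)
  coord ([] x≈0) = (λ ()) , x≈0
  coord {g ∷ gs} {x} (cons c s) with coord s
  ... | d , eq = (λ { zero → c ; (suc i) → d i }) , ≈-trans
    (solve 2 (λ x y → x := y :+ (x :- y)) ≈-refl x (ι c * g)) (+-congˡ eq)

  rank : ℕ
  rank = length generators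

  gen : Fin rank → Carrier
  gen = List.lookup generators

  coords : Carrier → Fin rank → ℤ
  coords x = proj₁ (coord (span x))

  coords-spec : ∀ x → x ≈ comb (coords x) gen
  coords-spec x = proj₂ (coord (span x))

  dependence : ∀ (w : Fin (suc rank) → Carrier) → ∃[ c ] Nonzero c × comb c w ≈ 0#
  dependence w = conclude (integer-dependence (coords ∘ w))
    where
    module S = Sum semiring
    open SetoidReasoning setoid
    conclude : ∃[ c ] Nonzero c × (∀ i → sumℤ (λ j → c j ℤ.* coords (w j) i) ≡ + 0) →
               ∃[ c ] Nonzero c × comb c w ≈ 0#
    conclude (c , c≢0 , eq) = c , c≢0 , (begin
      comb c w ≈⟨ S.sum-cong-≋ (λ j → ≈-trans (*-congˡ (coords-spec (w j))) (≈-sym (comb-* (c j) (coords (w j)) gen))) ⟩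
      S.sum (λ j → comb (λ i → c j ℤ.* coords (w j) i) gen) ≈⟨ comb-sum (λ j i → c j ℤ.* coords (w j) i) gen ⟨
      comb (λ i → sumℤ (λ j → c j ℤ.* coords (w j) i)) gen  ≈⟨ comb-cong gen eq ⟩
      comb (λ _ → + 0) gen                           ≈⟨ comb-0 gen ⟩
      0#                                             ∎)

  residue-pigeonhole : ∀ n → n ≢ + 0 → ∀ {N} → ∣ n ∣ ^ rank < N → (w : Fin N → Carrier) →
                       ∃₂ λ i j → i ≢ j × ∃[ h ] w i - w j ≈ ι n * h
  residue-pigeonhole n n≢0 {N} small w = conclude (pigeonhole-vectors small residues)
    where
    open SetoidReasoning setoid
    instance
      n-nonZero : ℤ.NonZero n
      n-nonZero = ℤ.≢-nonZero n≢0
    residues : Fin N → Fin rank → Fin ∣ n ∣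
    residues i d = fromℕ< (ℤ.n%d<d (coords (w i) d) n)
    conclude : (∃₂ λ i j → i ≢ j × (∀ d → residues i d ≡ residues j d)) →
               ∃₂ λ i j → i ≢ j × ∃[ h ] w i - w j ≈ ι n * h
    conclude (i , j , i≢j , same) = i , j , i≢j , comb quotients gen , (begin
      w i - w j ≈⟨ +-cong (coords-spec (w i)) (-‿cong (coords-spec (w j))) ⟩
      comb (coords (w i)) gen - comb (coords (w j)) gen ≈⟨ comb-- (coords (w i)) (coords (w j)) gen ⟨
      comb (λ d → coords (w i) d ℤ.- coords (w j) d) gen ≈⟨ comb-cong gen multiple ⟩
      comb (λ d → n ℤ.* quotients d) gen ≈⟨ comb-* n quotients gen ⟩
      ι n * comb quotients gen ∎)
      where
      quotients : Fin rank → ℤ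
      quotients d = coords (w i) d ℤ./ n ℤ.- coords (w j) d ℤ./ n
      identity : ∀ r a b n → (r ℤ.+ a ℤ.* n) ℤ.- (r ℤ.+ b ℤ.* n) ≡ n ℤ.* (a ℤ.- b)
      identity = ℤSolver.solve-∀
      same-residue : ∀ d → coords (w i) d ℤ.% n ≡ coords (w j) d ℤ.% n
      same-residue d = ≡.trans (≡.sym (Fin.toℕ-fromℕ< _)) (≡.trans (cong toℕ (same d)) (Fin.toℕ-fromℕ< _))
      multiple : ∀ d → coords (w i) d ℤ.- coords (w j) d ≡ n ℤ.* quotients d
      multiple d = ≡.trans (cong₂ ℤ._-_ (ℤ.a≡a%n+[a/n]*n (coords (w i) d) n) (ℤ.a≡a%n+[a/n]*n (coords (w j) d) n))
        (≡.trans (cong (λ r → (+ r ℤ.+ (coords (w i) d ℤ./ n) ℤ.* n) ℤ.- (+ (coords (w j) d ℤ.% n) ℤ.+ (coords (w j) d ℤ./ n) ℤ.* n)) (same-residue d))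
          (identity (+ (coords (w j) d ℤ.% n)) (coords (w i) d ℤ./ n) (coords (w j) d ℤ./ n) n))

module PrimeIdeals (Ans : Set) (A : ℤ-Algebra) where
  open Classical Ans
  open ℤ-Algebra A
  open Solver A
  open Combinations A
  open Ideals A

  Prime-ideal : Ideal → Set
  Prime-ideal J = ∀ x y → x * y ∈I → Cl (x ∈I ⊎ y ∈I)
    where open Ideal J

  infix 4 _⊑_
  _⊑_ : Ideal → Ideal → Set
  I ⊑ J = ∀ {x} → Ideal._∈I I x → Ideal._∈I J x

  adjoin : Ideal → Carrier → Ideal
  adjoin J x = record
    { _∈I  = λ u → ∃[ v ] u - v * x ∈I
    ; resp = λ { e (v , d) → v , resp (+-congʳ e) d }
    ; 0∈   = 0# , resp (solve 1 (λ x → con (+ 0) := con (+ 0) :- con (+ 0) :* x) ≈-refl x) 0∈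
    ; +∈   = λ { {a} {b} (v , d) (v′ , d′) → v + v′ , resp
        (solve 5 (λ a b v v′ x → (a :- v :* x) :+ (b :- v′ :* x) := (a :+ b) :- (v :+ v′) :* x) ≈-refl a b v v′ x) (+∈ d d′) }
    ; *∈   = λ { r {a} (v , d) → r * v , resp
        (solve 4 (λ r a v x → r :* (a :- v :* x) := r :* a :- (r :* v) :* x) ≈-refl r a v x) (*∈ r d) } }
    where open Ideal J

  ⊑-adjoin : ∀ J x → J ⊑ adjoin J x
  ⊑-adjoin J x {u} u∈ = 0# , Ideal.resp J (solve 2 (λ u x → u := u :- con (+ 0) :* x) ≈-refl u x) u∈

  -- An ideal maximal among those avoiding a multiplicative set of integers is prime; the measure μ
  -- replaces Zorn's lemma.
  module _ (S : ℤ → Set) (S-1 : S (+ 1)) (S-* : ∀ {m n} → S m → S n → S (m ℤ.* n)) where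

    Avoids : Ideal → Set
    Avoids J = ∀ {s} → S s → Ideal._∈I J (ι s) → Ans

    -- For S the nonzero integers this kills the torsion of A/J. An element outside it has no
    -- multiple by a member of S in J, which is what lowers the measure when the element is
    -- adjoined.
    saturation : Ideal → Ideal
    saturation J = record
      { _∈I  = λ u → ∃[ s ] S s × ι s * u ∈I
      ; resp = λ { e (s , Ss , d) → s , Ss , resp (*-congˡ e) d }
      ; 0∈   = + 1 , S-1 , *∈ _ 0∈
      ; +∈   = λ { {a} {b} (s , Ss , d) (t , St , d′) → s ℤ.* t , S-* Ss St , resp
          (≈-trans (solve 4 (λ s t a b → t :* (s :* a) :+ s :* (t :* b) := (s :* t) :* (a :+ b)) ≈-refl (ι s) (ι t) a b)
            (*-congʳ (≈-sym (ι-* s t)))) (+∈ (*∈ (ι t) d) (*∈ (ι s) d′)) }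
      ; *∈   = λ { r {a} (s , Ss , d) → s , Ss , resp
          (solve 3 (λ r s a → r :* (s :* a) := s :* (r :* a)) ≈-refl r (ι s) a) (*∈ r d) } }
      where open Ideal J

    module _ (μ : ℕ → Ideal → Set)
             (base : ∀ J → Avoids J → μ 0 J → Ans)
             (step : ∀ k J x → μ (suc k) J → (Ideal._∈I (saturation J) x → Ans) → μ k (adjoin J x)) where

      primeIdeal : ∀ k J → μ k J → Avoids J → Cl (∃[ J′ ] J ⊑ J′ × Avoids J′ × Prime-ideal J′)
      primeIdeal zero    J μJ avoids = λ _ → base J avoids μJ
      primeIdeal (suc k) J μJ avoids K = lem (∃₂ λ x y → x * y ∈S × (x ∈S → Ans) × (y ∈S → Ans)) λ where
          (inj₂ none) → K (saturation J , (λ {x} x∈ → + 1 , S-1 , *∈ _ x∈)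
            , (λ { {s} Ss (t , St , d) → avoids (S-* St Ss) (resp (≈-sym (ι-* t s)) d) })
            , (λ x y xy∈ K′ → lem (x ∈S) λ where
                (inj₁ x∈) → K′ (inj₁ x∈)
                (inj₂ x∉) → lem (y ∈S) λ where
                  (inj₁ y∈) → K′ (inj₂ y∈)
                  (inj₂ y∉) → none (x , y , xy∈ , x∉ , y∉)))
          -- If J + (x) or J + (y) avoids S, the search goes on there with a smaller measure.
          -- Otherwise they contain some s and t of S, and multiplying out puts r s t into J.
          (inj₁ (x , y , (r , Sr , rxy∈) , x∉ , y∉)) → try x x∉ λ {s} Ss (v , d) → try y y∉ λ {t} St (v′ , d′) →
            avoids (S-* Sr (S-* Ss St)) (resp
              (≈-trans (solve 7 (λ r s t v v′ x y →
                (r :* t) :* (s :- v :* x) :+ ((r :* v :* x) :* (t :- v′ :* y) :+ (v :* v′) :* (r :* (x :* y))) :=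
                r :* (s :* t)) ≈-refl (ι r) (ι s) (ι t) v v′ x y)
                (≈-sym (≈-trans (ι-* r (s ℤ.* t)) (*-congˡ (ι-* s t)))))
              (+∈ (*∈ _ d) (+∈ (*∈ _ d′) (*∈ _ rxy∈))))
        where
        open Ideal J
        open Ideal (saturation J) using () renaming (_∈I to _∈S)
        try : ∀ x → (x ∈S → Ans) → Avoids (adjoin J x) → Ans
        try x x∉ avoids′ = primeIdeal k (adjoin J x) (step k J x μJ x∉) avoids′ λ where
          (J′ , sub , rest) → K (J′ , (λ u∈ → sub (⊑-adjoin J x u∈)) , rest)

  -- The rank of A/J is less than k.
  DependentModulo : ℕ → Ideal → Set
  DependentModulo k J = ∀ (w : Fin k → Carrier) → Cl (∃[ c ] Nonzero c × Ideal._∈I J (comb c w))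

  primeIdeal-avoidingℤ : ∀ k J → DependentModulo k J → Avoids (_≢ + 0) (λ ()) *≢0 J →
                         Cl (∃[ J′ ] J ⊑ J′ × Avoids (_≢ + 0) (λ ()) *≢0 J′ × Prime-ideal J′)
  primeIdeal-avoidingℤ = primeIdeal (_≢ + 0) (λ ()) *≢0 DependentModulo
    (λ J avoids dep → dep (λ ()) λ { (c , (() , _) , _) })
    step
    where
    step : ∀ k J x → DependentModulo (suc k) J → (Ideal._∈I (saturation (_≢ + 0) (λ ()) *≢0 J) x → Ans) →
           DependentModulo k (adjoin J x)
    step k J x dep x∉ w K = dep (λ { zero → x ; (suc i) → w i }) λ where
        (c , c≢0 , d) → case nonzero? (c ∘ suc) of λ where
          (inj₁ nz)  → K (c ∘ suc , nz , - ι (c zero) , resp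
            (solve 3 (λ c x y → c :* x :+ y := y :- (:- c) :* x) ≈-refl (ι (c zero)) x (comb (c ∘ suc) w)) d)
          (inj₂ all) → x∉ (c zero , head≢0 c c≢0 all , resp
            (≈-trans (+-congˡ (≈-trans (comb-cong w all) (comb-0 w))) (+-identityʳ _)) d)
      where
      open Ideal J
      head≢0 : ∀ c → Nonzero c → (∀ i → c (suc i) ≡ + 0) → c zero ≢ + 0
      head≢0 c (zero  , c≢0) all = c≢0
      head≢0 c (suc i , c≢0) all = contradiction (all i) c≢0

  Proper : Ideal → Set
  Proper J = Ideal._∈I J 1# → Ans

  -- A/J has fewer than k elements.
  CongruentModulo : ℕ → Ideal → Set
  CongruentModulo k J = ∀ (w : Fin k → Carrier) → Cl (∃₂ λ i j → i ≢ j × Ideal._∈I J (w i - w j))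

  primeIdeal-proper : ∀ k J → CongruentModulo k J → Proper J → Cl (∃[ J′ ] J ⊑ J′ × Proper J′ × Prime-ideal J′)
  primeIdeal-proper k J small proper K =
    primeIdeal (_≡ + 1) refl (λ { refl refl → refl }) CongruentModulo
      (λ J avoids small → small (λ ()) λ { (() , _) }) step k J small
      (λ { refl 1∈ → proper (Ideal.resp J ι-1 1∈) })
      λ { (J′ , sub , avoids , pr) → K (J′ , sub , (λ 1∈ → avoids refl (Ideal.resp J′ (≈-sym ι-1) 1∈)) , pr) }
    where
    step : ∀ k J x → CongruentModulo (suc k) J → (Ideal._∈I (saturation (_≡ + 1) refl (λ { refl refl → refl }) J) x → Ans) →
           CongruentModulo k (adjoin J x)
    step zero    J x small x∉ w K = small (λ _ → 0#) λ { (zero , zero , 0≢0 , _) → contradiction refl 0≢0 }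
    -- A coincidence modulo J among w₀ + x, w₀, w₁, ... is one modulo J + (x) among the w, unless it
    -- is w₀ + x ≡ w₀, which would put x into J.
    step (suc k) J x small x∉ w K = small (λ { zero → w zero + x ; (suc i) → w i }) λ where
        (zero  , zero  , i≢j , d) → contradiction refl i≢j
        (suc i , suc j , i≢j , d) → K (i , j , i≢j ∘ cong suc , ⊑-adjoin J x d)
        (zero  , suc j , i≢j , d) → split j d
        (suc i , zero  , i≢j , d) → split i (resp
          (solve 3 (λ u x v → :- (v :- (u :+ x)) := (u :+ x) :- v) ≈-refl (w zero) x (w i)) (neg∈ d))
      where
      open Ideal J
      split : ∀ j → (w zero + x) - w j ∈I → Ans
      split zero    d = x∉ (+ 1 , refl , resp
        (≈-trans (solve 2 (λ u x → (u :+ x) :- u := con (+ 1) :* x) ≈-refl (w zero) x) (*-congʳ (≈-sym ι-1))) d)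
      split (suc j) d = K (zero , suc j , (λ ()) , - 1# , resp
        (solve 3 (λ u x v → (u :+ x) :- v := (u :- v) :- (:- con (+ 1)) :* x) ≈-refl (w zero) x (w (suc j))) d)

-- Irreducibility over ℚ

ℚ-algebra : ℤ-Algebra
ℚ-algebra = record
  { commRing = ℚ.+-*-commutativeRing ; ι = ℚ._/ 1
  ; ι-+ = λ m n → ℚ.toℚᵘ-injective (ℚᵘ.≃-trans (toℚᵘ-/1 (m ℤ.+ n))
      (ℚᵘ.≃-trans (ℚᵘ.*≡* (add m n))
        (ℚᵘ.≃-sym (ℚᵘ.≃-trans (ℚ.toℚᵘ-homo-+ (m ℚ./ 1) (n ℚ./ 1)) (ℚᵘ.+-cong (toℚᵘ-/1 m) (toℚᵘ-/1 n))))))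
  ; ι-* = λ m n → ℚ.toℚᵘ-injective (ℚᵘ.≃-trans (toℚᵘ-/1 (m ℤ.* n))
      (ℚᵘ.≃-trans (ℚᵘ.*≡* refl)
        (ℚᵘ.≃-sym (ℚᵘ.≃-trans (ℚ.toℚᵘ-homo-* (m ℚ./ 1) (n ℚ./ 1)) (ℚᵘ.*-cong (toℚᵘ-/1 m) (toℚᵘ-/1 n))))))
  ; ι-‿ = λ m → ℚ.toℚᵘ-injective (ℚᵘ.≃-trans (toℚᵘ-/1 (ℤ.- m))
      (ℚᵘ.≃-sym (ℚᵘ.≃-trans (ℚ.toℚᵘ-homo‿- (m ℚ./ 1)) (ℚᵘ.-‿cong (toℚᵘ-/1 m)))))
  ; ι-0 = refl ; ι-1 = refl }
  where
  toℚᵘ-/1 : ∀ n → ℚ.toℚᵘ (n ℚ./ 1) ℚᵘ.≃ ℚᵘ.mkℚᵘ n 0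
  toℚᵘ-/1 n = ℚ.toℚᵘ-fromℚᵘ (ℚᵘ.mkℚᵘ n 0)
  add : ∀ m n → (m ℤ.+ n) ℤ.* + 1 ≡ (m ℤ.* + 1 ℤ.+ n ℤ.* + 1) ℤ.* + 1
  add = ℤSolver.solve-∀

/1-injective : ∀ {n} → n ℚ./ 1 ≡ ℚ.0ℚ → n ≡ + 0
/1-injective {n} eq = ≡.trans (≡.sym (ℤ.*-identityʳ n)) (ℚᵘ.drop-*≡* (ℚᵘ.≃-trans
  (ℚᵘ.≃-sym (ℚ.toℚᵘ-fromℚᵘ (ℚᵘ.mkℚᵘ n 0))) (ℚᵘ.≃-reflexive (cong ℚ.toℚᵘ eq))))

module ℤ-Poly where
  open PolyRing ℤ-algebra public
  open PolyProperties ℤ-algebra public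

module ℤ[X] = ℤ-Algebra (PolyRing.algebra ℤ-algebra)
module ℤ[X]-Solver = Solver (PolyRing.algebra ℤ-algebra)

module ScalarExtension (A : ℤ-Algebra) where
  open ℤ-Algebra A
  private
    module Z = PolyRing ℤ-algebra
    module P = PolyRing A

  coeff-ι : ∀ p k → P.coeff (map ι p) k ≈ ι (Z.coeff p k)
  coeff-ι []      k       = ≈-sym ι-0
  coeff-ι (a ∷ p) zero    = ≈-refl
  coeff-ι (a ∷ p) (suc k) = coeff-ι p k

  ι-≋ : ∀ {p q} → p Z.≋ q → map ι p P.≋ map ι q
  ι-≋ {p} {q} (Z.mk eq) = P.mk λ k → ≈-trans (coeff-ι p k) (≈-trans (≡⇒≈ (cong ι (eq k))) (≈-sym (coeff-ι q k)))

  ι-+ₚ : ∀ p q → map ι (p Z.+ₚ q) P.≋ map ι p P.+ₚ map ι q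
  ι-+ₚ p q = P.mk λ k → ≈-trans (coeff-ι (p Z.+ₚ q) k) (≈-trans (≡⇒≈ (cong ι (Z.coeff-+ p q k)))
    (≈-trans (ι-+ _ _) (≈-sym (≈-trans (P.coeff-+ (map ι p) (map ι q) k) (+-cong (coeff-ι p k) (coeff-ι q k))))))

  ι-scale : ∀ a p → map ι (map (a ℤ.*_) p) P.≋ map (ι a *_) (map ι p)
  ι-scale a p = P.mk λ k → ≈-trans (coeff-ι (map (a ℤ.*_) p) k) (≈-trans (≡⇒≈ (cong ι (Z.coeff-scale a p k)))
    (≈-trans (ι-* _ _) (≈-sym (≈-trans (P.coeff-scale (ι a) (map ι p) k) (*-congˡ (coeff-ι p k))))))

  ι-*ₚ : ∀ p q → map ι (p Z.*ₚ q) P.≋ map ι p P.*ₚ map ι q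
  ι-*ₚ []      q = P.≋-refl
  ι-*ₚ (a ∷ p) q = P.≋-trans (ι-+ₚ (map (a ℤ.*_) q) (+ 0 ∷ p Z.*ₚ q))
    (P.+ₚ-cong (ι-scale a q) (P.∷-cong ι-0 (ι-*ₚ p q)))

  ι-derivative : ∀ p → PolyProperties.derivative A (map ι p) P.≋ map ι (ℤ-Poly.derivative p)
  ι-derivative []      = P.≋-refl
  ι-derivative (a ∷ p) = P.≋-trans (P.+ₚ-cong (P.≋-refl {map ι p}) (P.∷-cong (≈-sym ι-0) (ι-derivative p)))
    (P.≋-sym (ι-+ₚ p (+ 0 ∷ ℤ-Poly.derivative p)))

  evalₚ-ι : ∀ p n → P.evalₚ (map ι p) (ι n) ≈ ι (eval p n)
  evalₚ-ι []      n = ≈-sym ι-0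
  evalₚ-ι (a ∷ p) n = ≈-sym (≈-trans (ι-+ _ _) (+-congˡ (≈-trans (ι-* _ _) (*-congˡ (≈-sym (evalₚ-ι p n))))))

open ℤ-Poly

degree : ∀ p → p ≋ [] ⊎ ∃[ k ] coeff p k ≢ + 0 × Vanishes p (suc k)
degree []      = inj₁ ≋-refl
degree (a ∷ p) with degree p
... | inj₂ (k , lead , van) = inj₂ (suc k , lead , λ { (suc j) (s≤s k<j) → van j k<j })
... | inj₁ p≋[] with a ℤ.≟ + 0
...   | yes a≡0 = inj₁ (∷≋[] a≡0 p≋[])
...   | no  a≢0 = inj₂ (0 , a≢0 , λ { (suc j) _ → at p≋[] j })

module _ (a : ℤ) where
  dilate : List ℤ → List ℤ
  dilate []      = []
  dilate (b ∷ p) = b ∷ map (a ℤ.*_) (dilate p)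

  coeff-dilate : ∀ p k → coeff (dilate p) k ≡ a ℤ.^ k ℤ.* coeff p k
  coeff-dilate []      k       = ≡.sym (ℤ.*-zeroʳ (a ℤ.^ k))
  coeff-dilate (b ∷ p) zero    = ≡.sym (ℤ.*-identityˡ b)
  coeff-dilate (b ∷ p) (suc k) = ≡.trans (coeff-scale a (dilate p) k)
    (≡.trans (cong (a ℤ.*_) (coeff-dilate p k)) (≡.sym (ℤ.*-assoc a (a ℤ.^ k) (coeff p k))))

  dilate-≋ : ∀ {p q} → p ≋ q → dilate p ≋ dilate q
  dilate-≋ {p} {q} (mk eq) = mk λ k → ≡.trans (coeff-dilate p k)
    (≡.trans (cong (a ℤ.^ k ℤ.*_) (eq k)) (≡.sym (coeff-dilate q k)))

  dilate-+ₚ : ∀ p q → dilate (p +ₚ q) ≋ dilate p +ₚ dilate q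
  dilate-+ₚ p q = mk λ k → ≡.trans (coeff-dilate (p +ₚ q) k) (≡.trans (cong (a ℤ.^ k ℤ.*_) (coeff-+ p q k))
    (≡.trans (ℤ.*-distribˡ-+ (a ℤ.^ k) (coeff p k) (coeff q k)) (≡.sym (≡.trans (coeff-+ (dilate p) (dilate q) k)
      (cong₂ ℤ._+_ (coeff-dilate p k) (coeff-dilate q k))))))

  dilate-scale : ∀ b p → dilate (map (b ℤ.*_) p) ≋ map (b ℤ.*_) (dilate p)
  dilate-scale b p = mk λ k → ≡.trans (coeff-dilate (map (b ℤ.*_) p) k) (≡.trans (cong (a ℤ.^ k ℤ.*_) (coeff-scale b p k))
    (≡.trans (swap (a ℤ.^ k) b (coeff p k)) (≡.sym (≡.trans (coeff-scale b (dilate p) k) (cong (b ℤ.*_) (coeff-dilate p k))))))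
    where
    swap : ∀ x y z → x ℤ.* (y ℤ.* z) ≡ y ℤ.* (x ℤ.* z)
    swap = ℤSolver.solve-∀

  dilate-*ₚ : ∀ p q → dilate (p *ₚ q) ≋ dilate p *ₚ dilate q
  dilate-*ₚ []      q = ≋-refl
  dilate-*ₚ (b ∷ p) q = ≋-trans (dilate-+ₚ (map (b ℤ.*_) q) (+ 0 ∷ p *ₚ q))
    (+ₚ-cong (dilate-scale b q) (∷-cong refl (≋-trans (scale-cong {a} {a} refl (dilate-*ₚ p q)) (≋-sym (scale-*ₚ a (dilate p) (dilate q))))))

  eval-dilate : ∀ p r → eval (dilate p) r ≡ eval p (a ℤ.* r)
  eval-dilate []      r = refl
  eval-dilate (b ∷ p) r = cong (λ z → b ℤ.+ z) (≡.trans (cong (r ℤ.*_) (evalₚ-scale a (dilate p) r))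
    (≡.trans (swap r a (eval (dilate p) r)) (cong (a ℤ.* r ℤ.*_) (eval-dilate p r))))
    where
    swap : ∀ r a x → r ℤ.* (a ℤ.* x) ≡ a ℤ.* r ℤ.* x
    swap = ℤSolver.solve-∀

^≢0 : ∀ {a} → a ≢ + 0 → ∀ k → a ℤ.^ k ≢ + 0
^≢0 a≢0 (suc k) = *≢0 a≢0 (^≢0 a≢0 k)

module _ (P : ℤ[x]) (irreducible : IrreducibleOverℚ P) where
  private
    module Q = PolyRing ℚ-algebra
    module QP = PolyProperties ℚ-algebra
    open ScalarExtension ℚ-algebra
    open RawSemiringDefinitions.Irreducible irreducible

    unit⇒constant : ∀ X → ¬ X ≋ [] → (∃[ w ] (w Q.*ₚ map (ℚ._/ 1) X) Q.≋ ℚ.1ℚ ∷ []) → Vanishes X 1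
    unit⇒constant X X≢0 (w , eq) with degree X
    ... | inj₁ X≋0               = contradiction X≋0 X≢0
    ... | inj₂ (zero  , _ , van) = van
    ... | inj₂ (suc k , lead , van) = contradiction (≡.trans (≡.sym (Q.at eq 0)) (Q.at w*X≋0 0)) λ ()
      where
      w≋0 : w Q.≋ []
      w≋0 = QP.cancel-lead (map (ℚ._/ 1) X) (suc k)
        (λ j k<j → ≡.trans (coeff-ι X j) (cong (ℚ._/ 1) (van j k<j)))
        (λ x x*lead≡0 → cancel x (≡.trans (cong (x ℚ.*_) (≡.sym (coeff-ι X (suc k)))) x*lead≡0))
        w λ { (suc j) _ → Q.at eq (suc j) }
        where
        instance
          lead-nonZero : ℚ.NonZero (coeff X (suc k) ℚ./ 1)
          lead-nonZero = ℚ.≢-nonZero (lead ∘ /1-injective)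
        cancel : ∀ x → x ℚ.* (coeff X (suc k) ℚ./ 1) ≡ ℚ.0ℚ → x ≡ ℚ.0ℚ
        cancel x eq′ = ≡.trans (≡.sym (≡.trans (ℚ.*-assoc x lead′ (ℚ.1/ lead′))
          (≡.trans (cong (x ℚ.*_) (ℚ.*-inverseʳ lead′)) (ℚ.*-identityʳ x))))
          (≡.trans (cong (ℚ._* (ℚ.1/ lead′)) eq′) (ℚ.*-zeroˡ (ℚ.1/ lead′)))
          where
          lead′ : ℚ
          lead′ = coeff X (suc k) ℚ./ 1
      w*X≋0 : (w Q.*ₚ map (ℚ._/ 1) X) Q.≋ []
      w*X≋0 = Q.*ₚ-cong {w} {[]} {map (ℚ._/ 1) X} {map (ℚ._/ 1) X} w≋0 Q.≋-refl

  -- The only form in which irreducibility is used. Carrying the denominator n along makes Gauss's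
  -- lemma unnecessary.
  irreducible-split : ∀ {n} → n ≢ + 0 → ∀ X Y → ¬ X ≋ [] → ¬ Y ≋ [] → (n ∷ []) *ₚ P ≋ X *ₚ Y →
                      Vanishes X 1 ⊎ Vanishes Y 1
  irreducible-split {n} n≢0 X Y X≢0 Y≢0 eq = case split-∣1 {(n⁻¹ ∷ []) Q.*ₚ map (ℚ._/ 1) X} {map (ℚ._/ 1) Y} (Q.at factors) of λ where
      (inj₁ (w RawMagmaDefinitions., unit)) → inj₁ (unit⇒constant X X≢0 (w Q.*ₚ (n⁻¹ ∷ []) ,
        Q.≋-trans (Q.*ₚ-assoc w (n⁻¹ ∷ []) (map (ℚ._/ 1) X)) (Q.mk unit)))
      (inj₂ (w RawMagmaDefinitions., unit)) → inj₂ (unit⇒constant Y Y≢0 (w , Q.mk unit))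
    where
    instance
      n-nonZero : ℚ.NonZero (n ℚ./ 1)
      n-nonZero = ℚ.≢-nonZero (n≢0 ∘ /1-injective)
    n⁻¹ : ℚ
    n⁻¹ = ℚ.1/ (n ℚ./ 1)
    factors : map (ℚ._/ 1) P Q.≋ ((n⁻¹ ∷ []) Q.*ₚ map (ℚ._/ 1) X) Q.*ₚ map (ℚ._/ 1) Y
    factors = Q.≋-sym (Q.≋-trans (Q.*ₚ-assoc (n⁻¹ ∷ []) (map (ℚ._/ 1) X) (map (ℚ._/ 1) Y))
      (Q.≋-trans (Q.*ₚ-congˡ (n⁻¹ ∷ []) (Q.≋-trans (Q.≋-sym (ι-*ₚ X Y)) (Q.≋-trans (ι-≋ (≋-sym eq)) (ι-*ₚ (n ∷ []) P))))
      (Q.≋-trans (Q.≋-sym (Q.*ₚ-assoc (n⁻¹ ∷ []) (n ℚ./ 1 ∷ []) (map (ℚ._/ 1) P)))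
      (Q.≋-trans (Q.*ₚ-cong {(n⁻¹ ∷ []) Q.*ₚ (n ℚ./ 1 ∷ [])} {ℚ.1ℚ ∷ []} {map (ℚ._/ 1) P} {map (ℚ._/ 1) P}
          (Q.≋-trans (Q.const-*ₚ n⁻¹ (n ℚ./ 1 ∷ [])) (Q.∷-cong (ℚ.*-inverseˡ (n ℚ./ 1)) Q.≋-refl)) Q.≋-refl)
        (Q.*ₚ-identityˡ (map (ℚ._/ 1) P))))))

coeff-applyUpTo : ∀ (f : ℕ → ℤ) n {k} → k < n → coeff (List.applyUpTo f n) k ≡ f k
coeff-applyUpTo f (suc n) {zero}  _         = refl
coeff-applyUpTo f (suc n) {suc k} (s≤s k<n) = coeff-applyUpTo (f ∘ suc) n k<n

applyUpTo-vanishes : ∀ (f : ℕ → ℤ) n → Vanishes (List.applyUpTo f n) n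
applyUpTo-vanishes f zero    j       _         = refl
applyUpTo-vanishes f (suc n) (suc j) (s≤s n≤j) = applyUpTo-vanishes (f ∘ suc) n j n≤j

-- With a the leading coefficient of P, the element a x of ℚ[x]/P is a root of the monic polynomial Q.
module MonicModel (P : ℤ[x]) (e : ℕ) (P-degree : HasDegree P (suc e)) where

  a : ℤ
  a = coeff P (suc e)

  a≢0 : a ≢ + 0
  a≢0 = proj₁ P-degree

  -- The coefficients of a^e P(X / a). The top one stands apart because truncated subtraction would
  -- give a^0 where a^(-1) is meant.
  Q-coeff : ℕ → ℤ
  Q-coeff k with k ℕ.≟ suc e
  ... | yes _ = + 1
  ... | no  _ = coeff P k ℤ.* a ℤ.^ (e ℕ.∸ k)

  Q : ℤ[x]
  Q = List.applyUpTo Q-coeff (suc (suc e))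

  Q-vanishes : Vanishes Q (suc (suc e))
  Q-vanishes = applyUpTo-vanishes Q-coeff (suc (suc e))

  Q-monic : coeff Q (suc e) ≡ + 1
  Q-monic = ≡.trans (coeff-applyUpTo Q-coeff (suc (suc e)) (ℕ.n<1+n (suc e))) top
    where
    top : Q-coeff (suc e) ≡ + 1
    top with suc e ℕ.≟ suc e
    ... | yes _ = refl
    ... | no  ≢ = contradiction refl ≢

  private
    a^*Q-coeff : ∀ k → k ≤ suc e → a ℤ.^ k ℤ.* Q-coeff k ≡ a ℤ.^ e ℤ.* coeff P k
    a^*Q-coeff k k≤d with k ℕ.≟ suc e
    ... | yes refl = ≡.trans (ℤ.*-identityʳ _) (ℤ.*-comm a (a ℤ.^ e))
    ... | no  k≢d  = ≡.trans (swap (a ℤ.^ k) (coeff P k) (a ℤ.^ (e ℕ.∸ k)))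
      (cong (ℤ._* coeff P k) (≡.trans (≡.sym (ℤ.^-distribˡ-+-* a k (e ℕ.∸ k)))
        (cong (a ℤ.^_) (ℕ.m+[n∸m]≡n (ℕ.≤-pred (ℕ.≤∧≢⇒< k≤d k≢d))))))
      where
      swap : ∀ x y z → x ℤ.* (y ℤ.* z) ≡ x ℤ.* z ℤ.* y
      swap = ℤSolver.solve-∀

  dilate-Q : dilate a Q ≋ (a ℤ.^ e ∷ []) *ₚ P
  dilate-Q = mk λ k → ≡.trans (coeff-dilate a Q k) (≡.trans (main k)
    (≡.sym (≡.trans (at (const-*ₚ (a ℤ.^ e) P) k) (coeff-scale (a ℤ.^ e) P k))))
    where
    main : ∀ k → a ℤ.^ k ℤ.* coeff Q k ≡ a ℤ.^ e ℤ.* coeff P k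
    main k with k ℕ.≤? suc e
    ... | yes k≤d = ≡.trans (cong (a ℤ.^ k ℤ.*_) (coeff-applyUpTo Q-coeff (suc (suc e)) (s≤s k≤d))) (a^*Q-coeff k k≤d)
    ... | no  k≰d = ≡.trans (cong (a ℤ.^ k ℤ.*_) (Q-vanishes k (ℕ.≰⇒> k≰d))) (≡.trans (ℤ.*-zeroʳ (a ℤ.^ k))
      (≡.sym (≡.trans (cong (a ℤ.^ e ℤ.*_) (proj₂ P-degree k (ℕ.≰⇒> k≰d))) (ℤ.*-zeroʳ (a ℤ.^ e)))))

  eval-Q : ∀ r → eval Q (a ℤ.* r) ≡ a ℤ.^ e ℤ.* eval P r
  eval-Q r = ≡.trans (≡.sym (eval-dilate a Q r)) (≡.trans (evalₚ-cong r dilate-Q)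
    (≡.trans (evalₚ-cong {(a ℤ.^ e ∷ []) *ₚ P} {map (a ℤ.^ e ℤ.*_) P} r (const-*ₚ (a ℤ.^ e) P)) (evalₚ-scale (a ℤ.^ e) P r)))

  module Order = Adjoin ℤ-algebra Q (suc e)

  O : ℤ-Algebra
  O = Order.extension

  open Ideals.Ideal Order.fIdeal renaming (_∈I to _∈Q) public using ()
  private module QI = Ideals.Ideal Order.fIdeal

  small∈Q : ∀ {f} → Vanishes f (suc e) → f ∈Q → f ≋ []
  small∈Q = Order.vanishes∈⇒≋[] Q-monic Q-vanishes

  -- The remainder ρ of f modulo the monic Q satisfies m ρ ∈ (Q), and its degree is too low for that
  -- unless m ρ = 0.
  Q-torsionFree : ∀ {m f} → m ≢ + 0 → (m ∷ []) *ₚ f ∈Q → f ∈Q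
  Q-torsionFree {m} {f} m≢0 mf∈ with Order.divide Q-monic Q-vanishes f
  ... | v , ρ , van , eq = v , ≋-trans eq (≋-trans (+ₚ-cong (≋-refl {v *ₚ Q}) ρ≋[]) (+ₚ-identityʳ (v *ₚ Q)))
    where
    mρ : map (m ℤ.*_) ρ ≋ []
    mρ = small∈Q
      (λ j d≤j → ≡.trans (coeff-scale m ρ j) (≡.trans (cong (m ℤ.*_) (van j d≤j)) (ℤ.*-zeroʳ m)))
      (QI.resp
        (≋-trans (ℤ[X].+-congʳ { -ₚ ((m ∷ []) *ₚ (v *ₚ Q))} (ℤ[X].*-congˡ {m ∷ []} eq))
          (≋-trans (solve 3 (λ m v r → m :* (v :+ r) :- m :* v := m :* r) ≋-refl (m ∷ []) (v *ₚ Q) ρ)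
            (const-*ₚ m ρ)))
        (QI.-∈ mf∈ (QI.*∈ (m ∷ []) (v , ≋-refl))))
      where open ℤ[X]-Solver
    ρ≋[] : ρ ≋ []
    ρ≋[] = mk λ k → case ℤ.i*j≡0⇒i≡0∨j≡0 m (≡.trans (≡.sym (coeff-scale m ρ k)) (at mρ k)) of λ where
      (inj₁ m≡0) → contradiction m≡0 m≢0
      (inj₂ ρ≡0) → ρ≡0

  O-char0 : ∀ {n} → n ∷ [] ∈Q → n ≡ + 0
  O-char0 {n} n∈ = at (small∈Q (λ { (suc j) _ → refl }) n∈) 0

  module _ (irreducible : IrreducibleOverℚ P) where
    private
      c*P : ∀ {c q g} → (c ∷ []) *ₚ Q ≋ q *ₚ g → (c ℤ.* a ℤ.^ e ∷ []) *ₚ P ≋ dilate a q *ₚ dilate a g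
      c*P {c} {q} {g} eq = ≋-trans (ℤ[X].*-congʳ {P} (≋-sym (const-*ₚ c (a ℤ.^ e ∷ []))))
        (≋-trans (*ₚ-assoc (c ∷ []) (a ℤ.^ e ∷ []) P)
        (≋-trans (*ₚ-congˡ (c ∷ []) (≋-sym dilate-Q))
        (≋-trans (≋-sym (dilate-*ₚ a (c ∷ []) Q)) (≋-trans (dilate-≋ a eq) (dilate-*ₚ a q g)))))

      undilate : ∀ {g} → Vanishes (dilate a g) 1 → Vanishes g 1
      undilate {g} van j 1≤j = case ℤ.i*j≡0⇒i≡0∨j≡0 (a ℤ.^ j) (≡.trans (≡.sym (coeff-dilate a g j)) (van j 1≤j)) of λ where
        (inj₁ a^j≡0) → contradiction a^j≡0 (^≢0 a≢0 j)
        (inj₂ g≡0)   → g≡0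

      dilate≋[] : ∀ {g} → dilate a g ≋ [] → g ≋ []
      dilate≋[] {g} (mk eq) = mk λ j → case ℤ.i*j≡0⇒i≡0∨j≡0 (a ℤ.^ j) (≡.trans (≡.sym (coeff-dilate a g j)) (eq j)) of λ where
        (inj₁ a^j≡0) → contradiction a^j≡0 (^≢0 a≢0 j)
        (inj₂ g≡0)   → g≡0

      constant : ∀ {g} → Vanishes g 1 → g ≋ coeff g 0 ∷ []
      constant van = mk λ { zero → refl ; (suc j) → van (suc j) (s≤s z≤n) }

      Bézout : List ℤ → Set
      Bézout f = f ∈Q ⊎ ∃₂ λ u n → n ≢ + 0 × (u *ₚ f +ₚ -ₚ (n ∷ [])) ∈Q

      -- g lies in the ideal (f, Q); only the cofactor of f is tracked.
      Reachable : List ℤ → List ℤ → Set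
      Reachable f g = ∃[ s ] (s *ₚ f +ₚ -ₚ g) ∈Q

      power-ℤ≢0 : ∀ {b} → b ≢ + 0 → ∀ l → power b l ≢ + 0
      power-ℤ≢0 b≢0 zero    = λ ()
      power-ℤ≢0 b≢0 (suc l) = *≢0 (power-ℤ≢0 b≢0 l) b≢0

      -- The remainders of Q and f modulo g are again reachable; if both vanish, then g divides cQ, and
      -- irreducibility leaves only a constant g or a constant cofactor.
      euclid : ∀ f l g k → k < l → coeff g k ≢ + 0 → Vanishes g (suc k) → Reachable f g → Bézout f
      euclid f (suc l) g k k<l lead van (s , sf-g∈) =
        divided (pseudoDivide g k van (length Q) Q (vanishes-mono {Q} (ℕ.m≤n+m (length Q) k) (vanishes-length Q)))
                (pseudoDivide g k van (length f) f (vanishes-mono {f} (ℕ.m≤n+m (length f) k) (vanishes-length f)))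
        where
        open ℤ[X]-Solver
        c c′ : ℤ
        c  = power (coeff g k) (length Q)
        c′ = power (coeff g k) (length f)
        Remainder : ℤ → List ℤ → Set
        Remainder c h = ∃₂ λ q r → Vanishes r k × (c ∷ []) *ₚ h ≋ q *ₚ g +ₚ r
        below : ∀ {r} k′ → coeff r k′ ≢ + 0 → Vanishes r k → k′ < l
        below k′ lead′ van = ℕ.<-≤-trans (ℕ.≰⇒> λ k≤k′ → lead′ (van k′ k≤k′)) (ℕ.≤-pred k<l)
        finish : ∀ c c′ → c ≢ + 0 → c′ ≢ + 0 → ∀ q q′ → (c ∷ []) *ₚ Q ≋ q *ₚ g → (c′ ∷ []) *ₚ f ≋ q′ *ₚ g → Bézout f
        finish c c′ c≢0 c′≢0 q q′ cQ c′f =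
          case irreducible-split P irreducible (*≢0 c≢0 (^≢0 a≢0 e)) (dilate a q) (dilate a g)
                 (q≢0 ∘ dilate≋[]) (g≢0 ∘ dilate≋[]) (c*P {c} {q} {g} cQ) of λ where
            -- With q constant, g is Q up to a rational factor. As g divides c′ f, a nonzero
            -- multiple of f lies in (Q), and O has no torsion.
            (inj₁ q-const) → inj₁ (Q-torsionFree (*≢0 (head≢0 q (undilate {q} q-const) q≢0) c′≢0)
              (q′ *ₚ (c ∷ []) ,
                ≋-trans (ℤ[X].*-congʳ {f} (≋-sym (const-*ₚ (coeff q 0) (c′ ∷ []))))
                (≋-trans (ℤ[X].*-congʳ {f} (ℤ[X].*-congʳ {c′ ∷ []} (≋-sym (constant {q} (undilate {q} q-const)))))
                (≋-trans (*ₚ-assoc q (c′ ∷ []) f) (≋-trans (*ₚ-congˡ q c′f)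
                (≋-trans (solve 3 (λ q q′ g → q :* (q′ :* g) := q′ :* (q :* g)) ≋-refl q q′ g)
                (≋-trans (*ₚ-congˡ q′ (≋-sym cQ)) (≋-sym (*ₚ-assoc q′ (c ∷ []) Q)))))))))
            (inj₂ g-const) → inj₂ (s , coeff g 0 , head≢0 g (undilate {g} g-const) g≢0 ,
              QI.resp (ℤ[X].+-congˡ {s *ₚ f} (ℤ[X].-‿cong (constant {g} (undilate {g} g-const)))) sf-g∈)
          where
          g≢0 : ¬ g ≋ []
          g≢0 g≋[] = lead (at g≋[] k)
          q≢0 : ¬ q ≋ []
          q≢0 q≋[] = *≢0 c≢0 (λ ()) (≡.trans
            (≡.sym (≡.trans (at (const-*ₚ c Q) (suc e)) (≡.trans (coeff-scale c Q (suc e)) (cong (c ℤ.*_) Q-monic))))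
            (≡.trans (at cQ (suc e)) (at (*ₚ-cong {q} {[]} {g} {g} q≋[] ≋-refl) (suc e))))
          head≢0 : ∀ h → Vanishes h 1 → ¬ h ≋ [] → coeff h 0 ≢ + 0
          head≢0 h van h≢0 h₀≡0 = h≢0 (≋-trans (constant {h} van) (∷≋[] h₀≡0 ≋-refl))
        drop-0 : ∀ {c h} q r → (c ∷ []) *ₚ h ≋ q *ₚ g +ₚ r → r ≋ [] → (c ∷ []) *ₚ h ≋ q *ₚ g
        drop-0 q r eq r≋[] = ≋-trans eq (≋-trans (ℤ[X].+-congˡ {q *ₚ g} r≋[]) (+ₚ-identityʳ (q *ₚ g)))
        divided : Remainder c Q → Remainder c′ f → Bézout f
        divided (q , r , van-r , eq) (q′ , r′ , van-r′ , eq′) = case degree r of λ where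
          (inj₂ (k′ , lead′ , van′)) → euclid f l r k′ (below {r} k′ lead′ van-r) lead′ van′
            (-ₚ (q *ₚ s) , QI.resp
              (≋-trans (ℤ[X].+-congˡ { -ₚ (q *ₚ (s *ₚ f +ₚ -ₚ g))} (ℤ[X].-‿cong eq))
                (solve 5 (λ q s f g r → :- (q :* (s :* f :- g)) :+ :- (q :* g :+ r) := (:- (q :* s)) :* f :- r) ≋-refl q s f g r))
              (QI.-∈ (QI.neg∈ (QI.*∈ q sf-g∈)) ((c ∷ []) , ≋-refl)))
          (inj₁ r≋[]) → case degree r′ of λ where
            (inj₂ (k′ , lead′ , van′)) → euclid f l r′ k′ (below {r′} k′ lead′ van-r′) lead′ van′
              ((c′ ∷ []) +ₚ -ₚ (q′ *ₚ s) , QI.resp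
                (≋-trans (solve 5 (λ q s f g r → (:- (q :* (s :* f :- g))) := ((q :* g :+ r) :- (q :* s) :* f) :- r) ≋-refl q′ s f g r′)
                  (≋-trans (ℤ[X].+-congʳ { -ₚ r′} (ℤ[X].+-congʳ { -ₚ ((q′ *ₚ s) *ₚ f)} (≋-sym eq′)))
                    (solve 5 (λ c q s f r → (c :* f :- (q :* s) :* f) :- r := (c :- q :* s) :* f :- r) ≋-refl (c′ ∷ []) q′ s f r′)))
                (QI.neg∈ (QI.*∈ q′ sf-g∈)))
            (inj₁ r′≋[]) → finish c c′ (power-ℤ≢0 lead (length Q)) (power-ℤ≢0 lead (length f)) q q′
              (drop-0 {c} {Q} q r eq r≋[]) (drop-0 {c′} {f} q′ r′ eq′ r′≋[])

    bézout : ∀ f → f ∈Q ⊎ ∃₂ λ u n → n ≢ + 0 × (u *ₚ f +ₚ -ₚ (n ∷ [])) ∈Q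
    -- Q itself is reachable, with cofactor 0.
    bézout f = euclid f (suc (suc e)) Q (suc e) (ℕ.n<1+n (suc e)) (λ Q≡0 → contradiction (≡.trans (≡.sym Q-monic) Q≡0) λ ())
      Q-vanishes ([] , QI.neg∈ ((+ 1 ∷ []) , ≋-sym (*ₚ-identityˡ Q)))

    O-orderLike : ∀ Ans → Lattices.OrderLike Ans O
    O-orderLike Ans = record
      { char0  = λ n≢0 n≈0 → contradiction (O-char0 (Ideals.≈[]0⇒∈ _ Order.fIdeal n≈0)) n≢0
      ; invert = λ f k → k (case bézout f of λ where
          (inj₁ f∈)                 → inj₁ (Ideals.∈⇒≈[]0 _ Order.fIdeal f∈)
          (inj₂ (u , n , n≢0 , d)) → inj₂ (u , n , n≢0 , Ideals.mk d)) }

    O-finitelyGenerated : FinitelyGenerated O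
    O-finitelyGenerated = Order.extension-finitelyGenerated Q-monic Q-vanishes ℤ-finitelyGenerated

    -- Q′ has degree e and leading coefficient e + 1, so it is nonzero in O. The integer n replaces
    -- the discriminant: modulo primes that do not divide it, roots of Q are simple.
    separable : 1 ≤ e → ∃₂ λ u n → n ≢ + 0 × (u *ₚ derivative Q +ₚ -ₚ (n ∷ [])) ∈Q
    separable 1≤e = case bézout (derivative Q) of λ where
        (inj₂ b)   → b
        (inj₁ Q′∈) → contradiction (≡.trans (≡.sym lead) (at (small∈Q van Q′∈) e)) λ ()
      where
      lead : coeff (derivative Q) e ≡ + suc e
      lead = ≡.trans (coeff-derivative Q e) (≡.trans (cong (+ suc e ℤ.*_) Q-monic) (ℤ.*-identityʳ (+ suc e)))
      van : Vanishes (derivative Q) (suc e)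
      van j d≤j = ≡.trans (coeff-derivative Q j) (≡.trans (cong (+ suc j ℤ.*_) (Q-vanishes (suc j) (s≤s d≤j))) (ℤ.*-zeroʳ (+ suc j)))

-- Roots modulo integers

prime-∤⇒coprime : ∀ {p n} → Prime p → ¬ p ℕ.∣ n → Coprimality.Coprime p n
prime-∤⇒coprime pr p∤n (d∣p , d∣n) = case ℕ.prime⇒irreducible pr d∣p of λ where
  (inj₁ d≡1)  → d≡1
  (inj₂ refl) → contradiction d∣n p∤n

∣⇒∣ℤ : ∀ {m n} → m ℕ.∣ n → + m ℤ.∣ + n
∣⇒∣ℤ m∣n = ℤ.∣ᵤ⇒∣ m∣n

∣ℤ⇒∣ : ∀ {m x} → + m ℤ.∣ x → m ℕ.∣ ∣ x ∣
∣ℤ⇒∣ m∣x = ℤ.∣⇒∣ᵤ m∣x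

∣ℤ-product : ∀ {p} x y → Prime p → + p ℤ.∣ x ℤ.* y → + p ℤ.∣ x ⊎ + p ℤ.∣ y
∣ℤ-product {p} x y pr p∣xy = case ℕ.euclidsLemma ∣ x ∣ ∣ y ∣ pr (subst (p ℕ.∣_) (ℤ.∣i*j∣≡∣i∣*∣j∣ x y) (∣ℤ⇒∣ p∣xy)) of λ where
  (inj₁ p∣x) → inj₁ (ℤ.∣ᵤ⇒∣ p∣x)
  (inj₂ p∣y) → inj₂ (ℤ.∣ᵤ⇒∣ p∣y)

modular-inverse : ∀ {p} → Prime p → ∀ x → ¬ + p ℤ.∣ x → ∃[ y ] + p ℤ.∣ x ℤ.* y ℤ.- + 1
modular-inverse {p} pr x p∤x = signed x (inverse ∣ x ∣ (λ p∣x → p∤x (ℤ.∣ᵤ⇒∣ p∣x)))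
  where
  inverse : ∀ n → ¬ p ℕ.∣ n → ∃[ y ] + p ℤ.∣ + n ℤ.* y ℤ.- + 1
  inverse n p∤n with Coprimality.coprime-Bézout (prime-∤⇒coprime pr p∤n)
  ... | ℕ.Bézout.+- u v eq = ℤ.- + v , ℤ.divides (ℤ.- + u) (begin
    + n ℤ.* ℤ.- + v ℤ.- + 1      ≡⟨ rearrange (+ n) (+ v) ⟩
    ℤ.- (+ 1 ℤ.+ + v ℤ.* + n)    ≡⟨ cong (λ z → ℤ.- (+ 1 ℤ.+ z)) (ℤ.pos-* v n) ⟨
    ℤ.- + (1 ℕ.+ v ℕ.* n)        ≡⟨ cong (λ z → ℤ.- + z) eq ⟩
    ℤ.- + (u ℕ.* p)              ≡⟨ cong ℤ.-_ (ℤ.pos-* u p) ⟩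
    ℤ.- (+ u ℤ.* + p)            ≡⟨ ℤ.neg-distribˡ-* (+ u) (+ p) ⟩
    ℤ.- + u ℤ.* + p              ∎)
    where
    open ≡-Reasoning
    rearrange : ∀ n v → n ℤ.* ℤ.- v ℤ.- + 1 ≡ ℤ.- (+ 1 ℤ.+ v ℤ.* n)
    rearrange = ℤSolver.solve-∀
  ... | ℕ.Bézout.-+ u v eq = + v , ℤ.divides (+ u) (begin
    + n ℤ.* + v ℤ.- + 1          ≡⟨ cong (ℤ._- + 1) (≡.trans (ℤ.*-comm (+ n) (+ v)) (≡.sym (ℤ.pos-* v n))) ⟩
    + (v ℕ.* n) ℤ.- + 1          ≡⟨ cong (λ z → + z ℤ.- + 1) eq ⟨
    + (1 ℕ.+ u ℕ.* p) ℤ.- + 1    ≡⟨ cancel (+ (u ℕ.* p)) ⟩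
    + (u ℕ.* p)                  ≡⟨ ℤ.pos-* u p ⟩
    + u ℤ.* + p                  ∎)
    where
    open ≡-Reasoning
    cancel : ∀ x → (+ 1 ℤ.+ x) ℤ.- + 1 ≡ x
    cancel = ℤSolver.solve-∀
  signed : ∀ x → (∃[ y ] + p ℤ.∣ + ∣ x ∣ ℤ.* y ℤ.- + 1) → ∃[ y ] + p ℤ.∣ x ℤ.* y ℤ.- + 1
  signed (+ n)    inv     = inv
  signed -[1+ n ] (y , d) = ℤ.- y , subst (+ p ℤ.∣_) (cong (ℤ._- + 1) (flip (+ suc n) y)) d
    where
    flip : ∀ n y → n ℤ.* y ≡ (ℤ.- n) ℤ.* (ℤ.- y)
    flip = ℤSolver.solve-∀

eval-difference : ∀ f r s → r ℤ.- s ℤ.∣ eval f r ℤ.- eval f s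
eval-difference f r s = ℤ.divides (eval (synthetic f s) r) (≡.trans (cong (ℤ._- eval f s) (evalₚ-factor f s r))
  (identity (r ℤ.- s) (eval (synthetic f s) r) (eval f s)))
  where
  identity : ∀ a b c → (a ℤ.* b ℤ.+ c) ℤ.- c ≡ b ℤ.* a
  identity = ℤSolver.solve-∀

eval-mod : ∀ {m} f r s → m ℤ.∣ r ℤ.- s → m ℤ.∣ eval f s → m ℤ.∣ eval f r
eval-mod {m} f r s m∣r-s m∣fs = subst (m ℤ.∣_) (identity (eval f r) (eval f s))
  (ℤ.∣m∣n⇒∣m+n (ℤ.∣-trans m∣r-s (eval-difference f r s)) m∣fs)
  where
  identity : ∀ x y → (x ℤ.- y) ℤ.+ y ≡ x
  identity = ℤSolver.solve-∀

∣-flip : ∀ {m} r s → m ℤ.∣ r ℤ.- s → m ℤ.∣ s ℤ.- r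
∣-flip {m} r s d = subst (m ℤ.∣_) (identity r s) (ℤ.∣m⇒∣-m d)
  where
  identity : ∀ r s → ℤ.- (r ℤ.- s) ≡ s ℤ.- r
  identity = ℤSolver.solve-∀

coprime-product : ∀ {q m x} → Prime q → ¬ q ℕ.∣ m → + q ℤ.∣ x → + m ℤ.∣ x → + (q ℕ.* m) ℤ.∣ x
coprime-product {q} {m} {x} pr q∤m q∣x (ℤ.divides k x≡km) =
  case ∣ℤ-product k (+ m) pr (subst (+ q ℤ.∣_) x≡km q∣x) of λ where
    (inj₂ q∣m) → contradiction (∣ℤ⇒∣ q∣m) q∤m
    (inj₁ (ℤ.divides l k≡lq)) → ℤ.divides l (begin
      x                      ≡⟨ x≡km ⟩
      k ℤ.* + m              ≡⟨ cong (ℤ._* + m) k≡lq ⟩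
      l ℤ.* + q ℤ.* + m      ≡⟨ ℤ.*-assoc l (+ q) (+ m) ⟩
      l ℤ.* (+ q ℤ.* + m)    ≡⟨ cong (l ℤ.*_) (ℤ.pos-* q m) ⟨
      l ℤ.* + (q ℕ.* m)      ∎)
  where open ≡-Reasoning

-- Hensel lifting (if q already divides the modulus) and the Chinese remainder theorem (if not).
module _ (f : ℤ[x]) (s : ℕ → ℤ) where
  SimpleRoot : ℕ → Set
  SimpleRoot q = Prime q × + q ℤ.∣ eval f (s q) × ¬ + q ℤ.∣ eval (derivative f) (s q)

  lift-roots : ∀ ms → All SimpleRoot ms →
               ∃[ r ] + ℕ.product ms ℤ.∣ eval f r × All (λ q → + q ℤ.∣ r ℤ.- s q) ms
  lift-roots []       []                 = + 0 , ℤ.divides (eval f (+ 0)) (≡.sym (ℤ.*-identityʳ (eval f (+ 0)))) , []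
  lift-roots (q ∷ ms) ((pr , root , simple) ∷ simples) = extend (lift-roots ms simples)
    where
    module Step (r k : ℤ) (fr≡km : eval f r ≡ k ℤ.* + ℕ.product ms) (congruent : All (λ q → + q ℤ.∣ r ℤ.- s q) ms) where
      m : ℕ
      m = ℕ.product ms
      Goal : Set
      Goal = ∃[ r ] + (q ℕ.* m) ℤ.∣ eval f r × All (λ q → + q ℤ.∣ r ℤ.- s q) (q ∷ ms)
      ms∣m : All (λ p → + p ℤ.∣ + m) ms
      ms∣m = All.tabulate (λ p∈ms → ∣⇒∣ℤ (ℕ.∈⇒∣product p∈ms))
      shift : ∀ t → ∀ {p} → + p ℤ.∣ r ℤ.- s p → + p ℤ.∣ + m → + p ℤ.∣ (r ℤ.+ + m ℤ.* t) ℤ.- s p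
      shift t {p} p∣r-s p∣m = subst (+ p ℤ.∣_) (identity r (s p) (+ m) t)
        (ℤ.∣m∣n⇒∣m+n p∣r-s (ℤ.∣m⇒∣m*n t p∣m))
        where
        identity : ∀ r s m t → (r ℤ.- s) ℤ.+ m ℤ.* t ≡ (r ℤ.+ m ℤ.* t) ℤ.- s
        identity = ℤSolver.solve-∀
      shift-all : ∀ t → All (λ p → + p ℤ.∣ (r ℤ.+ + m ℤ.* t) ℤ.- s p) ms
      shift-all t = All.zipWith (λ { (c , d) → shift t c d }) (congruent , ms∣m)

      hensel : Any.Any (q ≡_) ms → Goal
      hensel q∈ms = r₁ , ℤ.∣-trans q*m∣ (ℤ.∣-reflexive (≡.sym fr₁)) , All.lookup (shift-all t) q∈ms ∷ shift-all t
        where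
        inv = modular-inverse pr (eval (derivative f) (s q)) simple
        -- D is the difference quotient of f between r and r₁. As q divides m, it is congruent to
        -- f′(s q) modulo q, and y inverts that value, so t D + k ≡ 0 and f(r₁) = (t D + k) m gains
        -- the factor q.
        y t r₁ D : ℤ
        y  = proj₁ inv
        t  = ℤ.- (k ℤ.* y)
        r₁ = r ℤ.+ + m ℤ.* t
        D  = eval (synthetic f r) r₁
        q∣m : + q ℤ.∣ + m
        q∣m = All.lookup ms∣m q∈ms
        fr₁ : eval f r₁ ≡ (t ℤ.* D ℤ.+ k) ℤ.* + m
        fr₁ = ≡.trans (evalₚ-factor f r r₁) (≡.trans (cong (λ z → (r₁ ℤ.- r) ℤ.* D ℤ.+ z) fr≡km) (identity r (+ m) t D k))
          where
          identity : ∀ r m t D k → ((r ℤ.+ m ℤ.* t) ℤ.- r) ℤ.* D ℤ.+ k ℤ.* m ≡ (t ℤ.* D ℤ.+ k) ℤ.* m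
          identity = ℤSolver.solve-∀
        r₁-r : + q ℤ.∣ r₁ ℤ.- r
        r₁-r = subst (+ q ℤ.∣_) (identity r (+ m) t) (ℤ.∣m⇒∣m*n t q∣m)
          where
          identity : ∀ r m t → m ℤ.* t ≡ (r ℤ.+ m ℤ.* t) ℤ.- r
          identity = ℤSolver.solve-∀
        D-derivative : + q ℤ.∣ D ℤ.- eval (derivative f) (s q)
        D-derivative = subst (+ q ℤ.∣_) (≡.trans (cong (λ z → (D ℤ.- z) ℤ.+ (eval (derivative f) r ℤ.- eval (derivative f) (s q))) (≡.sym (evalₚ-derivative f r)))
            (identity D (eval (derivative f) r) (eval (derivative f) (s q))))
          (ℤ.∣m∣n⇒∣m+n (ℤ.∣-trans r₁-r (eval-difference (synthetic f r) r₁ r))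
            (ℤ.∣-trans (All.lookup congruent q∈ms) (eval-difference (derivative f) r (s q))))
          where
          identity : ∀ a b c → (a ℤ.- b) ℤ.+ (b ℤ.- c) ≡ a ℤ.- c
          identity = ℤSolver.solve-∀
        q∣tD+k : + q ℤ.∣ t ℤ.* D ℤ.+ k
        q∣tD+k = subst (+ q ℤ.∣_) (identity k y (eval (derivative f) (s q)) D)
          (ℤ.∣m∣n⇒∣m+n (ℤ.∣n⇒∣m*n (ℤ.- k) (proj₂ inv)) (ℤ.∣n⇒∣m*n (ℤ.- (k ℤ.* y)) D-derivative))
          where
          identity : ∀ k y d D → (ℤ.- k) ℤ.* (d ℤ.* y ℤ.- + 1) ℤ.+ (ℤ.- (k ℤ.* y)) ℤ.* (D ℤ.- d) ≡ (ℤ.- (k ℤ.* y)) ℤ.* D ℤ.+ k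
          identity = ℤSolver.solve-∀
        q*m∣ : + (q ℕ.* m) ℤ.∣ (t ℤ.* D ℤ.+ k) ℤ.* + m
        q*m∣ = case q∣tD+k of λ { (ℤ.divides l eq) → ℤ.divides l (≡.trans (cong (ℤ._* + m) eq)
          (≡.trans (ℤ.*-assoc l (+ q) (+ m)) (cong (l ℤ.*_) (≡.sym (ℤ.pos-* q m))))) }

      crt : ¬ Any.Any (q ≡_) ms → Goal
      crt q∉ms = r₁ , coprime-product pr q∤m (eval-mod f r₁ (s q) q∣r₁-s root) (eval-mod f r₁ r m∣r₁-r (ℤ.divides k fr≡km)) , q∣r₁-s ∷ shift-all t
        where
        q∤m : ¬ q ℕ.∣ m
        q∤m q∣m = q∉ms (Factorisation.factorisationHasAllPrimeFactors pr q∣m (All.map proj₁ simples))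
        inv = modular-inverse pr (+ m) (λ q∣m → q∤m (∣ℤ⇒∣ q∣m))
        y t r₁ : ℤ
        y  = proj₁ inv
        t  = y ℤ.* (s q ℤ.- r)
        r₁ = r ℤ.+ + m ℤ.* t
        q∣r₁-s : + q ℤ.∣ r₁ ℤ.- s q
        q∣r₁-s = subst (+ q ℤ.∣_) (identity r (+ m) y (s q)) (ℤ.∣n⇒∣m*n (s q ℤ.- r) (proj₂ inv))
          where
          identity : ∀ r m y s → (s ℤ.- r) ℤ.* (m ℤ.* y ℤ.- + 1) ≡ (r ℤ.+ m ℤ.* (y ℤ.* (s ℤ.- r))) ℤ.- s
          identity = ℤSolver.solve-∀
        m∣r₁-r : + m ℤ.∣ r₁ ℤ.- r
        m∣r₁-r = ℤ.divides t (identity r (+ m) t)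
          where
          identity : ∀ r m t → (r ℤ.+ m ℤ.* t) ℤ.- r ≡ t ℤ.* m
          identity = ℤSolver.solve-∀
    extend : (∃[ r ] + ℕ.product ms ℤ.∣ eval f r × All (λ q → + q ℤ.∣ r ℤ.- s q) ms) →
             ∃[ r ] + (q ℕ.* ℕ.product ms) ℤ.∣ eval f r × All (λ q → + q ℤ.∣ r ℤ.- s q) (q ∷ ms)
    extend (r , ℤ.divides k eq , congruent) = case Any.any? (q ℕ.≟_) ms of λ where
        (yes q∈ms) → Step.hensel r k eq congruent q∈ms
        (no  q∉ms) → Step.crt r k eq congruent q∉ms

∣-∣-bound : ∀ {n u v} → u < n → v < n → ∣ + u ℤ.- + v ∣ < n
∣-∣-bound {n} {u} {v} u<n v<n = subst (_< n) (cong ∣_∣ (≡.sym (ℤ.[+m]-[+n]≡m⊖n u v))) (case ℕ.≤-total u v of λ where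
  (inj₁ u≤v) → ℕ.≤-<-trans (ℕ.≤-trans (ℕ.≤-reflexive (ℤ.∣⊖∣-≤ u≤v)) (ℕ.m∸n≤m v u)) v<n
  (inj₂ v≤u) → ℕ.≤-<-trans (ℕ.≤-trans (ℕ.≤-reflexive (≡.trans (ℤ.∣m⊖n∣≡∣n⊖m∣ u v) (ℤ.∣⊖∣-≤ v≤u))) (ℕ.m∸n≤m u v)) u<n)

residue-unique : ∀ {n u v} → u < n → v < n → + n ℤ.∣ + u ℤ.- + v → u ≡ v
residue-unique {n} {u} {v} u<n v<n n∣u-v =
  ℤ.+-injective (ℤ.i-j≡0⇒i≡j (+ u) (+ v) (ℤ.∣i∣≡0⇒i≡0 (small (∣ℤ⇒∣ n∣u-v) (∣-∣-bound u<n v<n))))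
  where
  small : ∀ {x} → n ℕ.∣ x → x < n → x ≡ 0
  small {zero}  _   _   = refl
  small {suc x} n∣x x<n = contradiction (ℕ.∣⇒≤ n∣x) (ℕ.<⇒≱ x<n)

-- The average number of roots modulo primes is at most one

sumℕ : ∀ {n} → (Fin n → ℕ) → ℕ
sumℕ = Sum.sum ℕ.+-*-semiring

-- Turns a family indexed by pairs into one indexed by a single `Fin`, as pigeonhole requires.
module DisjointUnion where
  encode : ∀ {l} (N : Fin l → ℕ) → Σ (Fin l) (Fin ∘ N) → Fin (sumℕ N)
  encode N (zero  , j) = j Fin.↑ˡ sumℕ (N ∘ suc)
  encode N (suc i , j) = N zero Fin.↑ʳ encode (N ∘ suc) (i , j)

  decode : ∀ {l} (N : Fin l → ℕ) → Fin (sumℕ N) → Σ (Fin l) (Fin ∘ N)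
  decode {suc l} N k = [ (λ j → zero , j) , (λ k′ → suc (proj₁ (decode (N ∘ suc) k′)) , proj₂ (decode (N ∘ suc) k′)) ]′
    (Fin.splitAt (N zero) k)

  encode-decode : ∀ {l} (N : Fin l → ℕ) k → encode N (decode N k) ≡ k
  encode-decode {suc l} N k with Fin.splitAt (N zero) k in eq
  ... | inj₁ j  = Fin.splitAt⁻¹-↑ˡ eq
  ... | inj₂ k′ = ≡.trans (cong (N zero Fin.↑ʳ_) (encode-decode (N ∘ suc) k′)) (Fin.splitAt⁻¹-↑ʳ eq)

  decode-injective : ∀ {l} (N : Fin l → ℕ) {j k} → decode N j ≡ decode N k → j ≡ k
  decode-injective N {j} {k} eq =
    ≡.trans (≡.sym (encode-decode N j)) (≡.trans (cong (encode N) eq) (encode-decode N k))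

cofactor : (ps : List ℕ) → Fin (length ps) → ℕ
cofactor (p ∷ ps) zero    = ℕ.product ps
cofactor (p ∷ ps) (suc i) = p ℕ.* cofactor ps i

lookup*cofactor : ∀ ps i → List.lookup ps i ℕ.* cofactor ps i ≡ ℕ.product ps
lookup*cofactor (p ∷ ps) zero    = refl
lookup*cofactor (p ∷ ps) (suc i) = ≡.trans (swap (List.lookup ps i) p (cofactor ps i))
  (cong (p ℕ.*_) (lookup*cofactor ps i))
  where
  swap : ∀ x p c → x ℕ.* (p ℕ.* c) ≡ p ℕ.* (x ℕ.* c)
  swap = ℕSolver.solve-∀

-- The sum of the reciprocals of ps is numerator ps / product ps.
numerator : List ℕ → ℕ
numerator ps = sumℕ (cofactor ps)

lookup-≢ : ∀ {X : Set} {xs : List X} → AllPairs _≢_ xs → ∀ {i j} → i ≢ j → List.lookup xs i ≢ List.lookup xs j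
lookup-≢ (x≢ ∷ _) {zero}  {zero}  i≢j = contradiction refl i≢j
lookup-≢ (x≢ ∷ _) {zero}  {suc j} i≢j = All.lookup x≢ (∈.∈-lookup j)
lookup-≢ (x≢ ∷ _) {suc i} {zero}  i≢j = All.lookup x≢ (∈.∈-lookup i) ∘ ≡.sym
lookup-≢ (_ ∷ xs) {suc i} {suc j} i≢j = lookup-≢ xs (i≢j ∘ cong suc)

n∣n! : ∀ n .⦃ _ : NonZero n ⦄ → n ℕ.∣ n !
n∣n! (suc n) = ℕ.m∣m*n (n !)

prime∣! : ∀ {q n} → Prime q → q ≤ n → q ℕ.∣ n !
prime∣! {q} pr q≤n = ℕ.∣-trans (n∣n! q ⦃ ℕ.prime⇒nonZero pr ⦄) (ℕ.m≤n⇒m!∣n! q≤n)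

prime-divisor : ∀ n → n ≢ 0 → n ≢ 1 → ∃[ q ] Prime q × q ℕ.∣ n
prime-divisor n n≢0 n≢1 = conclude (Factorisation.factorise n ⦃ ℕ.≢-nonZero n≢0 ⦄)
  where
  conclude : Factorisation.PrimeFactorisation n → ∃[ q ] Prime q × q ℕ.∣ n
  conclude record { factors = []     ; isFactorisation = eq } = contradiction eq n≢1
  conclude record { factors = q ∷ qs ; isFactorisation = eq ; factorsPrime = pr ∷ _ } =
    q , pr , subst (q ℕ.∣_) (≡.sym eq) (ℕ.m∣m*n (ℕ.product qs))

Rough : ℕ → ℕ → Set
Rough z m = ∀ q → Prime q → q ℕ.∣ m → z < q

-- If d = k m with 0 < k < z, then k is coprime to m′, whose prime factors exceed z; so m′ ∣ k m
-- would force m′ ∣ m.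
rough-common-multiple : ∀ {z m m′ d} → Rough z m′ → m ℕ.∣ d → m′ ℕ.∣ d → ¬ m′ ℕ.∣ m → d < z ℕ.* m → d ≡ 0
rough-common-multiple rough (ℕ.divides zero    eq) m′∣d m′∤m d<zm = eq
rough-common-multiple {z} {m} {m′} rough (ℕ.divides k@(suc _) refl) m′∣d m′∤m d<zm =
  contradiction (Coprimality.coprime-divisor coprime m′∣d) m′∤m
  where
  k<z : k < z
  k<z = ℕ.*-cancelʳ-< m k z d<zm
  coprime : Coprimality.Coprime m′ k
  coprime {g} (g∣m′ , g∣k) with g ℕ.≟ 1
  ... | yes g≡1 = g≡1
  ... | no  g≢1 with prime-divisor g (λ { refl → contradiction (ℕ.0∣⇒≡0 g∣k) λ () }) g≢1
  ...   | q , pr , q∣g = contradiction (ℕ.<-trans (rough q pr (ℕ.∣-trans q∣g g∣m′)) (ℕ.≤-<-trans (ℕ.∣⇒≤ (ℕ.∣-trans q∣g g∣k)) k<z)) (ℕ.<-irrefl refl)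

NoOddPrimeRoot : ℤ[x] → Set
NoOddPrimeRoot P = ∃[ q ] Prime q × 2 < q × ∀ r → ¬ + q ℤ.∣ eval P r

TwoRoots : ℤ[x] → ℕ → Set
TwoRoots Q q = Prime q × ∃₂ λ r s → + q ℤ.∣ eval Q r × + q ℤ.∣ eval Q s × ¬ + q ℤ.∣ r ℤ.- s

module UpperBound (P : ℤ[x]) (δ : ℕ) (P-degree : HasDegree P (suc δ)) (1≤δ : 1 ≤ δ) (irreducible : IrreducibleOverℚ P) where
  open MonicModel P δ P-degree

  Ans : Set
  Ans = NoOddPrimeRoot P

  open Classical Ans
  open Lattices Ans O
  open Combinations O using (comb; comb--)
  open Ideals O
  private
    module O = ℤ-Algebra O

  all-Cl : ∀ {ℓ} {B : ℕ → Set ℓ} {xs} → All (Cl ∘ B) xs → Cl (All B xs)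
  all-Cl []       k = k []
  all-Cl (f ∷ fs) k = f λ b → all-Cl fs λ bs → k (b ∷ bs)

  isRoot? : ∀ q (r : Fin q) → Dec (+ q ℤ.∣ eval Q (+ toℕ r))
  isRoot? q r = + q ℤ.∣? eval Q (+ toℕ r)

  firstRoot : ℕ → ℤ
  firstRoot q with Fin.any? (isRoot? q)
  ... | yes (r , _) = + toℕ r
  ... | no  _       = + 0

  -- The one place that produces the answer: a root r of P gives the root a r of Q, so if the search
  -- finds no root of Q, then P has none modulo q either.
  firstRoot-spec : ∀ q → Prime q → 2 < q → Cl (+ q ℤ.∣ eval Q (firstRoot q))
  firstRoot-spec q pr 2<q k with Fin.any? (isRoot? q)
  ... | yes (r , root) = k root
  ... | no  none       = q , pr , 2<q , λ r q∣Pr →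
    none (fromℕ< (ℤ.n%d<d (a ℤ.* r) (+ q)) , subst (λ x → + q ℤ.∣ eval Q (+ x)) (≡.sym (Fin.toℕ-fromℕ< _))
      (eval-mod Q (+ (a ℤ.* r ℤ.% + q)) (a ℤ.* r) (∣-flip (a ℤ.* r) (+ (a ℤ.* r ℤ.% + q)) (remainder (a ℤ.* r)))
        (subst (+ q ℤ.∣_) (≡.sym (eval-Q r)) (ℤ.∣n⇒∣m*n (a ℤ.^ δ) q∣Pr))))
    where
    instance
      q-nonZero : NonZero q
      q-nonZero = ℕ.prime⇒nonZero pr
    remainder : ∀ x → + q ℤ.∣ x ℤ.- + (x ℤ.% + q)
    remainder x = ℤ.divides (x ℤ./ + q) (≡.trans (cong (ℤ._- + (x ℤ.% + q)) (ℤ.a≡a%n+[a/n]*n x (+ q)))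
      (identity (+ (x ℤ.% + q)) ((x ℤ./ + q) ℤ.* + q)))
      where
      identity : ∀ r y → (r ℤ.+ y) ℤ.- r ≡ y
      identity = ℤSolver.solve-∀

  private
    separator : ∃₂ λ u n → n ≢ + 0 × Ideals.Ideal._∈I Order.fIdeal (u *ₚ derivative Q +ₚ -ₚ (n ∷ []))
    separator = separable irreducible 1≤δ

  discriminant : ℕ
  discriminant = ∣ proj₁ (proj₂ separator) ∣

  abstract
    -- Evaluating u Q′ - n = h Q at a common zero of Q and Q′ modulo q gives q ∣ n, although 0 < ∣n∣
    -- < q.
    simple : ∀ {q r} → discriminant < q → + q ℤ.∣ eval Q r → ¬ + q ℤ.∣ eval (derivative Q) r
    simple {q} {r} n<q q∣Qr q∣Q′r = simple′ separator refl
      where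
      simple′ : (b : ∃₂ λ u n → n ≢ + 0 × Ideals.Ideal._∈I Order.fIdeal (u *ₚ derivative Q +ₚ -ₚ (n ∷ []))) →
                discriminant ≡ ∣ proj₁ (proj₂ b) ∣ → ⊥
      simple′ (u , n , n≢0 , h , eq) same = contradiction (ℕ.∣⇒≤ ⦃ ℕ.≢-nonZero (n≢0 ∘ ℤ.∣i∣≡0⇒i≡0) ⦄ (∣ℤ⇒∣ q∣n))
        (ℕ.<⇒≱ (subst (_< q) same n<q))
        where
        value : eval u r ℤ.* eval (derivative Q) r ℤ.+ ℤ.- n ≡ eval h r ℤ.* eval Q r
        value = ≡.trans (≡.sym (≡.trans (evalₚ-+ (u *ₚ derivative Q) (-ₚ (n ∷ [])) r)
            (cong₂ ℤ._+_ (evalₚ-* u (derivative Q) r) (≡.trans (cong (λ z → ℤ.- n ℤ.+ z) (ℤ.*-zeroʳ r)) (ℤ.+-identityʳ (ℤ.- n))))))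
          (≡.trans (evalₚ-cong r eq) (evalₚ-* h Q r))
        q∣n : + q ℤ.∣ n
        q∣n = subst (+ q ℤ.∣_) (ℤ.neg-involutive n) (ℤ.∣m⇒∣-m (ℤ.∣m+n∣m⇒∣n
          (subst (+ q ℤ.∣_) (≡.sym value) (ℤ.∣n⇒∣m*n (eval h r) q∣Qr)) (ℤ.∣n⇒∣m*n (eval u r) q∣Q′r)))

  secondRoot : ∀ {q} → TwoRoots Q q → ∃[ r ] + q ℤ.∣ eval Q r × ¬ + q ℤ.∣ r ℤ.- firstRoot q
  secondRoot {q} (_ , r , s , q∣Qr , q∣Qs , r≢s) with + q ℤ.∣? r ℤ.- firstRoot q
  ... | no  r≢first = r , q∣Qr , r≢first
  ... | yes r≡first = s , q∣Qs , λ s≡first → r≢s (subst (+ q ℤ.∣_) (identity r s (firstRoot q)) (ℤ.∣m∣n⇒∣m-n r≡first s≡first))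
    where
    identity : ∀ r s t → (r ℤ.- t) ℤ.- (s ℤ.- t) ≡ r ℤ.- s
    identity = ℤSolver.solve-∀

  -- The ideal (m, α - r), as the kernel of evaluation at r modulo m.
  evalIdeal : ∀ m r → m ℤ.∣ eval Q r → Ideal
  evalIdeal m r m∣Qr = record
    { _∈I  = λ f → m ℤ.∣ eval f r
    ; resp = λ { {f} {g} (mk (h , eq)) m∣f → subst (m ℤ.∣_) (same f g h eq)
        (ℤ.∣m∣n⇒∣m-n m∣f (ℤ.∣n⇒∣m*n (eval h r) m∣Qr)) }
    ; 0∈   = ℤ.divides (+ 0) refl
    ; +∈   = λ {f} {g} d d′ → subst (m ℤ.∣_) (≡.sym (evalₚ-+ f g r)) (ℤ.∣m∣n⇒∣m+n d d′)
    ; *∈   = λ g {f} d → subst (m ℤ.∣_) (≡.sym (evalₚ-* g f r)) (ℤ.∣n⇒∣m*n (eval g r) d) }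
    where
    same : ∀ f g h → f +ₚ -ₚ g ≋ h *ₚ Q → eval f r ℤ.- eval h r ℤ.* eval Q r ≡ eval g r
    same f g h eq = ≡.trans (cong (λ z → eval f r ℤ.- z) (≡.trans (≡.sym (evalₚ-* h Q r)) (≡.trans (≡.sym (evalₚ-cong r eq))
      (≡.trans (evalₚ-+ f (-ₚ g) r) (cong (λ z → eval f r ℤ.+ z) (evalₚ-neg g r)))))) (identity (eval f r) (eval g r))
      where
      identity : ∀ x y → x ℤ.- (x ℤ.+ ℤ.- y) ≡ y
      identity = ℤSolver.solve-∀

  _∩_ : Ideal → Ideal → Ideal
  I ∩ J = record
    { _∈I  = λ f → I._∈I f × J._∈I f
    ; resp = λ e (i , j) → I.resp e i , J.resp e j
    ; 0∈   = I.0∈ , J.0∈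
    ; +∈   = λ (i , j) (i′ , j′) → I.+∈ i i′ , J.+∈ j j′
    ; *∈   = λ r (i , j) → I.*∈ r i , J.*∈ r j }
    where
    module I = Ideal I
    module J = Ideal J

  record RootModulus (z : ℕ) : Set where
    field
      m     : ℕ
      0<m   : 0 < m
      rough : Rough z m
      r     : ℤ
      root  : + m ℤ.∣ eval Q r

    ideal : Ideal
    ideal = evalIdeal (+ m) r root

  module _ {z} (μ ν : RootModulus z) where
    private
      module μ = RootModulus μ
      module ν = RootModulus ν

    -- If ν.m ∤ μ.m, their least common multiple exceeds z μ.m and the integers below it are incongruent.
    incongruent-∤ : ¬ ν.m ℕ.∣ μ.m → Incongruent {z ℕ.* μ.m} (μ.ideal ∩ ν.ideal) (λ i → + toℕ i ∷ [])
    incongruent-∤ ν∤μ i j i≢j (d , d′) = contradiction (Fin.toℕ-injective (ℤ.+-injective (ℤ.i-j≡0⇒i≡j (+ toℕ i) (+ toℕ j)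
      (ℤ.∣i∣≡0⇒i≡0 (rough-common-multiple ν.rough (∣ℤ⇒∣ (at-const μ.r d)) (∣ℤ⇒∣ (at-const ν.r d′)) ν∤μ
        (∣-∣-bound (Fin.toℕ<n i) (Fin.toℕ<n j))))))) i≢j
      where
      at-const : ∀ {m} r → m ℤ.∣ (+ toℕ i ℤ.+ ℤ.- + toℕ j) ℤ.+ r ℤ.* + 0 → m ℤ.∣ + toℕ i ℤ.- + toℕ j
      at-const {m} r = subst (m ℤ.∣_) (identity (+ toℕ i) (+ toℕ j) r)
        where
        identity : ∀ u v r → (u ℤ.+ ℤ.- v) ℤ.+ r ℤ.* + 0 ≡ u ℤ.- v
        identity = ℤSolver.solve-∀

    -- u + v (x - r) with u < m and v < z
    element : Fin (z ℕ.* μ.m) → List ℤ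
    element i = let (v , u) = Fin.remQuot {z} μ.m i in (+ toℕ u ℤ.- + toℕ v ℤ.* μ.r) ∷ + toℕ v ∷ []

    -- A congruence modulo the first ideal determines u. Modulo the second it then says that q
    -- divides (v - v′)(r′ - r), and v, v′ < z < q.
    incongruent-root : ∀ {q} → Prime q → z < q → q ℕ.∣ μ.m → ν.m ≡ μ.m → ¬ + q ℤ.∣ ν.r ℤ.- μ.r →
                       Incongruent (μ.ideal ∩ ν.ideal) element
    incongruent-root {q} pr z<q q∣m refl differ i j i≢j (d , d′) = contradiction i≡j i≢j
      where
      v u v′ u′ : ℕ
      v  = toℕ (proj₁ (Fin.remQuot {z} μ.m i))
      u  = toℕ (proj₂ (Fin.remQuot {z} μ.m i))
      v′ = toℕ (proj₁ (Fin.remQuot {z} μ.m j))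
      u′ = toℕ (proj₂ (Fin.remQuot {z} μ.m j))
      u≡u′ : u ≡ u′
      u≡u′ = residue-unique (Fin.toℕ<n (proj₂ (Fin.remQuot {z} μ.m i))) (Fin.toℕ<n (proj₂ (Fin.remQuot {z} μ.m j)))
        (subst (+ μ.m ℤ.∣_) (identity (+ u) (+ v) (+ u′) (+ v′) μ.r) d)
        where
        identity : ∀ u v u′ v′ r → ((u ℤ.- v ℤ.* r) ℤ.+ ℤ.- (u′ ℤ.- v′ ℤ.* r)) ℤ.+ r ℤ.* ((v ℤ.+ ℤ.- v′) ℤ.+ r ℤ.* + 0) ≡ u ℤ.- u′
        identity = ℤSolver.solve-∀
      q∣product : + q ℤ.∣ (+ v ℤ.- + v′) ℤ.* (ν.r ℤ.- μ.r)
      q∣product = ℤ.∣-trans (∣⇒∣ℤ q∣m) (subst (+ μ.m ℤ.∣_)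
        (≡.trans (cong (λ w → ((+ u ℤ.- + v ℤ.* μ.r) ℤ.+ ℤ.- (+ w ℤ.- + v′ ℤ.* μ.r)) ℤ.+ ν.r ℤ.* ((+ v ℤ.+ ℤ.- + v′) ℤ.+ ν.r ℤ.* + 0)) (≡.sym u≡u′))
          (identity (+ u) (+ v) (+ v′) μ.r ν.r)) d′)
        where
        identity : ∀ u v v′ r s → ((u ℤ.- v ℤ.* r) ℤ.+ ℤ.- (u ℤ.- v′ ℤ.* r)) ℤ.+ s ℤ.* ((v ℤ.+ ℤ.- v′) ℤ.+ s ℤ.* + 0) ≡ (v ℤ.- v′) ℤ.* (s ℤ.- r)
        identity = ℤSolver.solve-∀
      v≡v′ : v ≡ v′
      v≡v′ = case ∣ℤ-product (+ v ℤ.- + v′) (ν.r ℤ.- μ.r) pr q∣product of λ where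
        (inj₁ q∣v-v′) → residue-unique (ℕ.<-trans (Fin.toℕ<n (proj₁ (Fin.remQuot {z} μ.m i))) z<q) (ℕ.<-trans (Fin.toℕ<n (proj₁ (Fin.remQuot {z} μ.m j))) z<q) q∣v-v′
        (inj₂ q∣s-r)  → contradiction q∣s-r differ
      i≡j : i ≡ j
      i≡j = ≡.trans (≡.sym (Fin.combine-remQuot {z} μ.m i)) (≡.trans
        (cong₂ Fin.combine (Fin.toℕ-injective v≡v′) (Fin.toℕ-injective u≡u′)) (Fin.combine-remQuot {z} μ.m j))

  -- For equal moduli the roots must differ modulo a prime factor and not just modulo m, since their
  -- difference has to be a unit modulo q.
  Distinct : ∀ {z} → RootModulus z → RootModulus z → Set
  Distinct {z} μ ν = μ.m ≢ ν.m ⊎ ν.m ≡ μ.m × ∃[ q ] Prime q × q ℕ.∣ μ.m × ¬ + q ℤ.∣ ν.r ℤ.- μ.r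
    where
    module μ = RootModulus μ
    module ν = RootModulus ν

  rootModulus : ∀ z m → 0 < m → Rough z m → discriminant ≤ z → (s : ℕ → ℤ) →
                (∀ q → Prime q → q ℕ.∣ m → Cl (+ q ℤ.∣ eval Q (s q))) →
                Cl (Σ (RootModulus z) λ μ → RootModulus.m μ ≡ m ×
                    ∀ q → Prime q → q ℕ.∣ m → + q ℤ.∣ RootModulus.r μ ℤ.- s q)
  rootModulus z m 0<m rough disc≤z s roots k = build (Factorisation.factorise m ⦃ ℕ.>-nonZero 0<m ⦄)
    where
    build : Factorisation.PrimeFactorisation m → Ans
    build record { factors = qs ; isFactorisation = m≡∏ ; factorsPrime = primes } =
      all-Cl {B = SimpleRoot Q s} (All.tabulate λ {q} q∈ K →
        let pr  = All.lookup primes q∈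
            q∣m = subst (q ℕ.∣_) (≡.sym m≡∏) (ℕ.∈⇒∣product q∈)
        in roots q pr q∣m λ root → K (pr , root , simple {q} {s q} (ℕ.≤-<-trans disc≤z (rough q pr q∣m)) root)) λ simples →
      let (r , root , congruent) = lift-roots Q s qs simples
      in k (record { m = m ; 0<m = 0<m ; rough = rough ; r = r ; root = subst (λ x → + x ℤ.∣ eval Q r) (≡.sym m≡∏) root }
           , refl
           , λ q pr q∣m → All.lookup congruent
               (Factorisation.factorisationHasAllPrimeFactors pr (subst (q ℕ.∣_) m≡∏ q∣m) primes))

  module _ (L : Lattice) where
    open Lattice L
    open LatticeProperties (O-orderLike irreducible Ans) L

    smallElement : ∀ {z} (μ : RootModulus z) B → RootModulus.m μ < B ^ D →
                   ∃[ c ] Nonzero c × (∀ i → ∣ c i ∣ ≤ B) × Ideal._∈I (RootModulus.ideal μ) (comb c e)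
    smallElement μ B m<B^D = conclude (Fin.pigeonhole m<B^D residue)
      where
      open RootModulus μ
      instance
        m-nonZero : NonZero m
        m-nonZero = ℕ.>-nonZero 0<m
      t : Fin (B ^ D) → Fin D → ℤ
      t i d = + digits {B} {D} i d
      value : Fin (B ^ D) → ℤ
      value i = eval (comb (t i) e) r
      residue : Fin (B ^ D) → Fin m
      residue i = fromℕ< (ℤ.n%d<d (value i) (+ m))
      conclude : (∃₂ λ i j → i Fin.< j × residue i ≡ residue j) →
                 ∃[ c ] Nonzero c × (∀ i → ∣ c i ∣ ≤ B) × Ideal._∈I (RootModulus.ideal μ) (comb c e)
      conclude (i , j , i<j , same) = (λ d → t i d ℤ.- t j d) , nonzero
        , (λ d → ℕ.<⇒≤ (∣-∣-bound (Fin.toℕ<n (Fin.finToFun {B} {D} i d)) (Fin.toℕ<n (Fin.finToFun {B} {D} j d))))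
        , Ideal.resp ideal (O.≈-sym (comb-- (t i) (t j) e))
            (subst (+ m ℤ.∣_) (≡.sym (≡.trans (evalₚ-+ (comb (t i) e) (-ₚ comb (t j) e) r)
              (cong (λ z → value i ℤ.+ z) (evalₚ-neg (comb (t j) e) r)))) m∣difference)
        where
        nonzero : Nonzero (λ d → t i d ℤ.- t j d)
        nonzero = case nonzero? (λ d → t i d ℤ.- t j d) of λ where
          (inj₁ nz)  → nz
          (inj₂ all) → contradiction (digits-injective {B} {D} λ d → ℤ.+-injective (ℤ.i-j≡0⇒i≡j _ _ (all d))) (Fin.<⇒≢ i<j)
        m∣difference : + m ℤ.∣ value i ℤ.- value j
        m∣difference = ℤ.divides (value i ℤ./ + m ℤ.- value j ℤ./ + m)
          (≡.trans (cong₂ ℤ._-_ (ℤ.a≡a%n+[a/n]*n (value i) (+ m)) (ℤ.a≡a%n+[a/n]*n (value j) (+ m)))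
          (≡.trans (cong (λ x → (+ x ℤ.+ (value i ℤ./ + m) ℤ.* + m) ℤ.- (+ (value j ℤ.% + m) ℤ.+ (value j ℤ./ + m) ℤ.* + m))
              (≡.trans (≡.sym (Fin.toℕ-fromℕ< _)) (≡.trans (cong toℕ same) (Fin.toℕ-fromℕ< _))))
            (identity (+ (value j ℤ.% + m)) (value i ℤ./ + m) (value j ℤ./ + m) (+ m))))
          where
          identity : ∀ r x y m → (r ℤ.+ x ℤ.* m) ℤ.- (r ℤ.+ y ℤ.* m) ≡ (x ℤ.- y) ℤ.* m
          identity = ℤSolver.solve-∀

    -- The intersection of the two ideals has index at least z X, more than a common element with
    -- coordinates at most B permits.
    collision : ∀ {z} (μ ν : RootModulus z) → Distinct μ ν → ∀ c B X → 1 ≤ B → Nonzero c → (∀ i → ∣ c i ∣ ≤ B) →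
                Ideal._∈I (RootModulus.ideal μ) (comb c e) → Ideal._∈I (RootModulus.ideal ν) (comb c e) →
                X ≤ RootModulus.m μ → X ≤ RootModulus.m ν → (indexConstant ℕ.* B) ^ D < z ℕ.* X → Ans
    collision {z} μ ν distinct c B X 1≤B c≢0 c≤B c∈μ c∈ν X≤μ X≤ν small = case distinct of λ where
        (inj₂ (same , q , pr , q∣m , differ)) → index μ ν c∈μ c∈ν X≤μ (element μ ν)
          (incongruent-root μ ν pr (RootModulus.rough μ q pr q∣m) q∣m same differ)
        (inj₁ μ≢ν) → case RootModulus.m ν ℕ.∣? RootModulus.m μ of λ where
          (no ν∤μ)  → index μ ν c∈μ c∈ν X≤μ (λ i → + toℕ i ∷ []) (incongruent-∤ μ ν ν∤μ)
          (yes ν∣μ) → index ν μ c∈ν c∈μ X≤ν (λ i → + toℕ i ∷ []) (incongruent-∤ ν μ λ μ∣ν → μ≢ν (ℕ.∣-antisym μ∣ν ν∣μ))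
      where
      index : ∀ (μ ν : RootModulus z) → Ideal._∈I (RootModulus.ideal μ) (comb c e) → Ideal._∈I (RootModulus.ideal ν) (comb c e) →
              X ≤ RootModulus.m μ → (w : Fin (z ℕ.* RootModulus.m μ) → List ℤ) →
              Incongruent (RootModulus.ideal μ ∩ RootModulus.ideal ν) w → Ans
      index μ ν c∈μ c∈ν X≤μ w incong = indexBound (RootModulus.ideal μ ∩ RootModulus.ideal ν) c B 1≤B c≢0 c≤B (c∈μ , c∈ν)
        w incong (ℕ.<-≤-trans small (ℕ.*-monoʳ-≤ z X≤μ))

-- Counting pairs of a modulus and a root

module ReciprocalBound (P : ℤ[x]) (δ : ℕ) (P-degree : HasDegree P (suc δ)) (1≤δ : 1 ≤ δ) (irreducible : IrreducibleOverℚ P) where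
  open UpperBound P δ P-degree 1≤δ irreducible
  open MonicModel P δ P-degree
  open Classical Ans
  open Lattices Ans O
  open Ideals O using (module Ideal)

  private
    module Count (L : Lattice) (D′ : ℕ) (rank : Lattice.D L ≡ suc D′) (z : ℕ) (disc≤z : discriminant ≤ z) (2≤z : 2 ≤ z)
                 (M : ℕ) (2≤M : 2 ≤ M) (divides-M : ∀ q → Prime q → q ≤ z → q ℕ.∣ M)
                 (ps : List ℕ) (sorted : AllPairs _<_ ps) (z<ps : All (z <_) ps) (two : All (TwoRoots Q) ps) where
      open Lattice L
      open LatticeProperties (O-orderLike irreducible Ans) L

      Π V W : ℕ
      Π = ℕ.product ps
      V = M ℕ.* Π
      W = V ^ D′

      Index : Set
      Index = Fin (length ps)

      p : Index → ℕ
      p = List.lookup ps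

      twoRoots : ∀ i → TwoRoots Q (p i)
      twoRoots i = All.lookup two (∈.∈-lookup i)

      prime-p : ∀ i → Prime (p i)
      prime-p i = proj₁ (twoRoots i)

      N : Index → ℕ
      N i = W ℕ.* cofactor ps i

      -- A multiple of p i between V^D and (2V)^D. The cofactor is 1 modulo M, which excludes the
      -- primes up to z. For each i there are N i = W Π / p i of them, in all W Π times the
      -- reciprocal sum.
      modulus : Σ Index (Fin ∘ N) → ℕ
      modulus (i , j) = p i ℕ.* suc (M ℕ.* (N i ℕ.+ toℕ j))

      0<p : ∀ i → 0 < p i
      0<p i = ℕ.≤-<-trans z≤n (All.lookup z<ps (∈.∈-lookup i))

      0<V : 0 < V
      0<V = ℕ.*-mono-≤ (ℕ.≤-trans (s≤s z≤n) 2≤M) (positive ps two)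
        where
        positive : ∀ qs → All (TwoRoots Q) qs → 0 < ℕ.product qs
        positive qs two = ℕ.productOfPrimes≥1 (All.map proj₁ two)

      V^D : ∀ i → V ^ D ≡ p i ℕ.* (M ℕ.* N i)
      V^D i = ≡.trans (cong (V ^_) rank) (≡.trans (cong (λ x → M ℕ.* x ℕ.* W) (≡.sym (lookup*cofactor ps i)))
        (identity M (p i) (cofactor ps i) W))
        where
        identity : ∀ M p c W → M ℕ.* (p ℕ.* c) ℕ.* W ≡ p ℕ.* (M ℕ.* (W ℕ.* c))
        identity = ℕSolver.solve-∀

      V^D≤modulus : ∀ x → V ^ D ≤ modulus x
      V^D≤modulus (i , j) = ℕ.≤-trans (ℕ.≤-reflexive (V^D i)) (ℕ.*-monoʳ-≤ (p i)
        (ℕ.≤-trans (ℕ.*-monoʳ-≤ M (ℕ.m≤m+n (N i) (toℕ j))) (ℕ.n≤1+n _)))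

      modulus<[2V]^D : ∀ x → modulus x < (2 ℕ.* V) ^ D
      modulus<[2V]^D (i , j) = ℕ.<-≤-trans (ℕ.*-monoʳ-< (p i) ⦃ ℕ.>-nonZero (0<p i) ⦄ inner) (ℕ.≤-trans
        (ℕ.≤-reflexive (≡.trans (swap (p i) (M ℕ.* N i)) (cong (2 ℕ.*_) (≡.sym (V^D i)))))
        (ℕ.≤-trans (ℕ.*-monoˡ-≤ (V ^ D) 2≤2^D) (ℕ.≤-reflexive (≡.sym (^-distrib-* 2 V D)))))
        where
        swap : ∀ p x → p ℕ.* (2 ℕ.* x) ≡ 2 ℕ.* (p ℕ.* x)
        swap = ℕSolver.solve-∀
        2≤2^D : 2 ≤ 2 ^ D
        2≤2^D = ℕ.≤-trans (ℕ.*-monoʳ-≤ 2 (ℕ.>-nonZero⁻¹ (2 ^ D′) ⦃ ℕ.m^n≢0 2 D′ ⦄)) (ℕ.≤-reflexive (cong (2 ^_) (≡.sym rank)))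
        identity : ∀ M n j → M ℕ.* (n ℕ.+ j) ℕ.+ M ≡ M ℕ.* (n ℕ.+ suc j)
        identity = ℕSolver.solve-∀
        double : ∀ M n → M ℕ.* (n ℕ.+ n) ≡ 2 ℕ.* (M ℕ.* n)
        double = ℕSolver.solve-∀
        inner : suc (M ℕ.* (N i ℕ.+ toℕ j)) < 2 ℕ.* (M ℕ.* N i)
        inner = ℕ.<-≤-trans
          (ℕ.≤-<-trans (ℕ.≤-reflexive (ℕ.+-comm 1 _)) (ℕ.+-monoʳ-< (M ℕ.* (N i ℕ.+ toℕ j)) 2≤M))
          (ℕ.≤-trans (ℕ.≤-reflexive (identity M (N i) (toℕ j)))
            (ℕ.≤-trans (ℕ.*-monoʳ-≤ M (ℕ.+-monoʳ-≤ (N i) (Fin.toℕ<n j))) (ℕ.≤-reflexive (double M (N i)))))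

      0<modulus : ∀ x → 0 < modulus x
      0<modulus (i , j) = ℕ.*-mono-≤ (0<p i) (s≤s z≤n)

      rough : ∀ x → Rough z (modulus x)
      rough (i , j) q pr q∣m = ℕ.≰⇒> λ q≤z → case ℕ.euclidsLemma (p i) _ pr q∣m of λ where
        (inj₁ q∣p) → case ℕ.prime⇒irreducible (prime-p i) q∣p of λ where
          (inj₁ refl) → contradiction pr ℕ.¬prime[1]
          (inj₂ refl) → contradiction q≤z (ℕ.<⇒≱ (All.lookup z<ps (∈.∈-lookup i)))
        (inj₂ q∣1+M*) → contradiction (subst Prime (ℕ.∣1⇒≡1 (ℕ.∣m+n∣m⇒∣n
          (subst (q ℕ.∣_) (ℕ.+-comm 1 _) q∣1+M*) (ℕ.∣m⇒∣m*n _ (divides-M q pr q≤z)))) pr) ℕ.¬prime[1]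

      second : Index → ℤ
      second i = proj₁ (secondRoot (twoRoots i))

      -- If one modulus arises from two indices i and i′, the first item uses the second root at p
      -- i, while the other uses the first root there; the two pairs remain distinct.
      chosenRoot : Index → ℕ → ℤ
      chosenRoot i q with q ℕ.≟ p i
      ... | yes _ = second i
      ... | no  _ = firstRoot q

      chosenRoot-second : ∀ i → chosenRoot i (p i) ≡ second i
      chosenRoot-second i with p i ℕ.≟ p i
      ... | yes _ = refl
      ... | no  ≢ = contradiction refl ≢

      chosenRoot-first : ∀ i {q} → q ≢ p i → chosenRoot i q ≡ firstRoot q
      chosenRoot-first i {q} q≢p with q ℕ.≟ p i
      ... | yes q≡p = contradiction q≡p q≢p
      ... | no  _   = refl

      chosenRoot-spec : ∀ i q → Prime q → 2 < q → Cl (+ q ℤ.∣ eval Q (chosenRoot i q))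
      chosenRoot-spec i q pr 2<q k with q ℕ.≟ p i
      ... | yes refl = k (proj₁ (proj₂ (secondRoot (twoRoots i))))
      ... | no  _    = firstRoot-spec q pr 2<q k

      record Item (x : Σ Index (Fin ∘ N)) : Set where
        field
          μ         : RootModulus z
          μ-modulus : RootModulus.m μ ≡ modulus x
          congruent : ∀ q → Prime q → q ℕ.∣ modulus x → + q ℤ.∣ RootModulus.r μ ℤ.- chosenRoot (proj₁ x) q

      item : ∀ x → Cl (Item x)
      item x k = rootModulus z (modulus x) (0<modulus x) (rough x) disc≤z (chosenRoot (proj₁ x))
        (λ q pr q∣m → chosenRoot-spec (proj₁ x) q pr (ℕ.≤-<-trans 2≤z (rough x q pr q∣m)))
        λ (μ , eq , congruent) → k record { μ = μ ; μ-modulus = eq ; congruent = congruent }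

      distinct : ∀ {x y} (X : Item x) (Y : Item y) → x ≢ y → Distinct (Item.μ X) (Item.μ Y)
      distinct {i , j} {i′ , j′} X Y x≢y = case i Fin.≟ i′ of λ where
          (yes i≡i′) → inj₁ λ eq → same-index i≡i′ (≡.trans (≡.sym X.μ-modulus) (≡.trans eq Y.μ-modulus))
          (no  i≢i′) → case modulus (i , j) ℕ.≟ modulus (i′ , j′) of λ where
            (no  m≢m′) → inj₁ λ eq → m≢m′ (≡.trans (≡.sym X.μ-modulus) (≡.trans eq Y.μ-modulus))
            (yes m≡m′) → inj₂ (≡.trans Y.μ-modulus (≡.trans (≡.sym m≡m′) (≡.sym X.μ-modulus)) , p i , prime-p i
              , subst (p i ℕ.∣_) (≡.sym X.μ-modulus) p∣m
              , λ p∣difference → proj₂ (proj₂ (secondRoot (twoRoots i))) (subst (+ p i ℤ.∣_)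
                  (identity (second i) (firstRoot (p i)) X.r Y.r)
                  (ℤ.∣m∣n⇒∣m-n (ℤ.∣m∣n⇒∣m-n
                    (subst (λ s → + p i ℤ.∣ Y.r ℤ.- s) (chosenRoot-first i′ (lookup-≢ (AllPairs.map ℕ.<⇒≢ sorted) i≢i′))
                      (Y.congruent (p i) (prime-p i) (subst (p i ℕ.∣_) m≡m′ p∣m)))
                    p∣difference)
                    (subst (λ s → + p i ℤ.∣ X.r ℤ.- s) (chosenRoot-second i) (X.congruent (p i) (prime-p i) p∣m)))))
        where
        module X where
          open Item X public
          open RootModulus μ public
        module Y where
          open Item Y public
          open RootModulus μ public
        p∣m : p i ℕ.∣ modulus (i , j)
        p∣m = ℕ.m∣m*n _
        identity : ∀ s f x y → ((y ℤ.- f) ℤ.- (y ℤ.- x)) ℤ.- (x ℤ.- s) ≡ s ℤ.- f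
        identity = ℤSolver.solve-∀
        same-index : i ≡ i′ → modulus (i , j) ≡ modulus (i′ , j′) → ⊥
        same-index refl eq = x≢y (cong (i ,_) (Fin.toℕ-injective (ℕ.+-cancelˡ-≡ (N i) (toℕ j) (toℕ j′)
          (ℕ.*-cancelˡ-≡ _ _ M ⦃ ℕ.>-nonZero (ℕ.≤-trans (s≤s z≤n) 2≤M) ⦄ (ℕ.suc-injective
            (ℕ.*-cancelˡ-≡ _ _ (p i) ⦃ ℕ.>-nonZero (0<p i) ⦄ eq))))))

      contradict : 5 ^ D ℕ.* M ℕ.* Π < numerator ps → (2 ℕ.* indexConstant) ^ D < z → Ans
      contradict many large-z = finite-choice (λ k → item (DisjointUnion.decode N k)) λ items →
        let module I k = Item (items k)
            B = 2 ℕ.* V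
            X = V ^ D
            X≤ : ∀ k → X ≤ RootModulus.m (I.μ k)
            X≤ k = subst (X ≤_) (≡.sym (I.μ-modulus k)) (V^D≤modulus (DisjointUnion.decode N k))
            small k = smallElement L (I.μ k) B (subst (_< B ^ D) (≡.sym (I.μ-modulus k)) (modulus<[2V]^D (DisjointUnion.decode N k)))
            c = λ k → proj₁ (small k)
            (i , j , i≢j , same) = pigeonhole-ℤ B enough c (λ k → proj₁ (proj₂ (proj₂ (small k))))
            (c≢0 , c≤B , c∈) = proj₂ (small i)
            (_ , _ , c′∈) = proj₂ (small j)
        in collision L (I.μ i) (I.μ j) (distinct (items i) (items j) (i≢j ∘ DisjointUnion.decode-injective N))
             (c i) B X (ℕ.≤-trans 0<V (ℕ.m≤m+n V (V ℕ.+ 0))) c≢0 c≤B c∈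
             (Ideal.resp (RootModulus.ideal (I.μ j)) (Combinations.comb-cong O e (≡.sym ∘ same)) c′∈)
             (X≤ i) (X≤ j) indexSmall
        where
        identity : ∀ C V → C ℕ.* (2 ℕ.* V) ≡ 2 ℕ.* C ℕ.* V
        identity = ℕSolver.solve-∀
        indexSmall : (indexConstant ℕ.* (2 ℕ.* V)) ^ D < z ℕ.* V ^ D
        indexSmall = ℕ.≤-<-trans (ℕ.≤-reflexive (≡.trans (cong (_^ D) (identity indexConstant V)) (^-distrib-* (2 ℕ.* indexConstant) V D)))
          (ℕ.*-monoˡ-< (V ^ D) ⦃ ℕ.m^n≢0 V D ⦃ ℕ.>-nonZero 0<V ⦄ ⦄ large-z)
        rearrange : ∀ f M Π W → f ℕ.* (M ℕ.* Π ℕ.* W) ≡ W ℕ.* (f ℕ.* M ℕ.* Π)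
        rearrange = ℕSolver.solve-∀
        five : ∀ V → V ℕ.+ (2 ℕ.* V ℕ.+ 2 ℕ.* V) ≡ 5 ℕ.* V
        five = ℕSolver.solve-∀
        -- The small elements have at most (4V + 1)^D ≤ 5^D V W coordinate vectors, against W ·
        -- `numerator ps` moduli.
        enough : suc (2 ℕ.* V ℕ.+ 2 ℕ.* V) ^ D < sumℕ N
        enough = ℕ.≤-<-trans (ℕ.^-monoˡ-≤ D (ℕ.≤-trans (ℕ.+-monoˡ-≤ (2 ℕ.* V ℕ.+ 2 ℕ.* V) 0<V) (ℕ.≤-reflexive (five V))))
          (ℕ.≤-<-trans (ℕ.≤-reflexive (≡.trans (^-distrib-* 5 V D) (≡.trans (cong (λ n → 5 ^ D ℕ.* V ^ n) rank) (rearrange (5 ^ D) M Π W))))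
          (ℕ.<-≤-trans (ℕ.*-monoʳ-< W ⦃ ℕ.m^n≢0 V D′ ⦃ ℕ.>-nonZero 0<V ⦄ ⦄ many)
            (ℕ.≤-reflexive (Sum.*-distribˡ-sum ℕ.+-*-semiring W (cofactor ps)))))

  reciprocalBound : Cl (∃₂ λ z K → ∀ ps → AllPairs _<_ ps → All (z <_) ps → All (TwoRoots Q) ps →
                        K ℕ.* ℕ.product ps < numerator ps → Ans)
  reciprocalBound k = lattice (O-finitelyGenerated irreducible) λ L → positive L (Lattice.D L) refl
    where
    positive : ∀ L n → Lattice.D L ≡ n → Ans
    positive L zero     rank = LatticeProperties.rank-positive (O-orderLike irreducible Ans) L rank
    -- z exceeds the discriminant, for simple roots, and (2 indexConstant)^D, for the collision. In
    -- K the factor 5^D counts coordinates, and z! is the loss from keeping only cofactors that are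
    -- 1 modulo z!.
    positive L (suc D′) rank = k (z , 5 ^ Lattice.D L ℕ.* z ! , λ ps sorted z<ps two many →
      Count.contradict L D′ rank z (ℕ.m≤m+n discriminant (2 ℕ.+ C)) (ℕ.≤-trans (ℕ.m≤m+n 2 C) (ℕ.m≤n+m (2 ℕ.+ C) discriminant))
        (z !) (ℕ.≤-trans (ℕ.≤-trans (ℕ.m≤m+n 2 C) (ℕ.m≤n+m (2 ℕ.+ C) discriminant)) (n≤n! z))
        (λ q pr q≤z → prime∣! pr q≤z)
        ps sorted z<ps two many (ℕ.<-≤-trans (ℕ.n<1+n C) (ℕ.≤-trans (ℕ.n≤1+n (suc C)) (ℕ.m≤n+m (2 ℕ.+ C) discriminant))))
      where
      C z : ℕ
      C = (2 ℕ.* LatticeProperties.indexConstant (O-orderLike irreducible Ans) L) ^ Lattice.D L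
      z = discriminant ℕ.+ (2 ℕ.+ C)
      n≤n! : ∀ n → n ≤ n !
      n≤n! zero    = z≤n
      n≤n! (suc n) = ℕ.≤-trans (ℕ.≤-reflexive (≡.sym (ℕ.*-identityʳ (suc n)))) (ℕ.*-monoʳ-≤ (suc n) (ℕ.1≤n! n))

-- A ring containing a second root of P

sumℕ-scale : ∀ {n} a (f : Fin n → ℕ) → sumℕ (λ i → a ℕ.* f i) ≡ a ℕ.* sumℕ f
sumℕ-scale a f = ≡.sym (Sum.*-distribˡ-sum ℕ.+-*-semiring a f)

numerator-∷ : ∀ p ps → numerator (p ∷ ps) ≡ ℕ.product ps ℕ.+ p ℕ.* numerator ps
numerator-∷ p ps = cong (ℕ.product ps ℕ.+_) (sumℕ-scale p (cofactor ps))

numerator-++ : ∀ ps qs → numerator (ps ++ qs) ≡ numerator ps ℕ.* ℕ.product qs ℕ.+ ℕ.product ps ℕ.* numerator qs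
numerator-++ []       qs = ≡.sym (ℕ.*-identityˡ _)
numerator-++ (p ∷ ps) qs = ≡.trans (numerator-∷ p (ps ++ qs))
  (≡.trans (cong₂ (λ x y → x ℕ.+ p ℕ.* y) (ℕ.product-++ ps qs) (numerator-++ ps qs))
  (≡.trans (identity p (ℕ.product ps) (ℕ.product qs) (numerator ps) (numerator qs))
    (cong (λ x → x ℕ.* ℕ.product qs ℕ.+ p ℕ.* ℕ.product ps ℕ.* numerator qs) (≡.sym (numerator-∷ p ps)))))
  where
  identity : ∀ p P Q n m → P ℕ.* Q ℕ.+ p ℕ.* (n ℕ.* Q ℕ.+ P ℕ.* m) ≡ (P ℕ.+ p ℕ.* n) ℕ.* Q ℕ.+ p ℕ.* P ℕ.* m
  identity = ℕSolver.solve-∀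

-- Tails of a set of primes with bounded reciprocal sum

module SparseTail (Ans : Set) (T : ℕ → Set) (prime : ∀ {q} → T q → Prime q) where
  open Classical Ans

  Admissible : ℕ → List ℕ → Set
  Admissible z ps = AllPairs _<_ ps × All (z <_) ps × All T ps

  Bounded : Set
  Bounded = ∃₂ λ z K → ∀ ps → Admissible z ps → K ℕ.* ℕ.product ps < numerator ps → Ans

  -- Every finite set of primes of T beyond z has reciprocal sum below 1/N, with Ans in place of ⊥.
  Tail : ℕ → ℕ → Set
  Tail N z = ∀ ps → Admissible z ps → ℕ.product ps ≤ N ℕ.* numerator ps → Ans

  tail-mono : ∀ {N z z′} → z ≤ z′ → Tail N z → Tail N z′
  tail-mono z≤z′ tail ps (sorted , z′< , two) = tail ps (sorted , All.map (ℕ.≤-<-trans z≤z′) z′< , two)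

  private
    blocks : ∀ N j z → Cl (∃ (Tail N) ⊎ ∃[ ps ] Admissible z ps × j ℕ.* ℕ.product ps ≤ N ℕ.* numerator ps)
    blocks N zero    z k = k (inj₂ ([] , ([] , [] , []) , z≤n))
    blocks N (suc j) z k = lem (∃[ ps ] Admissible z ps × ℕ.product ps ≤ N ℕ.* numerator ps) λ where
        (inj₂ none) → k (inj₁ (z , λ ps admissible large → none (ps , admissible , large)))
        -- The product exceeds or equals each member of ps, so the next block starts beyond this
        -- one.
        (inj₁ (ps , (sorted , z<ps , two) , large)) → blocks N j (z ℕ.+ ℕ.product ps) λ where
          (inj₁ tail) → k (inj₁ tail)
          (inj₂ (qs , (sorted′ , z<qs , two′) , large′)) → k (inj₂ (ps ++ qs
            , ( AllPairs.++⁺ sorted sorted′ (All.tabulate λ {p} p∈ps → All.map (ℕ.≤-<-trans (below two p∈ps)) z<qs)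
              , All.++⁺ z<ps (All.map (ℕ.≤-<-trans (ℕ.m≤m+n z (ℕ.product ps))) z<qs)
              , All.++⁺ two two′ )
            , combine ps qs large large′))
      where
      below : ∀ {p ps} → All T ps → p ∈ ps → p ≤ z ℕ.+ ℕ.product ps
      below {p} {ps} two p∈ps = ℕ.≤-trans
        (ℕ.∣⇒≤ ⦃ ℕ.>-nonZero (ℕ.productOfPrimes≥1 (All.map prime two)) ⦄ (ℕ.∈⇒∣product p∈ps))
        (ℕ.m≤n+m (ℕ.product ps) z)
      combine : ∀ ps qs → ℕ.product ps ≤ N ℕ.* numerator ps → j ℕ.* ℕ.product qs ≤ N ℕ.* numerator qs →
                suc j ℕ.* ℕ.product (ps ++ qs) ≤ N ℕ.* numerator (ps ++ qs)
      combine ps qs large large′ = begin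
        suc j ℕ.* ℕ.product (ps ++ qs)                         ≡⟨ cong (suc j ℕ.*_) (ℕ.product-++ ps qs) ⟩
        suc j ℕ.* (P ℕ.* Q)                                    ≡⟨ split j P Q ⟩
        P ℕ.* Q ℕ.+ P ℕ.* (j ℕ.* Q)
          ≤⟨ ℕ.+-mono-≤ (ℕ.*-monoˡ-≤ Q large) (ℕ.*-monoʳ-≤ P large′) ⟩
        N ℕ.* numerator ps ℕ.* Q ℕ.+ P ℕ.* (N ℕ.* numerator qs) ≡⟨ gather N (numerator ps) Q P (numerator qs) ⟩
        N ℕ.* (numerator ps ℕ.* Q ℕ.+ P ℕ.* numerator qs)      ≡⟨ cong (N ℕ.*_) (numerator-++ ps qs) ⟨
        N ℕ.* numerator (ps ++ qs)                             ∎
        where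
        open ℕ.≤-Reasoning
        P = ℕ.product ps
        Q = ℕ.product qs
        split : ∀ j P Q → suc j ℕ.* (P ℕ.* Q) ≡ P ℕ.* Q ℕ.+ P ℕ.* (j ℕ.* Q)
        split = ℕSolver.solve-∀
        gather : ∀ N n Q P m → N ℕ.* n ℕ.* Q ℕ.+ P ℕ.* (N ℕ.* m) ≡ N ℕ.* (n ℕ.* Q ℕ.+ P ℕ.* m)
        gather = ℕSolver.solve-∀

  -- If no tail were that sparse, disjoint blocks of reciprocal sum 1/N would exceed the bound K.
  tail : Bounded → ∀ N → 1 ≤ N → Cl (∃ (Tail N))
  tail (z , K , bounded) N 1≤N k = blocks N (suc (N ℕ.* K)) z λ where
    (inj₁ tail) → k tail
    (inj₂ (ps , admissible@(_ , _ , two) , large)) → bounded ps admissible (ℕ.*-cancelˡ-< N (K ℕ.* ℕ.product ps) (numerator ps)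
      (ℕ.<-≤-trans (ℕ.≤-<-trans (ℕ.≤-reflexive (≡.sym (ℕ.*-assoc N K (ℕ.product ps))))
        (ℕ.m<n+m (N ℕ.* K ℕ.* ℕ.product ps) (ℕ.productOfPrimes≥1 (All.map prime two)))) large))

module AlgebraicDomain (Ans : Set) (A : ℤ-Algebra) (fg : FinitelyGenerated A) where
  open ℤ-Algebra A
  open Classical Ans
  open Combinations A
  open Solver A
  open SetoidReasoning setoid
  open GeneratorCoordinates A fg

  pow : Carrier → ∀ {k} → Fin k → Carrier
  pow x zero    = 1#
  pow x (suc i) = x * pow x i

  module _ (char0 : ∀ {n} → n ≢ + 0 → ι n ≈ 0# → Ans)
           (domain : ∀ x y → x * y ≈ 0# → Cl (x ≈ 0# ⊎ y ≈ 0#)) where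
    private
      -- In a polynomial relation for x the constant term, if nonzero, is a multiple of x. If it is
      -- zero, a factor x cancels because the ring is a domain.
      relation : ∀ x k (c : Fin k → ℤ) → Nonzero c → comb c (pow x) ≈ 0# →
                 Cl (x ≈ 0# ⊎ ∃₂ λ u n → n ≢ + 0 × u * x ≈ ι n)
      relation x zero    c (() , _)
      relation x (suc k) c nz c≈0 K = case c zero ℤ.≟ + 0 of λ where
          (no c₀≢0)  → K (inj₂ (- rest , c zero , c₀≢0 , (begin
            - rest * x                                  ≈⟨ solve 3 (λ r x c → :- r :* x := c :* con (+ 1) :- (c :* con (+ 1) :+ x :* r)) ≈-refl rest x (ι (c zero)) ⟩
            ι (c zero) * 1# - (ι (c zero) * 1# + x * rest) ≈⟨ +-congˡ (-‿cong (≈-trans (≈-sym expand) c≈0)) ⟩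
            ι (c zero) * 1# - 0#                        ≈⟨ solve 1 (λ c → c :* con (+ 1) :- con (+ 0) := c) ≈-refl (ι (c zero)) ⟩
            ι (c zero)                                  ∎)))
          (yes c₀≡0) → domain x rest (begin
              x * rest                     ≈⟨ +-identityˡ _ ⟨
              0# + x * rest                ≈⟨ +-congʳ (≈-trans (*-congʳ (≈-trans (ι-cong c₀≡0) ι-0)) (zeroˡ 1#)) ⟨
              ι (c zero) * 1# + x * rest   ≈⟨ expand ⟨
              comb c (pow x)               ≈⟨ c≈0 ⟩
              0#                           ∎) λ where
            (inj₁ x≈0)    → K (inj₁ x≈0)
            (inj₂ rest≈0) → relation x k (c ∘ suc)
              (case nz of λ { (zero , c₀≢0) → contradiction c₀≡0 c₀≢0 ; (suc i , cᵢ≢0) → i , cᵢ≢0 }) rest≈0 K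
        where
        module S = Sum semiring
        rest : Carrier
        rest = comb (c ∘ suc) (pow x)
        expand : comb c (pow x) ≈ ι (c zero) * 1# + x * rest
        expand = +-congˡ (≈-trans
          (S.sum-cong-≋ {k} {λ i → ι (c (suc i)) * (x * pow x i)} {λ i → x * (ι (c (suc i)) * pow x i)}
            (λ i → solve 3 (λ c x p → c :* (x :* p) := x :* (c :* p)) ≈-refl (ι (c (suc i))) x (pow x i)))
          (≈-sym (S.*-distribˡ-sum x (λ i → ι (c (suc i)) * pow x i))))

    orderLike : Lattices.OrderLike Ans A
    orderLike = record
      { char0  = char0
      ; invert = λ x k → case dependence (pow x) of λ (c , nz , c≈0) → relation x (suc rank) c nz c≈0 k }

-- Not definitional: the raw semirings of A and of its quotient differ in their equality.
evalₚ-quotient : ∀ A J f x → PolyRing.evalₚ (Ideals.quotient A J) f x ≡ PolyRing.evalₚ A f x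
evalₚ-quotient A J []      x = refl
evalₚ-quotient A J (a ∷ f) x = cong (λ y → a + x * y) (evalₚ-quotient A J f x)
  where open ℤ-Algebra A

module SecondRoot (P : ℤ[x]) (δ : ℕ) (P-degree : HasDegree P (suc δ)) (1≤δ : 1 ≤ δ) (irreducible : IrreducibleOverℚ P) where
  open MonicModel P δ P-degree
  private
    module O = ℤ-Algebra O
    module OP = PolyRing O
    module OPP = PolyProperties O
    module OX = ℤ-Algebra (PolyRing.algebra O)
    module OS = Solver (PolyRing.algebra O)
    module E = ScalarExtension O
    I = Order.fIdeal

    α : List ℤ
    α = + 0 ∷ + 1 ∷ []

    QO Q₁ : List (List ℤ)
    QO = map O.ι Q
    Q₁ = OPP.synthetic QO α

    QO-vanishes : OPP.Vanishes QO (suc (suc δ))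
    QO-vanishes j δ<j = O.≈-trans (E.coeff-ι Q j) (O.≈-trans (O.≡⇒≈ (cong O.ι (Q-vanishes j δ<j))) O.ι-0)

    Q₁-vanishes : OPP.Vanishes Q₁ (suc δ)
    Q₁-vanishes = OPP.synthetic-vanishes QO α (suc δ) QO-vanishes

    Q₁-monic : OP.coeff Q₁ δ O.≈ O.1#
    Q₁-monic = O.≈-trans (OPP.synthetic-lead QO α δ QO-vanishes)
      (O.≈-trans (E.coeff-ι Q (suc δ)) (O.≈-trans (O.≡⇒≈ (cong O.ι Q-monic)) O.ι-1))

    evaluate-α : ∀ p → OP.evalₚ (map O.ι p) α O.≈ p
    evaluate-α p = O.≈-trans (O.≡⇒≈ (evalₚ-quotient (PolyRing.algebra ℤ-algebra) I (map O.ι p) α)) $ Ideals.≈⇒≈[] (PolyRing.algebra ℤ-algebra) I (evalₚ-X p)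

    QO-α : OP.evalₚ QO α O.≈ O.0#
    QO-α = O.≈-trans (evaluate-α Q) (Ideals.∈⇒≈[]0 (PolyRing.algebra ℤ-algebra) I (+ 1 ∷ [] , ≋-sym (*ₚ-identityˡ Q)))

    Q₁-α : OP.evalₚ Q₁ α O.≈ derivative Q
    Q₁-α = O.≈-trans (O.≈-sym (OPP.evalₚ-derivative QO α))
      (O.≈-trans (OPP.evalₚ-cong α (E.ι-derivative Q)) (evaluate-α (derivative Q)))

    module Extension = Adjoin O Q₁ δ

  -- O[X] / (Q₁), where Q = (X - α) Q₁ over O. Nothing says that Q₁ is irreducible, so S may have
  -- zero divisors.
  S : ℤ-Algebra
  S = Extension.extension

  private
    module S = ℤ-Algebra S
    I₁ = Extension.fIdeal

  S-finitelyGenerated : FinitelyGenerated S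
  S-finitelyGenerated = Extension.extension-finitelyGenerated Q₁-monic Q₁-vanishes (O-finitelyGenerated irreducible)

  S-char0 : ∀ {n} → S.ι n S.≈ S.0# → n ≡ + 0
  S-char0 {n} n≈0 = O-char0 (Ideals.≈[]0⇒∈ (PolyRing.algebra ℤ-algebra) I (OP.at (Extension.vanishes∈⇒≋[] Q₁-monic Q₁-vanishes constant (Ideals.≈[]0⇒∈ (PolyRing.algebra O) I₁ n≈0)) 0))
    where
    constant : OPP.Vanishes (O.ι n ∷ []) δ
    constant (suc j) _   = O.≈-refl
    constant zero    δ≤0 = contradiction (ℕ.≤-trans 1≤δ δ≤0) λ ()

  root₁ root₂ : S.Carrier
  root₁ = α ∷ []
  root₂ = O.0# ∷ O.1# ∷ []

  private
    evaluate-const : ∀ f x → PolyRing.evalₚ (PolyRing.algebra O) (map (_∷ []) f) (x ∷ []) OP.≋ OP.evalₚ f x ∷ []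
    evaluate-const []      x = OP.≋-sym OP.0∷[]
    evaluate-const (a ∷ f) x = OP.≋-trans
      (OX.+-congˡ {a ∷ []} (OP.≋-trans (OX.*-congˡ {x ∷ []} (evaluate-const f x)) (OP.const-*ₚ x (OP.evalₚ f x ∷ []))))
      OP.≋-refl

    map-ι : ∀ p → map S.ι p ≡ map (_∷ []) (map O.ι p)
    map-ι []      = refl
    map-ι (a ∷ p) = cong (S.ι a ∷_) (map-ι p)

  isRoot₁ : PolyRing.evalₚ S (map S.ι Q) root₁ S.≈ S.0#
  isRoot₁ = subst (λ f → PolyRing.evalₚ S f root₁ S.≈ S.0#) (≡.sym (map-ι Q))
    (S.≈-trans (S.≡⇒≈ (evalₚ-quotient (PolyRing.algebra O) I₁ (map (_∷ []) QO) root₁)) $ Ideals.≈⇒≈[] (PolyRing.algebra O) I₁ (OP.≋-trans (evaluate-const QO α) (OP.∷≋[] QO-α OP.≋-refl)))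

  isRoot₂ : PolyRing.evalₚ S (map S.ι Q) root₂ S.≈ S.0#
  isRoot₂ = subst (λ f → PolyRing.evalₚ S f root₂ S.≈ S.0#) (≡.sym (map-ι Q))
    (S.≈-trans (S.≈-trans (S.≡⇒≈ (evalₚ-quotient (PolyRing.algebra O) I₁ (map (_∷ []) QO) root₂)) (Ideals.≈⇒≈[] (PolyRing.algebra O) I₁ (OPP.evalₚ-X QO)))
      (Ideals.∈⇒≈[]0 (PolyRing.algebra O) I₁ (O.- α ∷ O.1# ∷ [] , OP.≋-trans (OPP.synthetic-division QO α)
        (OP.≋-trans (OX.+-congˡ {(O.- α ∷ O.1# ∷ []) OP.*ₚ Q₁} (OP.∷≋[] QO-α OP.≋-refl)) (OP.+ₚ-identityʳ _)))))

  -- Modulo root₁ − root₂ the relation Q₁(root₂) = 0 becomes Q′(root₁) = 0.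
  separation : ∃[ n ] n ≢ + 0 × ∀ (J : Ideals.Ideal S) → Ideals.Ideal._∈I J (root₁ S.- root₂) → Ideals.Ideal._∈I J (S.ι n)
  separation = conclude (separable irreducible 1≤δ)
    where
    conclude : (∃₂ λ u n → n ≢ + 0 × Ideals.Ideal._∈I I (u *ₚ derivative Q +ₚ -ₚ (n ∷ []))) →
               ∃[ n ] n ≢ + 0 × ∀ (J : Ideals.Ideal S) → Ideals.Ideal._∈I J (root₁ S.- root₂) → Ideals.Ideal._∈I J (S.ι n)
    conclude (u , n , n≢0 , uQ′-n) = n , n≢0 , λ J d → let open Ideals.Ideal J in
      resp (Ideals.≈⇒≈[] (PolyRing.algebra O) I₁ (OP.≋-trans (OP.const-*ₚ u _) (OP.∷-cong (O.≈-trans (O.*-congˡ {u} Q₁-α) (Ideals.mk uQ′-n)) OP.≋-refl)))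
        (*∈ (u ∷ []) (resp
          (S.≈-trans (S.+-congʳ {S.- ((O.- α ∷ O.1# ∷ []) S.* q)} (S.≈-sym Q₁≈0))
            (Ideals.≈⇒≈[] (PolyRing.algebra O) I₁ (OX.≈-trans (OX.+-congʳ {OX.- ((O.- α ∷ O.1# ∷ []) OX.* q)} (OPP.synthetic-division Q₁ α))
              (OS.solve 2 (λ x y → x OS.:+ y OS.:- x OS.:= y) OX.≈-refl ((O.- α ∷ O.1# ∷ []) OX.* q) (OP.evalₚ Q₁ α ∷ [])))))
          (-∈ 0∈ (*∈ʳ (resp (Ideals.≈⇒≈[] (PolyRing.algebra O) I₁ difference) (neg∈ d)) q))))
      where
      q : List (List ℤ)
      q = OPP.synthetic Q₁ α
      Q₁≈0 : Q₁ S.≈ S.0#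
      Q₁≈0 = Ideals.∈⇒≈[]0 (PolyRing.algebra O) I₁ (OX.1# , OP.≋-sym (OP.*ₚ-identityˡ Q₁))
      difference : OP.-ₚ (root₁ OP.+ₚ OP.-ₚ root₂) OP.≋ O.- α ∷ O.1# ∷ []
      difference = OP.∷-cong (zero-case α) (OP.∷-cong one-case OP.≋-refl)
        where
        module SO = Solver O
        zero-case : ∀ a → O.- (a O.+ O.- O.0#) O.≈ O.- a
        zero-case a = SO.solve 1 (λ a → SO.:- (a SO.:+ SO.:- SO.con (+ 0)) SO.:= SO.:- a) O.≈-refl a
        one-case : O.- (O.- O.1#) O.≈ O.1#
        one-case = SO.solve 0 (SO.:- (SO.:- SO.con (+ 1)) SO.:= SO.con (+ 1)) O.≈-refl

-- Prime factors of the elements of a box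

argmax : ∀ {n} (y : Fin n → ℤ) → Nonzero y → ∃[ i ] y i ≢ + 0 × ∀ j → ∣ y j ∣ ≤ ∣ y i ∣
argmax {suc n} y nz = case nonzero? (y ∘ suc) of λ where
    (inj₂ all) → zero , head≢0 nz all , λ { zero → ℕ.≤-refl ; (suc j) → ℕ.≤-trans (ℕ.≤-reflexive (cong ∣_∣ (all j))) z≤n }
    (inj₁ nz′) → compare (argmax (y ∘ suc) nz′)
  where
  head≢0 : Nonzero y → (∀ i → y (suc i) ≡ + 0) → y zero ≢ + 0
  head≢0 (zero  , y≢0) all = y≢0
  head≢0 (suc i , y≢0) all = contradiction (all i) y≢0
  compare : (∃[ i ] y (suc i) ≢ + 0 × ∀ j → ∣ y (suc j) ∣ ≤ ∣ y (suc i) ∣) → ∃[ i ] y i ≢ + 0 × ∀ j → ∣ y j ∣ ≤ ∣ y i ∣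
  compare (i , y≢0 , max) = case ∣ y zero ∣ ℕ.≤? ∣ y (suc i) ∣ of λ where
    (yes ≤) → suc i , y≢0 , λ { zero → ≤ ; (suc j) → max j }
    (no  ≰) → zero
      , (λ y₀≡0 → contradiction (ℕ.≤-trans (ℕ.≤-reflexive (cong ∣_∣ y₀≡0)) z≤n) ≰)
      , λ { zero → ℕ.≤-refl ; (suc j) → ℕ.≤-trans (max j) (ℕ.<⇒≤ (ℕ.≰⇒> ≰)) }

-- `separation` amounts to n₀ ∈ (α - β); quantified over ideals, it passes to a quotient ring by
-- pulling ideals back.
record SeparatedRoots (Q : ℤ[x]) (A : ℤ-Algebra) : Set₁ where
  open ℤ-Algebra A
  open Ideals A using (Ideal; module Ideal)
  field
    α β        : Carrier
    isRoot-α   : PolyRing.evalₚ A (map ι Q) α ≈ 0#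
    isRoot-β   : PolyRing.evalₚ A (map ι Q) β ≈ 0#
    n₀         : ℤ
    n₀≢0       : n₀ ≢ + 0
    separation : ∀ J → Ideal._∈I J (α - β) → Ideal._∈I J (ι n₀)

module PrimeFactors (Ans : Set) (Q : ℤ[x]) (A : ℤ-Algebra) (fg : FinitelyGenerated A)
  (orderLike : Lattices.OrderLike Ans A) (L : Lattices.Lattice Ans A) (separatedRoots : SeparatedRoots Q A) where
  open ℤ-Algebra A
  open Ideals A using (Ideal; module Ideal; principal)
  open SeparatedRoots separatedRoots
  open Classical Ans
  open Lattices Ans A using (Incongruent; module Lattice; module OrderLike; module LatticeProperties)
  open Lattice L
  open OrderLike orderLike
  open LatticeProperties orderLike L
  open Combinations A
  open GeneratorCoordinates A fg using (rank; residue-pigeonhole)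
  open PrimeIdeals Ans A
  open Solver A
  open SetoidReasoning setoid

  -- Multiplication by a vector of size Y enlarges coordinates at most D²ΓY times, up to the factor
  -- Δ, and Ω bounds the coordinates of Δ · 1. The shift M κ Y must outweigh both.
  Ω κ : ℕ
  Ω = proj₁ (maxOf λ i → ∣ coordΔ 1# i ∣)
  κ = D ℕ.* (D ℕ.* Γ) ℕ.+ Ω

  sizeConstant : ℕ
  sizeConstant = indexConstant ℕ.* (suc κ ℕ.* Ω ℕ.+ ∣ Δ ∣)

  1≉0 : 1# ≈ 0# → Ans
  1≉0 1≈0 = char0 {+ 1} (λ ()) (≈-trans ι-1 1≈0)

  module Box (M Y : ℕ) (1≤M : 1 ≤ M) (1≤Y : 1 ≤ Y) where

    shift : ℕ
    shift = suc (M ℕ.* (κ ℕ.* Y))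

    -- The integer part dominates the box, so that multiplication by an element expands the lattice.
    element : (Fin D → ℤ) → Carrier
    element t = ι (+ shift) + ι (+ M) * comb t e

    private
      dominate : ∀ a m X → 1 ≤ a → 1 ≤ m → a ℕ.* Ω ℕ.+ M ℕ.* (m ℕ.* (X ℕ.* Y)) < a ℕ.* suc (M ℕ.* ((X ℕ.+ Ω) ℕ.* Y)) ℕ.* m
      dominate a m X 1≤a 1≤m = ℕ.≤-trans
        (ℕ.+-mono-≤ (ℕ.*-mono-≤ 1≤a 1≤m) (ℕ.+-mono-≤
          (ℕ.≤-trans (ℕ.≤-reflexive (≡.sym (ℕ.*-identityʳ (a ℕ.* Ω)))) (ℕ.*-monoʳ-≤ (a ℕ.* Ω) (ℕ.*-mono-≤ 1≤m (ℕ.*-mono-≤ 1≤M 1≤Y))))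
          (ℕ.≤-trans (ℕ.≤-reflexive (≡.sym (ℕ.*-identityˡ (M ℕ.* (m ℕ.* (X ℕ.* Y)))))) (ℕ.*-monoˡ-≤ (M ℕ.* (m ℕ.* (X ℕ.* Y))) 1≤a))))
        (ℕ.≤-reflexive (identity a m M Y X Ω))
        where
        identity : ∀ a m M Y X Ω → a ℕ.* m ℕ.+ (a ℕ.* Ω ℕ.* (m ℕ.* (M ℕ.* Y)) ℕ.+ a ℕ.* (M ℕ.* (m ℕ.* (X ℕ.* Y)))) ≡
                                   a ℕ.* suc (M ℕ.* ((X ℕ.+ Ω) ℕ.* Y)) ℕ.* m
        identity = ℕSolver.solve-∀

    -- The case ε = 0, v = 1 shows that the element is nonzero, the case ε = 1 that it is not a
    -- unit. In the place of the largest coordinate of Δ v, the contribution of the shift exceeds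
    -- all the others together.
    no-small-multiple : ∀ t → (∀ d → ∣ t d ∣ ≤ Y) → ∀ v → (v ≈ 0# → Ans) → ∀ ε → ∣ ε ∣ ≤ 1 → element t * v ≈ ι ε → Ans
    no-small-multiple t t≤Y v v≉0 ε ε≤1 bv≈ε = case nonzero? y of λ where
        (inj₂ all) → torsionFree Δ≢0 (≈-trans (coordΔ-spec v) (≈-trans (comb-cong e all) (comb-0 e))) v≉0
        (inj₁ nz)  → comb-injective {λ i → Δ ℤ.* + shift ℤ.* y i ℤ.+ + M ℤ.* mulΔ y t i} {λ i → Δ ℤ.* ε ℤ.* o i} coordinates
          λ eq → contradiction (too-large nz eq) (λ ())
      where
      y o : Fin D → ℤ
      y = coordΔ v
      o = coordΔ 1#
      coordinates : comb (λ i → Δ ℤ.* + shift ℤ.* y i ℤ.+ + M ℤ.* mulΔ y t i) e ≈ comb (λ i → Δ ℤ.* ε ℤ.* o i) e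
      coordinates = begin
        comb (λ i → Δ ℤ.* + shift ℤ.* y i ℤ.+ + M ℤ.* mulΔ y t i) e
          ≈⟨ comb-+ (λ i → Δ ℤ.* + shift ℤ.* y i) (λ i → + M ℤ.* mulΔ y t i) e ⟩
        comb (λ i → Δ ℤ.* + shift ℤ.* y i) e + comb (λ i → + M ℤ.* mulΔ y t i) e
          ≈⟨ +-cong (≈-trans (comb-* (Δ ℤ.* + shift) y e) (*-cong (ι-* Δ (+ shift)) (≈-sym (coordΔ-spec v))))
                    (≈-trans (comb-* (+ M) (mulΔ y t) e) (*-congˡ (≈-trans (mulΔ-spec y t) (*-congˡ (*-congʳ (≈-sym (coordΔ-spec v))))))) ⟩
        (ι Δ * ι (+ shift)) * (ι Δ * v) + ι (+ M) * (ι Δ * ((ι Δ * v) * comb t e))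
          ≈⟨ solve 5 (λ Δ s v M t → (Δ :* s) :* (Δ :* v) :+ M :* (Δ :* ((Δ :* v) :* t)) := (Δ :* Δ) :* ((s :+ M :* t) :* v))
               ≈-refl (ι Δ) (ι (+ shift)) v (ι (+ M)) (comb t e) ⟩
        (ι Δ * ι Δ) * (element t * v)     ≈⟨ *-congˡ bv≈ε ⟩
        (ι Δ * ι Δ) * ι ε                 ≈⟨ solve 2 (λ Δ ε → (Δ :* Δ) :* ε := (Δ :* ε) :* (Δ :* con (+ 1))) ≈-refl (ι Δ) (ι ε) ⟩
        (ι Δ * ι ε) * (ι Δ * 1#)          ≈⟨ *-cong (≈-sym (ι-* Δ ε)) (coordΔ-spec 1#) ⟩
        ι (Δ ℤ.* ε) * comb o e            ≈⟨ comb-* (Δ ℤ.* ε) o e ⟨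
        comb (λ i → Δ ℤ.* ε ℤ.* o i) e    ∎
      too-large : Nonzero y → (∀ i → Δ ℤ.* + shift ℤ.* y i ℤ.+ + M ℤ.* mulΔ y t i ≡ Δ ℤ.* ε ℤ.* o i) → ⊥
      too-large nz eq = ℕ.<⇒≱ (dominate ∣ Δ ∣ ∣ y i ∣ (D ℕ.* (D ℕ.* Γ)) (positive Δ≢0) (positive yᵢ≢0)) (R.begin
          ∣ Δ ∣ ℕ.* shift ℕ.* ∣ y i ∣                         R.≡⟨ cong (ℕ._* ∣ y i ∣) (ℤ.∣i*j∣≡∣i∣*∣j∣ Δ (+ shift)) ⟨
          ∣ Δ ℤ.* + shift ∣ ℕ.* ∣ y i ∣                       R.≡⟨ ℤ.∣i*j∣≡∣i∣*∣j∣ (Δ ℤ.* + shift) (y i) ⟨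
          ∣ Δ ℤ.* + shift ℤ.* y i ∣                           R.≡⟨ cong ∣_∣ (isolate (Δ ℤ.* + shift ℤ.* y i) (+ M ℤ.* mulΔ y t i) (eq i)) ⟩
          ∣ Δ ℤ.* ε ℤ.* o i ℤ.- + M ℤ.* mulΔ y t i ∣          R.≤⟨ ℤ.∣i-j∣≤∣i∣+∣j∣ (Δ ℤ.* ε ℤ.* o i) (+ M ℤ.* mulΔ y t i) ⟩
          ∣ Δ ℤ.* ε ℤ.* o i ∣ ℕ.+ ∣ + M ℤ.* mulΔ y t i ∣
            R.≡⟨ cong₂ ℕ._+_ (≡.trans (ℤ.∣i*j∣≡∣i∣*∣j∣ (Δ ℤ.* ε) (o i)) (cong (ℕ._* ∣ o i ∣) (ℤ.∣i*j∣≡∣i∣*∣j∣ Δ ε))) (ℤ.∣i*j∣≡∣i∣*∣j∣ (+ M) (mulΔ y t i)) ⟩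
          ∣ Δ ∣ ℕ.* ∣ ε ∣ ℕ.* ∣ o i ∣ ℕ.+ M ℕ.* ∣ mulΔ y t i ∣
            R.≤⟨ ℕ.+-mono-≤ (ℕ.*-mono-≤ (ℕ.≤-trans (ℕ.*-monoʳ-≤ ∣ Δ ∣ ε≤1) (ℕ.≤-reflexive (ℕ.*-identityʳ ∣ Δ ∣))) (proj₂ (maxOf λ i → ∣ o i ∣) i))
                            (ℕ.*-monoʳ-≤ M (ℕ.≤-trans (∣mulΔ∣≤ {y} {t} max t≤Y i) (ℕ.≤-reflexive (rearrange D ∣ y i ∣ Y Γ)))) ⟩
          ∣ Δ ∣ ℕ.* Ω ℕ.+ M ℕ.* (∣ y i ∣ ℕ.* (D ℕ.* (D ℕ.* Γ) ℕ.* Y)) R.∎)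
        where
        module R = ℕ.≤-Reasoning
        i : Fin D
        i = proj₁ (argmax y nz)
        yᵢ≢0 : y i ≢ + 0
        yᵢ≢0 = proj₁ (proj₂ (argmax y nz))
        max : ∀ j → ∣ y j ∣ ≤ ∣ y i ∣
        max = proj₂ (proj₂ (argmax y nz))
        positive : ∀ {x} → x ≢ + 0 → 1 ≤ ∣ x ∣
        positive x≢0 = ℕ.n≢0⇒n>0 (x≢0 ∘ ℤ.∣i∣≡0⇒i≡0)
        isolate : ∀ u w {v} → u ℤ.+ w ≡ v → u ≡ v ℤ.- w
        isolate u w eq = ≡.trans (cancel u w) (cong (ℤ._- w) eq)
          where
          cancel : ∀ u w → u ≡ (u ℤ.+ w) ℤ.- w
          cancel = ℤSolver.solve-∀
        rearrange : ∀ D m Y Γ → D ℕ.* (m ℕ.* (D ℕ.* (Y ℕ.* Γ))) ≡ m ℕ.* (D ℕ.* (D ℕ.* Γ) ℕ.* Y)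
        rearrange = ℕSolver.solve-∀

    scaled : (Fin D → ℤ) → Fin D → ℤ
    scaled t i = + shift ℤ.* coordΔ 1# i ℤ.+ + M ℤ.* (Δ ℤ.* t i)

    scaled-spec : ∀ t → comb (scaled t) e ≈ ι Δ * element t
    scaled-spec t = begin
      comb (scaled t) e ≈⟨ comb-+ (λ i → + shift ℤ.* coordΔ 1# i) (λ i → + M ℤ.* (Δ ℤ.* t i)) e ⟩
      comb (λ i → + shift ℤ.* coordΔ 1# i) e + comb (λ i → + M ℤ.* (Δ ℤ.* t i)) e
        ≈⟨ +-cong (≈-trans (comb-* (+ shift) (coordΔ 1#) e) (*-congˡ (≈-sym (coordΔ-spec 1#))))
                  (≈-trans (comb-* (+ M) (λ i → Δ ℤ.* t i) e) (*-congˡ (comb-* Δ t e))) ⟩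
      ι (+ shift) * (ι Δ * 1#) + ι (+ M) * (ι Δ * comb t e)
        ≈⟨ solve 4 (λ s Δ M t → s :* (Δ :* con (+ 1)) :+ M :* (Δ :* t) := Δ :* (s :+ M :* t)) ≈-refl (ι (+ shift)) (ι Δ) (ι (+ M)) (comb t e) ⟩
      ι Δ * element t ∎

    -- Bounds the number of residue classes of any ideal that contains an element of the box, and
    -- with it the primes over which the count runs.
    index≤ : ∀ t → (∀ d → ∣ t d ∣ ≤ Y) → ∀ J → Ideal._∈I J (element t) → ∀ {N} (w : Fin N → Carrier) →
             Incongruent J w → (sizeConstant ℕ.* (M ℕ.* Y)) ^ D < N → Ans
    index≤ t t≤Y J b∈J {N} w incong small = case nonzero? (scaled t) of λ where
        (inj₂ all) → torsionFree Δ≢0 (≈-trans (≈-sym (scaled-spec t)) (≈-trans (comb-cong e all) (comb-0 e))) λ b≈0 →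
          no-small-multiple t t≤Y 1# 1≉0 (+ 0) z≤n (≈-trans (*-identityʳ (element t)) (≈-trans b≈0 (≈-sym ι-0)))
        (inj₁ nz)  → indexBound J (scaled t) B 1≤B nz scaled≤B (Ideal.resp J (≈-sym (scaled-spec t)) (Ideal.*∈ J (ι Δ) b∈J)) w incong
          (subst (λ x → x ^ D < N) (ℕ.*-assoc indexConstant (suc κ ℕ.* Ω ℕ.+ ∣ Δ ∣) (M ℕ.* Y)) small)
      where
      B : ℕ
      B = (suc κ ℕ.* Ω ℕ.+ ∣ Δ ∣) ℕ.* (M ℕ.* Y)
      1≤B : 1 ≤ B
      1≤B = ℕ.*-mono-≤ (ℕ.≤-trans (ℕ.n≢0⇒n>0 (Δ≢0 ∘ ℤ.∣i∣≡0⇒i≡0)) (ℕ.m≤n+m ∣ Δ ∣ (suc κ ℕ.* Ω))) (ℕ.*-mono-≤ 1≤M 1≤Y)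
      shift≤ : shift ≤ suc κ ℕ.* (M ℕ.* Y)
      shift≤ = ℕ.≤-trans (ℕ.+-monoˡ-≤ (M ℕ.* (κ ℕ.* Y)) (ℕ.*-mono-≤ 1≤M 1≤Y)) (ℕ.≤-reflexive (identity M κ Y))
        where
        identity : ∀ M κ Y → M ℕ.* Y ℕ.+ M ℕ.* (κ ℕ.* Y) ≡ suc κ ℕ.* (M ℕ.* Y)
        identity = ℕSolver.solve-∀
      scaled≤B : ∀ i → ∣ scaled t i ∣ ≤ B
      scaled≤B i = ℕ.≤-trans (ℤ.∣i+j∣≤∣i∣+∣j∣ (+ shift ℤ.* coordΔ 1# i) (+ M ℤ.* (Δ ℤ.* t i)))
        (ℕ.≤-trans (ℕ.+-mono-≤
            (ℕ.≤-trans (ℕ.≤-reflexive (ℤ.∣i*j∣≡∣i∣*∣j∣ (+ shift) (coordΔ 1# i))) (ℕ.*-mono-≤ shift≤ (proj₂ (maxOf λ i → ∣ coordΔ 1# i ∣) i)))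
            (ℕ.≤-trans (ℕ.≤-reflexive (≡.trans (ℤ.∣i*j∣≡∣i∣*∣j∣ (+ M) (Δ ℤ.* t i)) (cong (M ℕ.*_) (ℤ.∣i*j∣≡∣i∣*∣j∣ Δ (t i)))))
              (ℕ.*-monoʳ-≤ M (ℕ.*-monoʳ-≤ ∣ Δ ∣ (t≤Y i)))))
          (ℕ.≤-reflexive (identity κ M Y Ω ∣ Δ ∣)))
        where
        identity : ∀ κ M Y Ω Δ → suc κ ℕ.* (M ℕ.* Y) ℕ.* Ω ℕ.+ M ℕ.* (Δ ℕ.* Y) ≡ (suc κ ℕ.* Ω ℕ.+ Δ) ℕ.* (M ℕ.* Y)
        identity = ℕSolver.solve-∀

  record PrimeFactor (p : ℕ) (x : Carrier) : Set₁ where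
    field
      isPrime : Prime p
      𝔮       : Ideal
      x∈      : Ideal._∈I 𝔮 x
      p∈      : Ideal._∈I 𝔮 (ι (+ p))
      proper  : Proper 𝔮
      prime𝔮  : Prime-ideal 𝔮
    open Ideal 𝔮 public

    multiple∈ : ∀ {m} → + p ℤ.∣ m → ι m ∈I
    multiple∈ (ℤ.divides k refl) = resp (≈-sym (ι-* k (+ p))) (*∈ (ι k) p∈)

    integer∈⇒∣ : ∀ {m} → ι m ∈I → Cl (+ p ℤ.∣ m)
    integer∈⇒∣ {m} m∈ k = case + p ℤ.∣? m of λ where
        (yes p∣m) → k p∣m
        (no  p∤m) → invertible (modular-inverse isPrime m p∤m)
      where
      invertible : ∃[ y ] + p ℤ.∣ m ℤ.* y ℤ.- + 1 → Ans
      invertible (y , p∣my-1) = proper (resp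
        (begin
          ι m * ι y - ι (m ℤ.* y ℤ.- + 1) ≈⟨ +-congʳ (ι-* m y) ⟨
          ι (m ℤ.* y) - ι (m ℤ.* y ℤ.- + 1) ≈⟨ +-congˡ (-‿cong (≈-trans (ι-+ (m ℤ.* y) (ℤ.- + 1)) (+-congˡ (≈-trans (ι-‿ (+ 1)) (-‿cong ι-1))))) ⟩
          ι (m ℤ.* y) - (ι (m ℤ.* y) - 1#) ≈⟨ solve 1 (λ x → x :- (x :- con (+ 1)) := con (+ 1)) ≈-refl (ι (m ℤ.* y)) ⟩
          1# ∎)
        (-∈ (*∈ʳ m∈ (ι y)) (multiple∈ p∣my-1)))

    small-integers : Incongruent {p} 𝔮 (λ u → ι (+ toℕ u))
    small-integers u u′ u≢u′ d = integer∈⇒∣ {+ toℕ u ℤ.- + toℕ u′}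
      (resp (≈-sym (≈-trans (ι-+ (+ toℕ u) (ℤ.- + toℕ u′)) (+-congˡ (ι-‿ (+ toℕ u′))))) d)
      λ p∣u-u′ → contradiction (Fin.toℕ-injective (residue-unique (Fin.toℕ<n u) (Fin.toℕ<n u′) p∣u-u′)) u≢u′

    quadratic : Carrier → Fin (p ℕ.* p) → Carrier
    quadratic w i = let (v , u) = Fin.remQuot {p} p i in ι (+ toℕ u) + ι (+ toℕ v) * w

    -- If u + v w ≡ u′ + v′ w with v ≠ v′, then dividing by v - v′ modulo p makes w congruent to an
    -- integer.
    quadratic-incongruent : ∀ w → (∀ r → w - ι r ∈I → Ans) → Incongruent 𝔮 (quadratic w)
    quadratic-incongruent w irrational i j i≢j d = case v Fin.≟ v′ of λ where
        (yes v≡v′) → small-integers u u′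
          (λ u≡u′ → i≢j (≡.trans (≡.sym (Fin.combine-remQuot {p} p i)) (≡.trans (cong₂ Fin.combine v≡v′ u≡u′) (Fin.combine-remQuot {p} p j))))
          (resp (same-v v≡v′) d)
        (no  v≢v′) → invertible (modular-inverse isPrime (+ toℕ v ℤ.- + toℕ v′)
          (λ p∣ → v≢v′ (Fin.toℕ-injective (residue-unique (Fin.toℕ<n v) (Fin.toℕ<n v′) p∣))))
      where
      v u v′ u′ : Fin p
      v  = proj₁ (Fin.remQuot {p} p i)
      u  = proj₂ (Fin.remQuot {p} p i)
      v′ = proj₁ (Fin.remQuot {p} p j)
      u′ = proj₂ (Fin.remQuot {p} p j)
      U V U′ V′ : ℤ
      U = + toℕ u
      V = + toℕ v
      U′ = + toℕ u′
      V′ = + toℕ v′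
      same-v : v ≡ v′ → (ι U + ι V * w) - (ι U′ + ι V′ * w) ≈ ι U - ι U′
      same-v v≡v′ = ≈-trans (+-congˡ (-‿cong (+-congˡ (*-congʳ (ι-cong (cong (+_ ∘ toℕ) (≡.sym v≡v′)))))))
        (solve 4 (λ u v u′ w → (u :+ v :* w) :- (u′ :+ v :* w) := u :- u′) ≈-refl (ι U) (ι V) (ι U′) w)
      invertible : ∃[ y ] + p ℤ.∣ (V ℤ.- V′) ℤ.* y ℤ.- + 1 → Ans
      invertible (y , p∣) = irrational (ℤ.- ((U ℤ.- U′) ℤ.* y)) (resp
        (begin
          ι y * ((ι U + ι V * w) - (ι U′ + ι V′ * w)) - w * ι ((V ℤ.- V′) ℤ.* y ℤ.- + 1)
            ≈⟨ +-congˡ (-‿cong (*-congˡ (≈-trans (ι-+ ((V ℤ.- V′) ℤ.* y) (ℤ.- + 1)) (+-cong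
                 (≈-trans (ι-* (V ℤ.- V′) y) (*-congʳ (≈-trans (ι-+ V (ℤ.- V′)) (+-congˡ (ι-‿ V′)))))
                 (≈-trans (ι-‿ (+ 1)) (-‿cong ι-1)))))) ⟩
          ι y * ((ι U + ι V * w) - (ι U′ + ι V′ * w)) - w * ((ι V - ι V′) * ι y - 1#)
            ≈⟨ solve 6 (λ y U V U′ V′ w → y :* ((U :+ V :* w) :- (U′ :+ V′ :* w)) :- w :* ((V :- V′) :* y :- con (+ 1)) :=
                 w :- :- ((U :- U′) :* y)) ≈-refl (ι y) (ι U) (ι V) (ι U′) (ι V′) w ⟩
          w - - ((ι U - ι U′) * ι y)
            ≈⟨ +-congˡ (-‿cong (≈-trans (ι-‿ ((U ℤ.- U′) ℤ.* y)) (-‿cong (≈-trans (ι-* (U ℤ.- U′) y) (*-congʳ (≈-trans (ι-+ U (ℤ.- U′)) (+-congˡ (ι-‿ U′)))))))) ⟨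
          w - ι (ℤ.- ((U ℤ.- U′) ℤ.* y)) ∎)
        (-∈ (*∈ (ι y) d) (*∈ w (multiple∈ p∣))))

    root∈ : ∀ {γ r} → PolyRing.evalₚ A (map ι Q) γ ≈ 0# → γ - ι r ∈I → Cl (+ p ℤ.∣ eval Q r)
    root∈ {γ} {r} γ-root d = integer∈⇒∣ (resp
      (begin
        f γ - (γ - ι r) * g ≈⟨ +-congʳ (PolyProperties.evalₚ-factor A (map ι Q) (ι r) γ) ⟩
        ((γ - ι r) * g + f (ι r)) - (γ - ι r) * g ≈⟨ solve 2 (λ x y → (x :+ y) :- x := y) ≈-refl ((γ - ι r) * g) (f (ι r)) ⟩
        f (ι r)                          ≈⟨ ScalarExtension.evalₚ-ι A Q r ⟩
        ι (eval Q r) ∎)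
      (-∈ (resp (≈-sym γ-root) 0∈) (*∈ʳ d g)))
      where
      f : Carrier → Carrier
      f = PolyRing.evalₚ A (map ι Q)
      g : Carrier
      g = PolyRing.evalₚ A (PolyProperties.synthetic A (map ι Q) (ι r)) γ

    -- Only lower bounds on the number of classes are claimed: more classes mean fewer box elements
    -- in the ideal.
    ResidueSize : Set
    ResidueSize = TwoRoots Q p × (∃[ w ] Incongruent {p} 𝔮 w) ⊎ (∃[ w ] Incongruent {p ℕ.* p} 𝔮 w)

    residueSize : ∣ n₀ ∣ < p → Cl ResidueSize
    residueSize n₀<p k = lem (∃[ r ] α - ι r ∈I) λ where
      (inj₂ irrational) → k (inj₂ (quadratic α , quadratic-incongruent α λ r d → irrational (r , d)))
      (inj₁ (r , α≡r)) → lem (∃[ s ] β - ι s ∈I) λ where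
        (inj₂ irrational) → k (inj₂ (quadratic β , quadratic-incongruent β λ s d → irrational (s , d)))
        (inj₁ (s , β≡s)) → root∈ isRoot-α α≡r λ p∣Qr → root∈ isRoot-β β≡s λ p∣Qs →
          case + p ℤ.∣? r ℤ.- s of λ where
            (no  p∤r-s) → k (inj₁ ((isPrime , r , s , p∣Qr , p∣Qs , p∤r-s) , (λ u → ι (+ toℕ u)) , small-integers))
            (yes p∣r-s) → integer∈⇒∣ (separation 𝔮 (resp
              (≈-trans (+-congˡ (≈-trans (ι-+ r (ℤ.- s)) (+-congˡ (ι-‿ s))))
                (solve 4 (λ a b r s → ((a :- r) :- (b :- s)) :+ (r :- s) := a :- b) ≈-refl α β (ι r) (ι s)))
              (+∈ (-∈ α≡r β≡s) (multiple∈ p∣r-s))))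
              λ p∣n₀ → contradiction (ℕ.∣⇒≤ ⦃ ℕ.≢-nonZero (n₀≢0 ∘ ℤ.∣i∣≡0⇒i≡0) ⦄ (∣ℤ⇒∣ p∣n₀)) (ℕ.<⇒≱ n₀<p)

  prime∈ : ∀ 𝔮 → Proper 𝔮 → Prime-ideal 𝔮 → ∀ {n} → n ≢ + 0 → Ideal._∈I 𝔮 (ι n) →
           Cl (∃[ p ] Prime p × Ideal._∈I 𝔮 (ι (+ p)))
  prime∈ 𝔮 proper prime𝔮 {n} n≢0 n∈ K =
    conclude (Factorisation.factorise ∣ n ∣ ⦃ ℕ.≢-nonZero (n≢0 ∘ ℤ.∣i∣≡0⇒i≡0) ⦄)
    where
    open Ideal 𝔮
    abs∈ : ∀ n → ι n ∈I → ι (+ ∣ n ∣) ∈I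
    abs∈ (+ n)    n∈ = n∈
    abs∈ -[1+ n ] n∈ = resp (≈-sym (ι-‿ -[1+ n ])) (neg∈ n∈)
    search : ∀ qs → All Prime qs → ι (+ ℕ.product qs) ∈I → Ans
    search []       []            1∈ = proper (resp ι-1 1∈)
    search (q ∷ qs) (pr ∷ primes) d  = prime𝔮 (ι (+ q)) (ι (+ ℕ.product qs))
      (resp (≈-trans (ι-cong (ℤ.pos-* q (ℕ.product qs))) (ι-* (+ q) (+ ℕ.product qs))) d) λ where
        (inj₁ q∈) → K (q , pr , q∈)
        (inj₂ r∈) → search qs primes r∈
    conclude : Factorisation.PrimeFactorisation ∣ n ∣ → Ans
    conclude record { factors = qs ; isFactorisation = eq ; factorsPrime = primes } =
      search qs primes (subst (λ m → ι (+ m) ∈I) eq (abs∈ n n∈))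

  -- As x divides an integer n ≠ 0, A/(x) has at most ∣n∣^rank elements, and this finiteness is the
  -- measure for the search of a prime ideal.
  primeFactor : ∀ x → (x ≈ 0# → Ans) → (∀ h → h * x ≈ 1# → Ans) → Cl (∃[ p ] PrimeFactor p x)
  primeFactor x x≉0 nonunit K = invert x λ where
    (inj₁ x≈0) → x≉0 x≈0
    (inj₂ (u , n , n≢0 , ux≈n)) → primeIdeal-proper (suc (∣ n ∣ ^ rank)) (principal x)
      (λ w k → case residue-pigeonhole n n≢0 (ℕ.n<1+n _) w of λ (i , j , i≢j , h , eq) → k (i , j , i≢j , u * h ,
        (begin
          w i - w j     ≈⟨ eq ⟩
          ι n * h       ≈⟨ *-congʳ ux≈n ⟨
          u * x * h     ≈⟨ solve 3 (λ u x h → u :* x :* h := u :* h :* x) ≈-refl u x h ⟩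
          u * h * x     ∎)))
      (λ (h , 1≈hx) → nonunit h (≈-sym 1≈hx))
      λ (𝔮 , x⊑𝔮 , proper , prime𝔮) → let open Ideal 𝔮 in
        prime∈ 𝔮 proper prime𝔮 n≢0 (x⊑𝔮 (u , ≈-sym ux≈n)) λ (p , pr , p∈) → K (p , record
          { isPrime = pr ; 𝔮 = 𝔮 ; x∈ = x⊑𝔮 (1# , ≈-sym (*-identityˡ x)) ; p∈ = p∈ ; proper = proper ; prime𝔮 = prime𝔮 })

  horner : ∀ {m} → (Fin m → Carrier) → (Fin m → ℤ) → Carrier
  horner {zero}  b u = 0#
  horner {suc m} b u = ι (u zero) + b zero * horner (b ∘ suc) (u ∘ suc)

  -- If bⱼ lies in the j-th prime ideal only, the digits of u₀ + b₀ (u₁ + b₁ (…)) modulo p can be read off in turn.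
  horner-digits : ∀ {m p} (b : Fin m → Carrier) (F : ∀ j → PrimeFactor p (b j)) →
                  (∀ i j → i ≢ j → PrimeFactor._∈I (F i) (b j) → Ans) →
                  ∀ c → (∀ j → PrimeFactor._∈I (F j) c → Ans) →
                  ∀ u u′ g → c * (horner b u - horner b u′) ≈ ι (+ p) * g → Cl (∀ j → + p ℤ.∣ u j ℤ.- u′ j)
  horner-digits {zero}  b F off c c∉ u u′ g eq K = K λ ()
  horner-digits {suc m} {p} b F off c c∉ u u′ g eq K =
    F₀.prime𝔮 c (ι (u zero ℤ.- u′ zero)) (F₀.resp
      (begin
        ι (+ p) * g - b zero * (c * (h - h′)) ≈⟨ +-congʳ eq ⟨
        c * ((ι (u zero) + b zero * h) - (ι (u′ zero) + b zero * h′)) - b zero * (c * (h - h′))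
          ≈⟨ solve 6 (λ c u u′ b h h′ → c :* ((u :+ b :* h) :- (u′ :+ b :* h′)) :- b :* (c :* (h :- h′)) := c :* (u :- u′))
               ≈-refl c (ι (u zero)) (ι (u′ zero)) (b zero) h h′ ⟩
        c * (ι (u zero) - ι (u′ zero)) ≈⟨ *-congˡ ι-difference ⟨
        c * ι (u zero ℤ.- u′ zero) ∎)
      (F₀.-∈ (F₀.*∈ʳ F₀.p∈ g) (F₀.*∈ʳ F₀.x∈ (c * (h - h′))))) λ where
      (inj₁ c∈) → c∉ zero c∈
      (inj₂ d∈) → F₀.integer∈⇒∣ d∈ λ p∣d@(ℤ.divides k d≡kp) →
        horner-digits (b ∘ suc) (F ∘ suc) (λ i j i≢j → off (suc i) (suc j) (i≢j ∘ Fin.suc-injective))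
          (c * b zero) (λ j cb∈ → PrimeFactor.prime𝔮 (F (suc j)) c (b zero) cb∈ λ where
            (inj₁ c∈) → c∉ (suc j) c∈
            (inj₂ b∈) → off (suc j) zero (λ ()) b∈)
          (u ∘ suc) (u′ ∘ suc) (g - c * ι k)
          (begin
            c * b zero * (h - h′)
              ≈⟨ solve 6 (λ c u u′ b h h′ → c :* b :* (h :- h′) := c :* ((u :+ b :* h) :- (u′ :+ b :* h′)) :- c :* (u :- u′))
                   ≈-refl c (ι (u zero)) (ι (u′ zero)) (b zero) h h′ ⟩
            c * (horner b u - horner b u′) - c * (ι (u zero) - ι (u′ zero))
              ≈⟨ +-cong eq (-‿cong (*-congˡ (≈-trans (≈-sym ι-difference) (≈-trans (ι-cong d≡kp) (ι-* k (+ p)))))) ⟩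
            ι (+ p) * g - c * (ι k * ι (+ p))
              ≈⟨ solve 4 (λ p g c k → p :* g :- c :* (k :* p) := p :* (g :- c :* k)) ≈-refl (ι (+ p)) g c (ι k) ⟩
            ι (+ p) * (g - c * ι k) ∎)
          λ rest → K λ { zero → p∣d ; (suc j) → rest j }
    where
    module F₀ = PrimeFactor (F zero)
    h h′ : Carrier
    h  = horner (b ∘ suc) (u ∘ suc)
    h′ = horner (b ∘ suc) (u′ ∘ suc)
    ι-difference : ι (u zero ℤ.- u′ zero) ≈ ι (u zero) - ι (u′ zero)
    ι-difference = ≈-trans (ι-+ (u zero) (ℤ.- u′ zero)) (+-congˡ (ι-‿ (u′ zero)))

  -- At most rank A of the prime ideals over p can be told apart by elements, since |A/pA| = p^rank.
  few-primes : ∀ {p} → Prime p → (b : Fin (suc rank) → Carrier) (F : ∀ j → PrimeFactor p (b j)) →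
               (∀ i j → i ≢ j → PrimeFactor._∈I (F i) (b j) → Ans) → Ans
  few-primes {p} pr b F off = collide (residue-pigeonhole (+ p) p≢0 {p ^ suc rank} small (λ i → horner b (u i)))
    where
    p≢0 : + p ≢ + 0
    p≢0 refl = ℕ.¬prime[0] pr
    instance
      p-nonZero : NonZero p
      p-nonZero = ℕ.prime⇒nonZero pr
    small : p ^ rank < p ^ suc rank
    small = ℕ.^-monoʳ-< p (ℕ.nonTrivial⇒n>1 p ⦃ ℕ.prime⇒nonTrivial pr ⦄) (ℕ.n<1+n rank)
    u : Fin (p ^ suc rank) → Fin (suc rank) → ℤ
    u i j = + digits {p} {suc rank} i j
    collide : (∃₂ λ i j → i ≢ j × ∃[ h ] horner b (u i) - horner b (u j) ≈ ι (+ p) * h) → Ans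
    collide (i , j , i≢j , h , eq) = horner-digits b F off 1# (λ k 1∈ → PrimeFactor.proper (F k) 1∈) (u i) (u j) h
      (≈-trans (*-identityˡ _) eq)
      λ same → contradiction (digits-injective {p} {suc rank} λ d → residue-unique
        (Fin.toℕ<n (Fin.finToFun {p} {suc rank} i d)) (Fin.toℕ<n (Fin.finToFun {p} {suc rank} j d)) (same d)) i≢j

-- Pigeonholes with capacities, cells of a box, and sums over primes

module _ {A B : Set} (_≟_ : (x y : B) → Dec (x ≡ y)) (σ : A → B) (w : B → ℕ) {ℓ} {R : A → A → Set} {P : A → Set ℓ} where
  private
    filter-lengths : ∀ b xs → length (List.filter (λ x → σ x ≟ b) xs) ℕ.+ length (List.filter (λ x → ¬? (σ x ≟ b)) xs) ≡ length xs
    filter-lengths b []       = refl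
    filter-lengths b (x ∷ xs) with σ x ≟ b
    ... | yes _ = cong suc (filter-lengths b xs)
    ... | no  _ = ≡.trans (ℕ.+-suc _ _) (cong suc (filter-lengths b xs))

  -- w is the capacity of a hole. R and P travel along so that the members of the overfull hole are
  -- still known to be distinct and of the required kind.
  weighted-pigeonhole : ∀ bs xs → AllPairs R xs → All P xs → All (λ x → σ x ∈ bs) xs → ℕ.sum (map w bs) < length xs →
                        ∃₂ λ b ys → AllPairs R ys × All P ys × All (λ y → σ y ≡ b) ys × w b < length ys
  weighted-pigeonhole []       (x ∷ xs) _     _  (() ∷ _) _
  weighted-pigeonhole (b ∷ bs) xs       pairs ps σ∈       many =
    case w b ℕ.<? length (List.filter (λ x → σ x ≟ b) xs) of λ where
      (yes crowded) → b , List.filter (λ x → σ x ≟ b) xs , AllPairs.filter⁺ (λ x → σ x ≟ b) pairs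
        , All.filter⁺ (λ x → σ x ≟ b) ps , All.all-filter (λ x → σ x ≟ b) xs , crowded
      (no  sparse)  → weighted-pigeonhole bs (List.filter (λ x → ¬? (σ x ≟ b)) xs) (AllPairs.filter⁺ (λ x → ¬? (σ x ≟ b)) pairs)
        (All.filter⁺ (λ x → ¬? (σ x ≟ b)) ps)
        (All.zipWith (λ { (σ≢b , here σ≡b) → contradiction σ≡b σ≢b ; (σ≢b , there σ∈bs) → σ∈bs })
          (All.all-filter (λ x → ¬? (σ x ≟ b)) xs , All.filter⁺ (λ x → ¬? (σ x ≟ b)) σ∈))
        (ℕ.+-cancelˡ-< (w b) _ _ (ℕ.<-≤-trans many (ℕ.≤-trans (ℕ.≤-reflexive (≡.sym (filter-lengths b xs)))
          (ℕ.+-monoˡ-≤ _ (ℕ.≮⇒≥ sparse)))))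

m≤m^n : ∀ m {n} → 1 ≤ m → 1 ≤ n → m ≤ m ^ n
m≤m^n m {suc n} 1≤m _ = ℕ.≤-trans (ℕ.≤-reflexive (≡.sym (ℕ.*-identityʳ m)))
  (ℕ.*-monoʳ-≤ m (ℕ.>-nonZero⁻¹ (m ^ n) ⦃ ℕ.m^n≢0 m n ⦃ ℕ.>-nonZero 1≤m ⦄ ⦄))

quotient-unique : ∀ {s u v} .⦃ _ : NonZero s ⦄ → u ℕ./ s ≡ v ℕ./ s → ∣ + u ℤ.- + v ∣ < s
quotient-unique {s} {u} {v} same = subst (λ x → ∣ x ∣ < s)
  (≡.sym (≡.trans (cong₂ (λ x y → + x ℤ.- + y) (ℕ.m≡m%n+[m/n]*n u s) (≡.trans (ℕ.m≡m%n+[m/n]*n v s) (cong (λ q → v ℕ.% s ℕ.+ q ℕ.* s) (≡.sym same))))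
    (≡.trans (cong₂ ℤ._-_ (ℤ.pos-+ (u ℕ.% s) _) (ℤ.pos-+ (v ℕ.% s) _)) (identity (+ (u ℕ.% s)) (+ (v ℕ.% s)) (+ (u ℕ./ s ℕ.* s))))))
  (∣-∣-bound (ℕ.m%n<n u s) (ℕ.m%n<n v s))
  where
  identity : ∀ x y z → (x ℤ.+ z) ℤ.- (y ℤ.+ z) ≡ x ℤ.- y
  identity = ℤSolver.solve-∀

module Cells (C D : ℕ) (1≤C : 1 ≤ C) (1≤D : 1 ≤ D) where

  -- For an ideal with at least N classes, `small` keeps distinct lattice points of one cell
  -- incongruent, by the index bound; a cell of side 1 has only one point. `large` says that s is of
  -- the order N^(1/D), so that cells are not too many.
  record CellSide (N : ℕ) : Set where
    field
      s     : ℕ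
      1≤s   : 1 ≤ s
      small : s ≡ 1 ⊎ (C ℕ.* s) ^ D < N
      large : N ≤ (2 ℕ.* C ℕ.* s) ^ D

  cellSide : ∀ N → CellSide N
  cellSide N = search N (ℕ.≤-trans (ℕ.≤-trans (ℕ.m≤n+m N 2) (ℕ.≤-trans (ℕ.≤-reflexive (≡.sym (ℕ.*-identityˡ (2 ℕ.+ N)))) (ℕ.*-monoˡ-≤ (2 ℕ.+ N) 1≤C)))
    (m≤m^n (C ℕ.* (2 ℕ.+ N)) (ℕ.*-mono-≤ 1≤C (s≤s z≤n)) 1≤D))
    where
    large : ∀ s → N ≤ (C ℕ.* (2 ℕ.+ s)) ^ D → N ≤ (2 ℕ.* C ℕ.* suc s) ^ D
    large s N≤ = ℕ.≤-trans N≤ (ℕ.^-monoˡ-≤ D (ℕ.≤-trans (ℕ.*-monoʳ-≤ C (ℕ.m≤m+n (2 ℕ.+ s) s)) (ℕ.≤-reflexive (identity C s))))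
      where
      identity : ∀ C s → C ℕ.* (2 ℕ.+ s ℕ.+ s) ≡ 2 ℕ.* C ℕ.* suc s
      identity = ℕSolver.solve-∀
    search : ∀ s → N ≤ (C ℕ.* (2 ℕ.+ s)) ^ D → CellSide N
    search zero    N≤ = record { s = 1 ; 1≤s = ℕ.≤-refl ; small = inj₁ refl ; large = large 0 N≤ }
    search (suc s) N≤ = case (C ℕ.* (2 ℕ.+ s)) ^ D ℕ.<? N of λ where
      (yes <N) → record { s = 2 ℕ.+ s ; 1≤s = s≤s z≤n ; small = inj₂ <N ; large = large (suc s) N≤ }
      (no  ≮N) → search s (ℕ.≮⇒≥ ≮N)

  module _ (Y : ℕ) where
    cellsPerSide : ℕ → ℕ
    cellsPerSide N = suc (ℕ._/_ Y s ⦃ ℕ.>-nonZero 1≤s ⦄)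
      where open CellSide (cellSide N)

    cellCount : ℕ → ℕ
    cellCount N = cellsPerSide N ^ D

    -- For s ≤ Y there are at most (2Y/s)^D cells, and N ≤ (2Cs)^D; otherwise there is a single
    -- cell, which accounts for the summand N.
    cellCount-bound : ∀ N → N ℕ.* cellCount N ≤ (4 ℕ.* C) ^ D ℕ.* (Y ^ D ℕ.+ N)
    cellCount-bound N = case s ℕ.≤? Y of λ where
        (yes s≤Y) → ℕ.≤-trans (ℕ.*-monoˡ-≤ (cellCount N) large)
          (ℕ.≤-trans (ℕ.≤-reflexive (≡.sym (^-distrib-* (2 ℕ.* C ℕ.* s) k D)))
          (ℕ.≤-trans (ℕ.^-monoˡ-≤ D (ℕ.≤-trans (ℕ.≤-reflexive (ℕ.*-assoc (2 ℕ.* C) s k))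
            (ℕ.≤-trans (ℕ.*-monoʳ-≤ (2 ℕ.* C) (fits s≤Y)) (ℕ.≤-reflexive (double C Y)))))
          (ℕ.≤-trans (ℕ.≤-reflexive (^-distrib-* (4 ℕ.* C) Y D)) (ℕ.*-monoʳ-≤ ((4 ℕ.* C) ^ D) (ℕ.m≤m+n (Y ^ D) N)))))
        (no  s≰Y) → ℕ.≤-trans (ℕ.≤-reflexive (≡.trans (cong (λ q → N ℕ.* suc q ^ D) (ℕ.m<n⇒m/n≡0 (ℕ.≰⇒> s≰Y)))
            (≡.trans (cong (N ℕ.*_) (ℕ.^-zeroˡ D)) (≡.trans (ℕ.*-identityʳ N) (≡.sym (ℕ.*-identityˡ N))))))
          (ℕ.*-mono-≤ (ℕ.>-nonZero⁻¹ ((4 ℕ.* C) ^ D) ⦃ ℕ.m^n≢0 (4 ℕ.* C) D ⦃ ℕ.>-nonZero (ℕ.*-mono-≤ {1} {4} (s≤s z≤n) 1≤C) ⦄ ⦄) (ℕ.m≤n+m N (Y ^ D)))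
      where
      open CellSide (cellSide N)
      instance
        s-nonZero : NonZero s
        s-nonZero = ℕ.>-nonZero 1≤s
      k : ℕ
      k = suc (Y ℕ./ s)
      fits : s ≤ Y → s ℕ.* k ≤ 2 ℕ.* Y
      fits s≤Y = ℕ.≤-trans (ℕ.≤-reflexive (ℕ.*-comm s k)) (ℕ.≤-trans (ℕ.+-mono-≤ s≤Y (ℕ.m/n*n≤m Y s))
        (ℕ.≤-reflexive (cong (Y ℕ.+_) (≡.sym (ℕ.+-identityʳ Y)))))
      double : ∀ C Y → 2 ℕ.* C ℕ.* (2 ℕ.* Y) ≡ 4 ℕ.* C ℕ.* Y
      double = ℕSolver.solve-∀

squares : ℕ → ℕ → List (ℕ × ℕ)
squares z zero    = []
squares z (suc l) = (suc z , suc z ℕ.* suc z) ∷ squares (suc z) l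

squares-∈ : ∀ z l {n} → z < n → n ≤ z ℕ.+ l → (n , n ℕ.* n) ∈ squares z l
squares-∈ z zero    z<n n≤z+l = contradiction z<n (ℕ.≤⇒≯ (ℕ.≤-trans n≤z+l (ℕ.≤-reflexive (ℕ.+-identityʳ z))))
squares-∈ z (suc l) z<n n≤z+l = case ℕ.m≤n⇒m<n∨m≡n z<n of λ where
  (inj₂ refl)  → here refl
  (inj₁ z+1<n) → there (squares-∈ (suc z) l z+1<n (ℕ.≤-trans n≤z+l (ℕ.≤-reflexive (ℕ.+-suc z l))))

module _ (κ : ℕ → ℕ) (E U : ℕ) (κ-bound : ∀ N → N ℕ.* κ N ≤ E ℕ.* (U ℕ.+ N)) where

  sum-over-primes : ∀ ps → ℕ.product ps ℕ.* ℕ.sum (map κ ps) ≤ E ℕ.* (U ℕ.* numerator ps ℕ.+ ℕ.product ps ℕ.* length ps)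
  sum-over-primes []       = z≤n
  sum-over-primes (p ∷ ps) = begin
    p ℕ.* Π ℕ.* (κ p ℕ.+ S)                          ≡⟨ split p Π (κ p) S ⟩
    Π ℕ.* (p ℕ.* κ p) ℕ.+ p ℕ.* (Π ℕ.* S)            ≤⟨ ℕ.+-mono-≤ (ℕ.*-monoʳ-≤ Π (κ-bound p)) (ℕ.*-monoʳ-≤ p (sum-over-primes ps)) ⟩
    Π ℕ.* (E ℕ.* (U ℕ.+ p)) ℕ.+ p ℕ.* (E ℕ.* (U ℕ.* numerator ps ℕ.+ Π ℕ.* length ps))
      ≡⟨ gather p Π E U (numerator ps) (length ps) ⟩
    E ℕ.* (U ℕ.* (Π ℕ.+ p ℕ.* numerator ps) ℕ.+ p ℕ.* Π ℕ.* suc (length ps))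
      ≡⟨ cong (λ x → E ℕ.* (U ℕ.* x ℕ.+ p ℕ.* Π ℕ.* suc (length ps))) (numerator-∷ p ps) ⟨
    E ℕ.* (U ℕ.* numerator (p ∷ ps) ℕ.+ p ℕ.* Π ℕ.* suc (length ps)) ∎
    where
    open ℕ.≤-Reasoning
    Π S : ℕ
    Π = ℕ.product ps
    S = ℕ.sum (map κ ps)
    split : ∀ p Π k S → p ℕ.* Π ℕ.* (k ℕ.+ S) ≡ Π ℕ.* (p ℕ.* k) ℕ.+ p ℕ.* (Π ℕ.* S)
    split = ℕSolver.solve-∀
    gather : ∀ p Π E U n l → Π ℕ.* (E ℕ.* (U ℕ.+ p)) ℕ.+ p ℕ.* (E ℕ.* (U ℕ.* n ℕ.+ Π ℕ.* l)) ≡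
                             E ℕ.* (U ℕ.* (Π ℕ.+ p ℕ.* n) ℕ.+ p ℕ.* Π ℕ.* suc l)
    gather = ℕSolver.solve-∀

  -- Telescoping: 1/(z+1)² + 1/(z+1) ≤ 1/z.
  sum-over-squares : ∀ z l → z ℕ.* ℕ.sum (map (κ ∘ proj₂) (squares z l)) ≤ E ℕ.* (U ℕ.+ z ℕ.* l)
  sum-over-squares z zero    = ℕ.≤-trans (ℕ.≤-reflexive (ℕ.*-zeroʳ z)) z≤n
  sum-over-squares z (suc l) = ℕ.*-cancelˡ-≤ (n ℕ.* n) (begin
    n ℕ.* n ℕ.* (z ℕ.* (κ (n ℕ.* n) ℕ.+ S))  ≡⟨ split z n (κ (n ℕ.* n)) S ⟩
    z ℕ.* (n ℕ.* n ℕ.* κ (n ℕ.* n)) ℕ.+ z ℕ.* n ℕ.* (n ℕ.* S)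
      ≤⟨ ℕ.+-mono-≤ (ℕ.*-monoʳ-≤ z (κ-bound (n ℕ.* n))) (ℕ.*-monoʳ-≤ (z ℕ.* n) (sum-over-squares n l)) ⟩
    z ℕ.* (E ℕ.* (U ℕ.+ n ℕ.* n)) ℕ.+ z ℕ.* n ℕ.* (E ℕ.* (U ℕ.+ n ℕ.* l))
      ≤⟨ ℕ.m≤m+n _ (E ℕ.* U) ⟩
    z ℕ.* (E ℕ.* (U ℕ.+ n ℕ.* n)) ℕ.+ z ℕ.* n ℕ.* (E ℕ.* (U ℕ.+ n ℕ.* l)) ℕ.+ E ℕ.* U
      ≡⟨ gather z E U l ⟩
    n ℕ.* n ℕ.* (E ℕ.* (U ℕ.+ z ℕ.* suc l)) ∎)
    where
    open ℕ.≤-Reasoning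
    n S : ℕ
    n = suc z
    S = ℕ.sum (map (κ ∘ proj₂) (squares n l))
    split : ∀ z n k S → n ℕ.* n ℕ.* (z ℕ.* (k ℕ.+ S)) ≡ z ℕ.* (n ℕ.* n ℕ.* k) ℕ.+ z ℕ.* n ℕ.* (n ℕ.* S)
    split = ℕSolver.solve-∀
    gather : ∀ z E U l → z ℕ.* (E ℕ.* (U ℕ.+ suc z ℕ.* suc z)) ℕ.+ z ℕ.* suc z ℕ.* (E ℕ.* (U ℕ.+ suc z ℕ.* l)) ℕ.+ E ℕ.* U ≡
                         suc z ℕ.* suc z ℕ.* (E ℕ.* (U ℕ.+ z ℕ.* suc l))
    gather = ℕSolver.solve-∀

-- Each reciprocal is at least 1/Z. Thus a small reciprocal sum also bounds how many primes there
-- are, and hence the summands 1 in Y^D / N + 1.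
length≤numerator : ∀ Z ps → All (_≤ Z) ps → ℕ.product ps ℕ.* length ps ≤ Z ℕ.* numerator ps
length≤numerator Z []       []           = z≤n
length≤numerator Z (p ∷ ps) (p≤Z ∷ ps≤Z) = begin
  p ℕ.* Π ℕ.* suc (length ps)                ≡⟨ split p Π (length ps) ⟩
  p ℕ.* Π ℕ.+ p ℕ.* (Π ℕ.* length ps)        ≤⟨ ℕ.+-mono-≤ (ℕ.*-monoˡ-≤ Π p≤Z) (ℕ.*-monoʳ-≤ p (length≤numerator Z ps ps≤Z)) ⟩
  Z ℕ.* Π ℕ.+ p ℕ.* (Z ℕ.* numerator ps)     ≡⟨ gather Z Π p (numerator ps) ⟩
  Z ℕ.* (Π ℕ.+ p ℕ.* numerator ps)           ≡⟨ cong (Z ℕ.*_) (numerator-∷ p ps) ⟨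
  Z ℕ.* numerator (p ∷ ps)                   ∎
  where
  open ℕ.≤-Reasoning
  Π : ℕ
  Π = ℕ.product ps
  split : ∀ p Π l → p ℕ.* Π ℕ.* suc l ≡ p ℕ.* Π ℕ.+ p ℕ.* (Π ℕ.* l)
  split = ℕSolver.solve-∀
  gather : ∀ Z Π p n → Z ℕ.* Π ℕ.+ p ℕ.* (Z ℕ.* n) ≡ Z ℕ.* (Π ℕ.+ p ℕ.* n)
  gather = ℕSolver.solve-∀

module CountingInequalities where
  private
    swap : ∀ a b c → a ℕ.* (b ℕ.* c) ≡ b ℕ.* (a ℕ.* c)
    swap = ℕSolver.solve-∀

  primes-part : ∀ {Π S n l} E U G → 0 < Π → Π ℕ.* S ≤ E ℕ.* (U ℕ.* n ℕ.+ Π ℕ.* l) →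
                G ℕ.* E ℕ.* n ≤ Π → G ℕ.* E ℕ.* l ≤ U → G ℕ.* S ≤ 2 ℕ.* U
  primes-part {Π} {S} {n} {l} E U G 0<Π bound few short = ℕ.*-cancelˡ-≤ Π ⦃ ℕ.>-nonZero 0<Π ⦄ (begin
    Π ℕ.* (G ℕ.* S)                               ≡⟨ swap Π G S ⟩
    G ℕ.* (Π ℕ.* S)                               ≤⟨ ℕ.*-monoʳ-≤ G bound ⟩
    G ℕ.* (E ℕ.* (U ℕ.* n ℕ.+ Π ℕ.* l))           ≡⟨ expand G E U n Π l ⟩
    U ℕ.* (G ℕ.* E ℕ.* n) ℕ.+ Π ℕ.* (G ℕ.* E ℕ.* l) ≤⟨ ℕ.+-mono-≤ (ℕ.*-monoʳ-≤ U few) (ℕ.*-monoʳ-≤ Π short) ⟩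
    U ℕ.* Π ℕ.+ Π ℕ.* U                           ≡⟨ collect U Π ⟩
    Π ℕ.* (2 ℕ.* U)                               ∎)
    where
    open ℕ.≤-Reasoning
    expand : ∀ G E U n Π l → G ℕ.* (E ℕ.* (U ℕ.* n ℕ.+ Π ℕ.* l)) ≡ U ℕ.* (G ℕ.* E ℕ.* n) ℕ.+ Π ℕ.* (G ℕ.* E ℕ.* l)
    expand = ℕSolver.solve-∀
    collect : ∀ U Π → U ℕ.* Π ℕ.+ Π ℕ.* U ≡ Π ℕ.* (2 ℕ.* U)
    collect = ℕSolver.solve-∀

  squares-part : ∀ {z S l} E U G → 0 < z → z ℕ.* S ≤ E ℕ.* (U ℕ.+ z ℕ.* l) → G ℕ.* E ≤ z → G ℕ.* E ℕ.* l ≤ U → G ℕ.* S ≤ 2 ℕ.* U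
  squares-part {z} {S} {l} E U G 0<z bound GE≤z short = ℕ.*-cancelˡ-≤ z ⦃ ℕ.>-nonZero 0<z ⦄ (begin
    z ℕ.* (G ℕ.* S)                               ≡⟨ swap z G S ⟩
    G ℕ.* (z ℕ.* S)                               ≤⟨ ℕ.*-monoʳ-≤ G bound ⟩
    G ℕ.* (E ℕ.* (U ℕ.+ z ℕ.* l))                 ≡⟨ expand G E U z l ⟩
    G ℕ.* E ℕ.* U ℕ.+ z ℕ.* (G ℕ.* E ℕ.* l)       ≤⟨ ℕ.+-mono-≤ (ℕ.*-monoˡ-≤ U GE≤z) (ℕ.*-monoʳ-≤ z short) ⟩
    z ℕ.* U ℕ.+ z ℕ.* U                           ≡⟨ collect z U ⟩
    z ℕ.* (2 ℕ.* U)                               ∎)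
    where
    open ℕ.≤-Reasoning
    expand : ∀ G E U z l → G ℕ.* (E ℕ.* (U ℕ.+ z ℕ.* l)) ≡ G ℕ.* E ℕ.* U ℕ.+ z ℕ.* (G ℕ.* E ℕ.* l)
    expand = ℕSolver.solve-∀
    collect : ∀ z U → z ℕ.* U ℕ.+ z ℕ.* U ≡ z ℕ.* (2 ℕ.* U)
    collect = ℕSolver.solve-∀

  short-list : ∀ {Π l n} GE B₀ U → 0 < Π → 0 < B₀ → Π ℕ.* l ≤ B₀ ℕ.* U ℕ.* n → GE ℕ.* B₀ ℕ.* n ≤ Π → GE ℕ.* l ≤ U
  short-list {Π} {l} {n} GE B₀ U 0<Π 0<B₀ Πl≤ few = ℕ.*-cancelˡ-≤ (Π ℕ.* B₀) ⦃ ℕ.>-nonZero (ℕ.*-mono-≤ 0<Π 0<B₀) ⦄ (begin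
    Π ℕ.* B₀ ℕ.* (GE ℕ.* l)             ≡⟨ regroup Π B₀ GE l ⟩
    GE ℕ.* B₀ ℕ.* (Π ℕ.* l)             ≤⟨ ℕ.*-monoʳ-≤ (GE ℕ.* B₀) Πl≤ ⟩
    GE ℕ.* B₀ ℕ.* (B₀ ℕ.* U ℕ.* n)       ≡⟨ swap (GE ℕ.* B₀) (B₀ ℕ.* U) n ⟩
    B₀ ℕ.* U ℕ.* (GE ℕ.* B₀ ℕ.* n)       ≤⟨ ℕ.*-monoʳ-≤ (B₀ ℕ.* U) few ⟩
    B₀ ℕ.* U ℕ.* Π                      ≡⟨ rotate B₀ U Π ⟩
    Π ℕ.* B₀ ℕ.* U                      ∎)
    where
    open ℕ.≤-Reasoning
    regroup : ∀ Π B₀ g l → Π ℕ.* B₀ ℕ.* (g ℕ.* l) ≡ g ℕ.* B₀ ℕ.* (Π ℕ.* l)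
    regroup = ℕSolver.solve-∀
    rotate : ∀ B₀ U Π → B₀ ℕ.* U ℕ.* Π ≡ Π ℕ.* B₀ ℕ.* U
    rotate = ℕSolver.solve-∀

  -- Each part takes at most an eighth of U / suc r; the constant 16 leaves slack, since 6 would
  -- already give the weak inequality.
  total : ∀ {r a b c U} → 0 < U → 16 ℕ.* suc r ℕ.* a ≤ 2 ℕ.* U → 16 ℕ.* suc r ℕ.* b ≤ 2 ℕ.* U → 16 ℕ.* suc r ℕ.* c ≤ 2 ℕ.* U →
          r ℕ.* (a ℕ.+ (b ℕ.+ c)) < U
  total {r} {a} {b} {c} {U} 0<U a≤ b≤ c≤ = ℕ.≰⇒> λ U≤ → ℕ.<⇒≱ (ℕ.*-monoˡ-< U ⦃ ℕ.>-nonZero 0<U ⦄ {6} {16} (ℕ.m≤m+n 7 9)) (begin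
    16 ℕ.* U                                  ≤⟨ ℕ.*-monoʳ-≤ 16 U≤ ⟩
    16 ℕ.* (r ℕ.* (a ℕ.+ (b ℕ.+ c)))          ≤⟨ ℕ.*-monoʳ-≤ 16 (ℕ.*-monoˡ-≤ (a ℕ.+ (b ℕ.+ c)) (ℕ.n≤1+n r)) ⟩
    16 ℕ.* (suc r ℕ.* (a ℕ.+ (b ℕ.+ c)))      ≡⟨ expand (suc r) a b c ⟩
    16 ℕ.* suc r ℕ.* a ℕ.+ (16 ℕ.* suc r ℕ.* b ℕ.+ 16 ℕ.* suc r ℕ.* c) ≤⟨ ℕ.+-mono-≤ a≤ (ℕ.+-mono-≤ b≤ c≤) ⟩
    2 ℕ.* U ℕ.+ (2 ℕ.* U ℕ.+ 2 ℕ.* U)         ≡⟨ collect U ⟩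
    6 ℕ.* U                                   ∎)
    where
    open ℕ.≤-Reasoning
    expand : ∀ r a b c → 16 ℕ.* (r ℕ.* (a ℕ.+ (b ℕ.+ c))) ≡ 16 ℕ.* r ℕ.* a ℕ.+ (16 ℕ.* r ℕ.* b ℕ.+ 16 ℕ.* r ℕ.* c)
    expand = ℕSolver.solve-∀
    collect : ∀ U → 2 ℕ.* U ℕ.+ (2 ℕ.* U ℕ.+ 2 ℕ.* U) ≡ 6 ℕ.* U
    collect = ℕSolver.solve-∀

-- The lower bound: distributing the box over prime ideals

module LowerBound (Ans : Set) (Q : ℤ[x]) (A : ℤ-Algebra) (fg : FinitelyGenerated A)
  (orderLike : Lattices.OrderLike Ans A) (L : Lattices.Lattice Ans A) (separatedRoots : SeparatedRoots Q A)
  (1≤D : 1 ≤ Lattices.Lattice.D L) where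
  open ℤ-Algebra A
  open Ideals A using (Ideal; module Ideal)
  open SeparatedRoots separatedRoots
  open PrimeFactors Ans Q A fg orderLike L separatedRoots
  open Classical Ans
  open Lattices Ans A using (Incongruent; module Lattice; module LatticeProperties)
  open Lattice L
  open LatticeProperties orderLike L
  open Combinations A
  open GeneratorCoordinates A fg using (rank)
  open PrimeIdeals Ans A using (Proper)
  open Solver A
  open SparseTail Ans (TwoRoots Q) proj₁

  private
    module Fibers (z M : ℕ) (1≤M : 1 ≤ M) (divides-M : ∀ q → Prime q → q ≤ z → q ℕ.∣ M) (n₀≤z : ∣ n₀ ∣ ≤ z)
                  (Y : ℕ) (1≤Y : 1 ≤ Y) where
      open Box M Y 1≤M 1≤Y public

      record Datum (t : Fin D → ℤ) : Set₁ where
        field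
          p      : ℕ
          factor : PrimeFactor p (element t)
          z<p    : z < p
          kind   : PrimeFactor.ResidueSize factor

        size : ℕ
        size = case kind of λ { (inj₁ _) → p ; (inj₂ _) → p ℕ.* p }

        residues : ∃[ w ] Incongruent {size} (PrimeFactor.𝔮 factor) w
        residues with kind
        ... | inj₁ (_ , w) = w
        ... | inj₂ w       = w

      -- The element is 1 modulo M, so a proper ideal cannot contain both.
      M∉ : ∀ {t} J → Proper J → Ideal._∈I J (element t) → Ideal._∈I J (ι (+ M)) → Ans
      M∉ {t} J proper b∈ M∈ = proper (resp
        (≈-trans (+-congʳ (+-congʳ (≈-trans (≈-trans (ι-+ (+ 1) (+ (M ℕ.* (κ ℕ.* Y)))) (+-congʳ ι-1))
            (+-congˡ (≈-trans (ι-cong (ℤ.pos-* M (κ ℕ.* Y))) (ι-* (+ M) (+ (κ ℕ.* Y))))))))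
          (solve 3 (λ m k t → (con (+ 1) :+ m :* k) :+ m :* t :- m :* (k :+ t) := con (+ 1)) ≈-refl (ι (+ M)) (ι (+ (κ ℕ.* Y))) (comb t e)))
        (-∈ b∈ (*∈ʳ M∈ (ι (+ (κ ℕ.* Y)) + comb t e))))
        where open Ideal J

      datum : ∀ t → (∀ d → ∣ t d ∣ ≤ Y) → Cl (Datum t)
      datum t t≤Y K = primeFactor (element t)
        (λ b≈0 → no-small-multiple t t≤Y 1# 1≉0 (+ 0) z≤n (≈-trans (*-identityʳ (element t)) (≈-trans b≈0 (≈-sym ι-0))))
        (λ h hb≈1 → no-small-multiple t t≤Y h
          (λ h≈0 → 1≉0 (≈-trans (≈-sym hb≈1) (≈-trans (*-congʳ h≈0) (zeroˡ (element t)))))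
          (+ 1) ℕ.≤-refl (≈-trans (*-comm (element t) h) (≈-trans hb≈1 (≈-sym ι-1))))
        λ (p , F) → let open PrimeFactor F in case z ℕ.<? p of λ where
          (no  z≮p) → M∉ 𝔮 proper x∈ (multiple∈ (∣⇒∣ℤ (divides-M p isPrime (ℕ.≮⇒≥ z≮p))))
          (yes z<p) → residueSize (ℕ.≤-<-trans n₀≤z z<p) λ kind → K record { p = p ; factor = F ; z<p = z<p ; kind = kind }

      -- A lattice element of an ideal with N residue classes has a coordinate of size ≫ N^(1/D), so
      -- the elements of one cell lie in different prime ideals.
      crowded-cell : ∀ {p N} → Prime p → (t : Fin (suc rank) → Fin D → ℤ) (F : ∀ j → PrimeFactor p (element (t j))) →
                     (∀ j → ∃[ w ] Incongruent {N} (PrimeFactor.𝔮 (F j)) w) →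
                     (cell : Cells.CellSide indexConstant D (s≤s z≤n) 1≤D N) →
                     (∀ i j → i ≢ j → Nonzero (λ d → t i d ℤ.- t j d)) →
                     (∀ i j d → ∣ t i d ℤ.- t j d ∣ < Cells.CellSide.s cell) → Ans
      crowded-cell pr t F residues cell distinct close = few-primes pr (λ j → element (t j)) F λ i j i≢j bⱼ∈ →
        let open PrimeFactor (F i)
            c : Fin D → ℤ
            c d = t i d ℤ.- t j d
        in prime𝔮 (ι (+ M)) (comb c e) (resp
             (≈-trans (solve 4 (λ s m u v → (s :+ m :* u) :- (s :+ m :* v) := m :* (u :- v)) ≈-refl
                 (ι (+ shift)) (ι (+ M)) (comb (t i) e) (comb (t j) e))
               (*-congˡ (≈-sym (comb-- (t i) (t j) e))))
             (-∈ x∈ bⱼ∈)) λ where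
          (inj₁ M∈) → M∉ {t i} 𝔮 proper x∈ M∈
          (inj₂ c∈) → case small of λ where
            (inj₁ s≡1)    → case distinct i j i≢j of λ (d , c≢0) →
              contradiction (ℤ.∣i∣≡0⇒i≡0 (ℕ.n<1⇒n≡0 (subst (∣ c d ∣ <_) s≡1 (close i j d)))) c≢0
            (inj₂ small′) → indexBound 𝔮 c s 1≤s (distinct i j i≢j) (λ d → ℕ.<⇒≤ (close i j d)) c∈
              (proj₁ (residues i)) (proj₂ (residues i)) small′
        where open Cells.CellSide cell

    _≟×_ : (x y : ℕ × ℕ) → Dec (x ≡ y)
    (a , b) ≟× (c , d) = case (a ℕ.≟ c) ×-dec (b ℕ.≟ d) of λ where
      (yes (refl , refl)) → yes refl
      (no  ≢)             → no λ { refl → ≢ (refl , refl) }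

    range : ℕ → ℕ → List ℕ
    range a = List.applyUpTo (λ i → suc a ℕ.+ i)

    range-∈ : ∀ {a l p} → a < p → p ≤ a ℕ.+ l → p ∈ range a l
    range-∈ {a} {l} a<p p≤a+l with ℕ.m≤n⇒∃[o]m+o≡n a<p
    ... | i , refl = ∈.∈-applyUpTo⁺ (λ i → suc a ℕ.+ i) (ℕ.+-cancelˡ-< a i l p≤a+l)

    range-sorted : ∀ a l → AllPairs _<_ (range a l)
    range-sorted a l = AllPairs.applyUpTo⁺₁ (λ i → suc a ℕ.+ i) l λ i<j _ → ℕ.+-monoʳ-< (suc a) i<j

    range-> : ∀ a l → All (a <_) (range a l)
    range-> a l = All.applyUpTo⁺₂ (λ i → suc a ℕ.+ i) l λ i → ℕ.m≤m+n (suc a) i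

    C E G : ℕ
    C = indexConstant
    E = (4 ℕ.* C) ^ D
    G = 16 ℕ.* suc rank

    1≤GE : 1 ≤ G ℕ.* E
    1≤GE = ℕ.*-mono-≤ {1} {G} (s≤s z≤n) (ℕ.>-nonZero⁻¹ E ⦃ ℕ.m^n≢0 (4 ℕ.* C) D ⦄)

    1≤sizeConstant : 1 ≤ sizeConstant
    1≤sizeConstant = ℕ.*-mono-≤ {1} {indexConstant} (s≤s z≤n)
      (ℕ.≤-trans (ℕ.n≢0⇒n>0 (Δ≢0 ∘ ℤ.∣i∣≡0⇒i≡0)) (ℕ.m≤n+m ∣ Δ ∣ (suc κ ℕ.* Ω)))

    module Count (z M z′ y : ℕ) (1≤M : 1 ≤ M) (divides-M : ∀ q → Prime q → q ≤ z → q ℕ.∣ M) (n₀≤z : ∣ n₀ ∣ ≤ z)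
                 (GE≤z : G ℕ.* E ≤ z) (B₀ : ℕ) (B₀-def : B₀ ≡ (sizeConstant ℕ.* M) ^ D)
                 (sparse : Tail (G ℕ.* E) z) (sparse′ : Tail (G ℕ.* E ℕ.* B₀) z′) (z≤z′ : z ≤ z′)
                 (y-large : G ℕ.* E ℕ.* (B₀ ℕ.+ z′) ≤ y) (1≤y : 1 ≤ y) where

      -- Z₁ bounds the sizes and Z₂ the primes with p² ≤ Z₁. Since Y is a square, U = (y^D)², and Z₂
      -- = B₀ y^D is small compared with U.
      Y U Z₁ Z₂ : ℕ
      Y  = y ℕ.* y
      U  = Y ^ D
      Z₁ = B₀ ℕ.* U
      Z₂ = B₀ ℕ.* y ^ D

      1≤Y : 1 ≤ Y
      1≤Y = ℕ.*-mono-≤ 1≤y 1≤y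

      open Fibers z M 1≤M divides-M n₀≤z Y 1≤Y
      open Cells C D (s≤s z≤n) 1≤D

      0<B₀ : 0 < B₀
      0<B₀ = subst (0 <_) (≡.sym B₀-def) (ℕ.>-nonZero⁻¹ _ ⦃ ℕ.m^n≢0 (sizeConstant ℕ.* M) D ⦃ ℕ.>-nonZero (ℕ.*-mono-≤ 1≤sizeConstant 1≤M) ⦄ ⦄)

      0<U : 0 < U
      0<U = ℕ.>-nonZero⁻¹ U ⦃ ℕ.m^n≢0 Y D ⦃ ℕ.>-nonZero 1≤Y ⦄ ⦄

      y≤U : y ≤ U
      y≤U = ℕ.≤-trans (ℕ.≤-trans (ℕ.≤-reflexive (≡.sym (ℕ.*-identityʳ y))) (ℕ.*-monoʳ-≤ y 1≤y)) (m≤m^n Y 1≤Y 1≤D)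

      GEz′≤U : G ℕ.* E ℕ.* z′ ≤ U
      GEz′≤U = ℕ.≤-trans (ℕ.*-monoʳ-≤ (G ℕ.* E) (ℕ.m≤n+m z′ B₀)) (ℕ.≤-trans y-large y≤U)

      U-square : U ≡ y ^ D ℕ.* y ^ D
      U-square = ^-distrib-* y y D

      GEZ₂≤U : G ℕ.* E ℕ.* Z₂ ≤ U
      GEZ₂≤U = ℕ.≤-trans (ℕ.≤-reflexive (≡.sym (ℕ.*-assoc (G ℕ.* E) B₀ (y ^ D)))) (ℕ.≤-trans
        (ℕ.*-monoˡ-≤ (y ^ D) (ℕ.≤-trans (ℕ.*-monoʳ-≤ (G ℕ.* E) (ℕ.m≤m+n B₀ z′)) (ℕ.≤-trans y-large (m≤m^n y 1≤y 1≤D))))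
        (ℕ.≤-reflexive (≡.sym U-square)))

      Index : Set
      Index = Fin (Y ^ D)

      t : Index → Fin D → ℤ
      t i d = + digits {Y} {D} i d

      t<Y : ∀ i d → digits {Y} {D} i d < Y
      t<Y i d = Fin.toℕ<n (Fin.finToFun {Y} {D} i d)

      module Assigned (data′ : ∀ i → Datum (t i)) (size≤ : ∀ i → Datum.size (data′ i) ≤ Z₁) where
        module Data i = Datum (data′ i)

        Split : ∀ i → Set
        Split i = ∃[ w ] Data.kind i ≡ inj₁ w

        split? : ∀ i → Dec (Split i)
        split? i with Data.kind i
        ... | inj₁ w = yes (w , refl)
        ... | inj₂ _ = no λ ()

        Occurs : ℕ → Set
        Occurs q = ∃[ i ] Split i × Data.p i ≡ q

        occurs? : ∀ q → Dec (Occurs q)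
        occurs? q = Fin.any? (λ i → split? i ×-dec (Data.p i ℕ.≟ q))

        occurs⇒twoRoots : ∀ {q} → Occurs q → TwoRoots Q q
        occurs⇒twoRoots (i , (w , _) , refl) = proj₁ w

        occurs⇒≤ : ∀ {q} → Occurs q → q ≤ Z₁
        occurs⇒≤ (i , (w , eq) , refl) = ℕ.≤-trans (ℕ.≤-reflexive (≡.sym (size-split eq))) (size≤ i)
          where
          size-split : ∀ {w} → Data.kind i ≡ inj₁ w → Data.size i ≡ Data.p i
          size-split eq rewrite eq = refl

        psA psB : List ℕ
        psA = List.filter occurs? (range z z′)
        psB = List.filter occurs? (range z′ Z₁)

        admissible : ∀ a l → Admissible a (List.filter occurs? (range a l))
        admissible a l = AllPairs.filter⁺ occurs? (range-sorted a l) , All.filter⁺ occurs? (range-> a l)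
          , All.map occurs⇒twoRoots (All.all-filter occurs? (range a l))

        diagonal : List ℕ → List (ℕ × ℕ)
        diagonal = map (λ p → p , p)

        -- All pairs (p, size) that can occur: primes of T up to z′, those beyond z′, and squares.
        -- Overlaps do no harm, as they only add capacity.
        slots : List (ℕ × ℕ)
        slots = diagonal psA ++ (diagonal psB ++ squares z Z₂)

        slot : Index → ℕ × ℕ
        slot i = Data.p i , Data.size i

        square-bound : ∀ {p} → p ℕ.* p ≤ Z₁ → p ≤ Z₂
        square-bound {p} p²≤ = ℕ.≮⇒≥ λ Z₂<p → ℕ.<⇒≱ (ℕ.*-mono-< Z₂<p Z₂<p) (ℕ.≤-trans p²≤ (ℕ.≤-trans
          (ℕ.≤-reflexive (cong (B₀ ℕ.*_) U-square)) (ℕ.≤-trans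
            (ℕ.*-monoˡ-≤ (y ^ D ℕ.* y ^ D) (ℕ.≤-trans (ℕ.≤-reflexive (≡.sym (ℕ.*-identityʳ B₀))) (ℕ.*-monoʳ-≤ B₀ 0<B₀)))
            (ℕ.≤-reflexive (identity B₀ (y ^ D))))))
          where
          identity : ∀ B₀ w → B₀ ℕ.* B₀ ℕ.* (w ℕ.* w) ≡ B₀ ℕ.* w ℕ.* (B₀ ℕ.* w)
          identity = ℕSolver.solve-∀

        slot∈ : ∀ i → slot i ∈ slots
        slot∈ i = by-kind (Data.kind i) refl (size≤ i)
          where
          z<p = Data.z<p i
          p = Data.p i
          by-kind : ∀ k → Data.kind i ≡ k → Data.size i ≤ Z₁ → slot i ∈ slots
          by-kind (inj₂ w) eq size≤ rewrite eq = ∈.∈-++⁺ʳ (diagonal psA) (∈.∈-++⁺ʳ (diagonal psB)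
            (squares-∈ z Z₂ z<p (ℕ.≤-trans (square-bound size≤) (ℕ.m≤n+m Z₂ z))))
          by-kind (inj₁ w) eq size≤ = case p ℕ.≤? z′ of λ where
              (yes p≤z′) → subst (_∈ slots) (cong (p ,_) (≡.sym size≡)) (∈.∈-++⁺ˡ (∈.∈-map⁺ (λ p → p , p) (∈.∈-filter⁺ occurs?
                (range-∈ z<p (ℕ.≤-trans p≤z′ (ℕ.m≤n+m z′ z))) (i , (w , eq) , refl))))
              (no  p≰z′) → subst (_∈ slots) (cong (p ,_) (≡.sym size≡)) (∈.∈-++⁺ʳ (diagonal psA) (∈.∈-++⁺ˡ (∈.∈-map⁺ (λ p → p , p) (∈.∈-filter⁺ occurs?
                (range-∈ (ℕ.≰⇒> p≰z′) (ℕ.≤-trans (ℕ.≤-reflexive (≡.sym size≡)) (ℕ.≤-trans size≤ (ℕ.m≤n+m Z₁ z′)))) (i , (w , eq) , refl)))))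
            where
            size≡ : Data.size i ≡ p
            size≡ rewrite eq = refl

        -- A cell holds at most `rank` elements of one slot: distinct ones lie in different prime
        -- ideals over the same p.
        weight : ℕ × ℕ → ℕ
        weight (_ , N) = rank ℕ.* cellCount Y N

        sum-weights : ∀ xs → ℕ.sum (map weight xs) ≡ rank ℕ.* ℕ.sum (map (cellCount Y ∘ proj₂) xs)
        sum-weights []             = ≡.sym (ℕ.*-zeroʳ rank)
        sum-weights ((_ , N) ∷ xs) = ≡.trans (cong (rank ℕ.* cellCount Y N ℕ.+_) (sum-weights xs))
          (≡.sym (ℕ.*-distribˡ-+ rank (cellCount Y N) _))

        sum-slots : ℕ.sum (map (cellCount Y ∘ proj₂) slots) ≡
                    ℕ.sum (map (cellCount Y) psA) ℕ.+ (ℕ.sum (map (cellCount Y) psB) ℕ.+ ℕ.sum (map (cellCount Y ∘ proj₂) (squares z Z₂)))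
        sum-slots = ≡.trans (sum-++ (diagonal psA) _) (cong₂ ℕ._+_ (cong ℕ.sum (≡.sym (List.map-∘ psA)))
          (≡.trans (sum-++ (diagonal psB) _) (cong (ℕ._+ _) (cong ℕ.sum (≡.sym (List.map-∘ psB))))))
          where
          f = cellCount Y ∘ proj₂
          sum-++ : ∀ xs ys → ℕ.sum (map f (xs ++ ys)) ≡ ℕ.sum (map f xs) ℕ.+ ℕ.sum (map f ys)
          sum-++ xs ys = ≡.trans (cong ℕ.sum (List.map-++ f xs ys)) (ℕ.sum-++ (map f xs) (map f ys))

        product>0 : ∀ {a ps} → Admissible a ps → 0 < ℕ.product ps
        product>0 (_ , _ , two) = ℕ.productOfPrimes≥1 (All.map proj₁ two)

        -- The main terms are small by sparsity and by the convergence of the sum of 1/n². The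
        -- summands 1 are few: at most z′ for psA, at most Z₂ for squares, and for psB, which
        -- reaches up to order B₀ U, by the extra factor B₀ in its sparsity.
        few-cells : G ℕ.* E ℕ.* numerator psA ≤ ℕ.product psA → G ℕ.* E ℕ.* numerator psB ≤ ℕ.product psB →
                    G ℕ.* E ℕ.* B₀ ℕ.* numerator psB ≤ ℕ.product psB → ℕ.sum (map weight slots) < length (List.allFin (Y ^ D))
        few-cells A-sparse B-sparse B-very-sparse = ℕ.<-≤-trans
          (ℕ.≤-<-trans (ℕ.≤-reflexive (≡.trans (sum-weights slots) (cong (rank ℕ.*_) sum-slots)))
            (CountingInequalities.total {rank} 0<U
              (CountingInequalities.primes-part E U G (product>0 (admissible z z′)) (bound psA) A-sparse
                (ℕ.≤-trans (ℕ.*-monoʳ-≤ (G ℕ.* E) (ℕ.≤-trans (List.length-filter occurs? (range z z′))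
                  (ℕ.≤-reflexive (List.length-applyUpTo (λ i → suc z ℕ.+ i) z′)))) GEz′≤U))
              (CountingInequalities.primes-part E U G (product>0 (admissible z′ Z₁)) (bound psB) B-sparse
                (CountingInequalities.short-list (G ℕ.* E) B₀ U (product>0 (admissible z′ Z₁)) 0<B₀
                  (length≤numerator Z₁ psB (All.map occurs⇒≤ (All.all-filter occurs? (range z′ Z₁)))) B-very-sparse))
              (CountingInequalities.squares-part E U G (ℕ.≤-trans 1≤GE GE≤z)
                (sum-over-squares (cellCount Y) E U (cellCount-bound Y) z Z₂) GE≤z GEZ₂≤U)))
          (ℕ.≤-reflexive (≡.sym (List.length-tabulate {n = Y ^ D} id)))
          where
          bound = sum-over-primes (cellCount Y) E U (cellCount-bound Y)

        module Crowded (N p : ℕ) (xs : List Index) (distinct : AllPairs _≢_ xs)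
                       (same-slot : All (λ i → slot i ≡ (p , N)) xs) (many : rank ℕ.* cellCount Y N < length xs) where
          open CellSide (cellSide N)
          instance
            s-nonZero : NonZero s
            s-nonZero = ℕ.>-nonZero 1≤s

          cell : Index → Fin (cellCount Y N)
          cell i = Fin.funToFin λ d → fromℕ< {digits {Y} {D} i d ℕ./ s} (s≤s (ℕ./-monoˡ-≤ s (ℕ.<⇒≤ (t<Y i d))))

          same-cell : ∀ {i j} → cell i ≡ cell j → ∀ d → ∣ t i d ℤ.- t j d ∣ < s
          same-cell {i} {j} eq d = quotient-unique {s} (≡.trans (≡.sym (Fin.toℕ-fromℕ< _)) (≡.trans (cong toℕ
            (≡.trans (≡.sym (Fin.finToFun-funToFin _ d)) (≡.trans (cong (λ c → Fin.finToFun c d) eq) (Fin.finToFun-funToFin _ d))))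
            (Fin.toℕ-fromℕ< _)))

          conclude : (∃₂ λ c ys → AllPairs _≢_ ys × All (λ i → slot i ≡ (p , N)) ys × All (λ i → cell i ≡ c) ys × rank < length ys) → Ans
          conclude (c , ys , distinct , slots≡ , cells≡ , rank<) =
            crowded-cell (subst Prime (cong proj₁ (slot≡ zero)) (PrimeFactor.isPrime (Data.factor (i zero))))
              (λ j → t (i j)) (λ j → subst (λ q → PrimeFactor q (element (t (i j)))) (cong proj₁ (slot≡ j)) (Data.factor (i j)))
              (λ j → transport (data′ (i j)) (slot≡ j)) (cellSide N)
              (λ j k j≢k → case nonzero? (λ d → t (i j) d ℤ.- t (i k) d) of λ where
                (inj₁ nz)  → nz
                (inj₂ all) → contradiction (digits-injective {Y} {D} λ d → ℤ.+-injective (ℤ.i-j≡0⇒i≡j _ _ (all d))) (i-distinct j≢k))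
              (λ j k → same-cell (≡.trans (cell≡ j) (≡.sym (cell≡ k))))
            where
            position : Fin (suc rank) → Fin (length ys)
            position j = Fin.inject≤ j rank<
            i : Fin (suc rank) → Index
            i j = List.lookup ys (position j)
            slot≡ : ∀ j → slot (i j) ≡ (p , N)
            slot≡ j = All.lookup slots≡ (∈.∈-lookup (position j))
            cell≡ : ∀ j → cell (i j) ≡ c
            cell≡ j = All.lookup cells≡ (∈.∈-lookup (position j))
            i-distinct : ∀ {j k} → j ≢ k → i j ≢ i k
            i-distinct j≢k = lookup-≢ distinct (j≢k ∘ Fin.inject≤-injective rank< rank< _ _)
            transport : ∀ {t} (X : Datum t) (eq : (Datum.p X , Datum.size X) ≡ (p , N)) →
                        ∃[ w ] Incongruent {N} (PrimeFactor.𝔮 (subst (λ q → PrimeFactor q (element t)) (cong proj₁ eq) (Datum.factor X))) w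
            transport X refl = Datum.residues X

          crowded : Ans
          crowded = conclude (weighted-pigeonhole Fin._≟_ cell (λ _ → rank) (List.allFin (cellCount Y N)) xs distinct same-slot
            (All.universal (λ i → ∈.∈-allFin (cell i)) xs)
            (subst (_< length xs) (≡.trans (ℕ.*-comm rank (cellCount Y N)) (≡.sym (constant-sum (cellCount Y N)))) many))
            where
            constant-map : ∀ {X : Set} (xs : List X) → ℕ.sum (map (λ _ → rank) xs) ≡ length xs ℕ.* rank
            constant-map []       = refl
            constant-map (x ∷ xs) = cong (rank ℕ.+_) (constant-map xs)
            constant-sum : ∀ n → ℕ.sum (map (λ _ → rank) (List.allFin n)) ≡ n ℕ.* rank
            constant-sum n = ≡.trans (constant-map (List.allFin n)) (cong (ℕ._* rank) (List.length-tabulate {n = n} id))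

        contradict : Ans
        contradict = sparse-or psA (G ℕ.* E) (sparse psA (admissible z z′)) λ A-sparse →
          sparse-or psB (G ℕ.* E) (tail-mono {G ℕ.* E} z≤z′ sparse psB (admissible z′ Z₁)) λ B-sparse →
          sparse-or psB (G ℕ.* E ℕ.* B₀) (sparse′ psB (admissible z′ Z₁)) λ B-very-sparse →
          conclude (weighted-pigeonhole _≟×_ slot weight slots (List.allFin (Y ^ D)) (AllPairs.tabulate⁺ id)
            (All.universal (λ _ → tt) (List.allFin (Y ^ D)))
            (All.universal slot∈ (List.allFin (Y ^ D))) (few-cells A-sparse B-sparse B-very-sparse))
          where
          sparse-or : ∀ ps N → (ℕ.product ps ≤ N ℕ.* numerator ps → Ans) → (N ℕ.* numerator ps ≤ ℕ.product ps → Ans) → Ans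
          sparse-or ps N dense k = case ℕ.≤-total (ℕ.product ps) (N ℕ.* numerator ps) of λ where
            (inj₁ ≤) → dense ≤
            (inj₂ ≥) → k ≥
          conclude : (∃₂ λ b ys → AllPairs _≢_ ys × All (λ _ → ⊤) ys × All (λ i → slot i ≡ b) ys × weight b < length ys) → Ans
          conclude ((p , N) , ys , distinct , _ , same-slot , many) = Crowded.crowded N p ys distinct same-slot many

      contradict : Ans
      contradict = finite-choice (λ i → datum (t i) (λ d → ℕ.<⇒≤ (t<Y i d))) λ data′ →
        case Fin.any? (λ i → Z₁ ℕ.<? Datum.size (data′ i)) of λ where
          (yes (i , large)) → index≤ (t i) (λ d → ℕ.<⇒≤ (t<Y i d)) (PrimeFactor.𝔮 (Datum.factor (data′ i)))
            (PrimeFactor.x∈ (Datum.factor (data′ i))) (proj₁ (Datum.residues (data′ i))) (proj₂ (Datum.residues (data′ i)))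
            (subst (_< Datum.size (data′ i)) Z₁-def large)
          (no  none) → Assigned.contradict data′ λ i → ℕ.≮⇒≥ λ large → none (i , large)
        where
        Z₁-def : Z₁ ≡ (sizeConstant ℕ.* (M ℕ.* Y)) ^ D
        Z₁-def = ≡.trans (cong (ℕ._* U) B₀-def) (≡.trans (≡.sym (^-distrib-* (sizeConstant ℕ.* M) Y D))
          (cong (_^ D) (ℕ.*-assoc sizeConstant M Y)))

  contradiction-from-sparsity : (∀ N → 1 ≤ N → Cl (∃ (Tail N))) → Ans
  contradiction-from-sparsity tails = tails (G ℕ.* E) 1≤GE λ (z₁ , tail₁) → second z₁ tail₁
    where
    second : ∀ z₁ → Tail (G ℕ.* E) z₁ → Ans
    -- B₀ involves z!, so this tail can be requested only when z is fixed. The side of the box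
    -- depends on y, which comes last and exceeds everything else.
    second z₁ tail₁ = tails (G ℕ.* E ℕ.* B₀) (ℕ.*-mono-≤ 1≤GE 0<B₀) λ (z₂ , tail₂) →
      Count.contradict z (z !) (z ℕ.+ z₂) (suc (G ℕ.* E ℕ.* (B₀ ℕ.+ (z ℕ.+ z₂)))) (ℕ.1≤n! z)
        (λ q pr q≤z → prime∣! pr q≤z)
        (ℕ.≤-trans (ℕ.m≤m+n ∣ n₀ ∣ (G ℕ.* E)) (ℕ.m≤n+m (∣ n₀ ∣ ℕ.+ G ℕ.* E) z₁))
        (ℕ.≤-trans (ℕ.m≤n+m (G ℕ.* E) ∣ n₀ ∣) (ℕ.m≤n+m (∣ n₀ ∣ ℕ.+ G ℕ.* E) z₁))
        B₀ refl (tail-mono {G ℕ.* E} (ℕ.m≤m+n z₁ _) tail₁) (tail-mono {G ℕ.* E ℕ.* B₀} (ℕ.m≤n+m z₂ z) tail₂) (ℕ.m≤m+n z z₂)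
        (ℕ.n≤1+n _) (s≤s z≤n)
      where
      z B₀ : ℕ
      z = z₁ ℕ.+ (∣ n₀ ∣ ℕ.+ G ℕ.* E)
      B₀ = (sizeConstant ℕ.* z !) ^ D
      0<B₀ : 0 < B₀
      0<B₀ = ℕ.>-nonZero⁻¹ B₀ ⦃ ℕ.m^n≢0 (sizeConstant ℕ.* z !) D ⦃ ℕ.>-nonZero (ℕ.*-mono-≤ 1≤sizeConstant (ℕ.1≤n! z)) ⦄ ⦄

-- Finiteness of the solutions

module PrimeWithoutRoot (P : ℤ[x]) (δ : ℕ) (P-degree : HasDegree P (suc δ)) (1≤δ : 1 ≤ δ) (irreducible : IrreducibleOverℚ P) where
  open MonicModel P δ P-degree using (Q)
  open SecondRoot P δ P-degree 1≤δ irreducible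
  open ReciprocalBound P δ P-degree 1≤δ irreducible using (reciprocalBound)
  private
    Ans : Set
    Ans = NoOddPrimeRoot P

  open Classical Ans
  open Ideals S using (Ideal; module Ideal; zeroIdeal; quotient; ≈⇒≈[]; ∈⇒≈[]0; ≈[]0⇒∈)
  open PrimeIdeals Ans S
  open SparseTail Ans (TwoRoots Q) proj₁
  private
    module S = ℤ-Algebra S

    module Quotient (J : Ideal) (avoids : Avoids (_≢ + 0) (λ ()) *≢0 J) (isPrime : Prime-ideal J) where
      R : ℤ-Algebra
      R = quotient J

      module R = ℤ-Algebra R

      R-finitelyGenerated : FinitelyGenerated R
      R-finitelyGenerated = quotient-finitelyGenerated S J S-finitelyGenerated

      R-orderLike : Lattices.OrderLike Ans R
      R-orderLike = AlgebraicDomain.orderLike Ans R R-finitelyGenerated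
        (λ n≢0 n≈0 → avoids n≢0 (≈[]0⇒∈ J n≈0))
        (λ x y xy≈0 k → isPrime x y (≈[]0⇒∈ J xy≈0) λ where
          (inj₁ x∈) → k (inj₁ (∈⇒≈[]0 J x∈))
          (inj₂ y∈) → k (inj₂ (∈⇒≈[]0 J y∈)))

      isRoot : ∀ x → PolyRing.evalₚ S (map S.ι Q) x S.≈ S.0# → PolyRing.evalₚ R (map R.ι Q) x R.≈ R.0#
      isRoot x root = R.≈-trans (R.≡⇒≈ (evalₚ-quotient S J (map S.ι Q) x)) (≈⇒≈[] J root)

      pullback : Ideals.Ideal R → Ideal
      pullback I = record { _∈I = _∈I ; resp = λ e → resp (≈⇒≈[] J e) ; 0∈ = 0∈ ; +∈ = +∈ ; *∈ = *∈ }
        where open Ideals.Ideal I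

      roots : SeparatedRoots Q R
      roots = record
        { α = root₁ ; β = root₂ ; isRoot-α = isRoot root₁ isRoot₁ ; isRoot-β = isRoot root₂ isRoot₂
        ; n₀ = proj₁ separation ; n₀≢0 = proj₁ (proj₂ separation)
        ; separation = λ I → proj₂ (proj₂ separation) (pullback I) }

      conclude : (∀ N → 1 ≤ N → Cl (∃ (Tail N))) → Ans
      conclude tails = Lattices.lattice Ans R R-finitelyGenerated λ L → by-rank L (Lattices.Lattice.D L) refl
        where
        by-rank : ∀ L n → Lattices.Lattice.D L ≡ n → Ans
        by-rank L zero    eq = Lattices.LatticeProperties.rank-positive Ans R R-orderLike L eq
        by-rank L (suc n) eq = LowerBound.contradiction-from-sparsity Ans Q R R-finitelyGenerated R-orderLike L
          roots (subst (1 ≤_) (≡.sym eq) (s≤s z≤n)) tails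

  noOddPrimeRoot : NoOddPrimeRoot P
  noOddPrimeRoot = primeIdeal-avoidingℤ (suc rank) zeroIdeal (λ w k → k (dependence w))
    (λ n≢0 n≈0 → contradiction (S-char0 n≈0) n≢0)
    λ (J , _ , avoids , isPrime) → Quotient.conclude J avoids isPrime λ N 1≤N k →
      reciprocalBound λ (z , K , bounded) → tail (z , K , λ ps (sorted , z<ps , two) → bounded ps sorted z<ps two) N 1≤N k
    where open GeneratorCoordinates S S-finitelyGenerated

-- Divisibility of the six sequences by an odd prime

∈⇒∣foldr-lcm : ∀ {m xs} → m ∈ xs → m ℕ.∣ List.foldr ℕ.lcm 1 xs
∈⇒∣foldr-lcm {xs = x ∷ xs} (here refl)  = ℕ.m∣lcm[m,n] x (List.foldr ℕ.lcm 1 xs)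
∈⇒∣foldr-lcm {xs = x ∷ xs} (there m∈xs) = ℕ.∣-trans (∈⇒∣foldr-lcm m∈xs) (ℕ.n∣lcm[m,n] x (List.foldr ℕ.lcm 1 xs))

parity : ∀ n → ∃[ k ] (n ≡ k ℕ.+ k ⊎ n ≡ suc (k ℕ.+ k))
parity zero    = 0 , inj₁ refl
parity (suc n) with parity n
... | k , inj₁ eq = k , inj₂ (cong suc eq)
... | k , inj₂ eq = suc k , inj₁ (cong suc (≡.trans eq (≡.sym (ℕ.+-suc k k))))

-- The double factorial n!! skips q unless n has the parity of q, but then it contains 2q; this is where q must be odd.
module OddPrimeDivides (q : ℕ) (pr : Prime q) (2<q : 2 < q) where

  -- The bound on m excludes m = 0, which q divides although 0 !! = 1.
  ∣!!-step : ∀ {m} → q ℕ.∣ m → 1 < m → ∀ k → q ℕ.∣ (m ℕ.+ (k ℕ.+ k)) !!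
  ∣!!-step {suc (suc m)} q∣m _ zero = subst (λ n → q ℕ.∣ n !!) (≡.sym (ℕ.+-identityʳ (suc (suc m)))) (ℕ.∣m⇒∣m*n (m !!) q∣m)
  ∣!!-step {suc zero} _ (s≤s ()) zero
  ∣!!-step {m} q∣m 1<m (suc k) = subst (λ n → q ℕ.∣ n !!) (identity m k)
    (ℕ.∣n⇒∣m*n (suc (suc (m ℕ.+ (k ℕ.+ k)))) (∣!!-step q∣m 1<m k))
    where
    identity : ∀ m k → suc (suc (m ℕ.+ (k ℕ.+ k))) ≡ m ℕ.+ (suc k ℕ.+ suc k)
    identity = ℕSolver.solve-∀

  1<q : 1 < q
  1<q = ℕ.<-trans (ℕ.n<1+n 1) 2<q

  odd : ∃[ j ] q ≡ suc (j ℕ.+ j)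
  odd with parity q
  ... | j , inj₂ eq = j , eq
  ... | j , inj₁ eq = case ℕ.prime⇒irreducible pr (ℕ.divides {2} {q} j (≡.trans eq (double j))) of λ where
      (inj₁ ())
      (inj₂ refl) → contradiction 2<q (ℕ.<-irrefl refl)
    where
    double : ∀ j → j ℕ.+ j ≡ j ℕ.* 2
    double = ℕSolver.solve-∀

  ∣!! : ∀ {n} → q ℕ.+ q ≤ n → q ℕ.∣ n !!
  ∣!! 2q≤n with ℕ.m≤n⇒∃[o]m+o≡n 2q≤n
  ... | r , refl with parity r
  ...   | k , inj₁ refl = ∣!!-step (ℕ.∣m∣n⇒∣m+n ℕ.∣-refl ℕ.∣-refl) (ℕ.≤-trans 1<q (ℕ.m≤m+n q q)) k
  ...   | k , inj₂ refl with odd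
  -- With q = 2j + 1, the odd number 2q + 2k + 1 is q + 2(j + 1 + k), so the factor q itself occurs
  -- in the product.
  ...     | j , q≡ = subst (λ n → q ℕ.∣ n !!) shape (∣!!-step ℕ.∣-refl 1<q (suc j ℕ.+ k))
    where
    identity : ∀ q j k → q ℕ.+ (suc j ℕ.+ k ℕ.+ (suc j ℕ.+ k)) ≡ q ℕ.+ suc (j ℕ.+ j) ℕ.+ suc (k ℕ.+ k)
    identity = ℕSolver.solve-∀
    shape : q ℕ.+ (suc j ℕ.+ k ℕ.+ (suc j ℕ.+ k)) ≡ q ℕ.+ q ℕ.+ suc (k ℕ.+ k)
    shape = ≡.trans (identity q j k) (cong (λ x → q ℕ.+ x ℕ.+ suc (k ℕ.+ k)) (≡.sym q≡))

  ∣lcmUpTo : ∀ {n} → q ≤ n → q ℕ.∣ lcmUpTo n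
  ∣lcmUpTo {n} q≤n = ∈⇒∣foldr-lcm (subst (_∈ map suc (List.upTo n)) (ℕ.suc-pred q ⦃ ℕ.prime⇒nonZero pr ⦄)
    (∈.∈-map⁺ suc (∈.∈-upTo⁺ (ℕ.≤-trans (ℕ.≤-reflexive (ℕ.suc-pred q ⦃ ℕ.prime⇒nonZero pr ⦄)) q≤n))))

  ∣primorial : ∀ {n} → q ≤ n → q ℕ.∣ primorial n
  ∣primorial q≤n = ℕ.∈⇒∣product (∈.∈-filter⁺ ℕ.prime? (∈.∈-upTo⁺ (s≤s q≤n)) pr)

  n≤nthPrime : ∀ n → n ≤ nthPrime n
  n≤nthPrime zero    = z≤n
  n≤nthPrime (suc n) = ℕ.≤-<-trans (n≤nthPrime n) (proj₁ (proj₂ (leastPrimeAbove (nthPrime n))))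

  ∣H : ∀ κ A n → q ℕ.+ q ≤ n → q ℕ.∣ H κ A n
  ∣H κ A n 2q≤n = by-kind κ
    where
    q≤n : q ≤ n
    q≤n = ℕ.≤-trans (ℕ.m≤m+n q q) 2q≤n
    q≤pₙ : q ≤ nthPrime n
    q≤pₙ = ℕ.≤-trans q≤n (n≤nthPrime n)
    by-kind : ∀ κ → q ℕ.∣ H κ A n
    by-kind A^n·[1…n]  = ℕ.∣n⇒∣m*n (A ^ n) (∣lcmUpTo q≤n)
    by-kind A^n·n!     = ℕ.∣n⇒∣m*n (A ^ n) (prime∣! pr q≤n)
    by-kind A^n·n!!    = ℕ.∣n⇒∣m*n (A ^ n) (∣!! 2q≤n)
    by-kind A^pₙ·pₙ#   = ℕ.∣n⇒∣m*n (A ^ nthPrime n) (∣primorial q≤pₙ)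
    by-kind A^n·pₙ#    = ℕ.∣n⇒∣m*n (A ^ n) (∣primorial q≤pₙ)
    by-kind A^n·n#     = ℕ.∣n⇒∣m*n (A ^ n) (∣primorial q≤n)

-- Enumeration of the candidates

interval : ℕ → List ℤ
interval n = map +_ (List.upTo (suc n)) ++ map (λ k → ℤ.- + k) (List.upTo (suc n))

∈-interval : ∀ {x n} → ∣ x ∣ ≤ n → x ∈ interval n
∈-interval {+ m}      m≤n = ∈.∈-++⁺ˡ (∈.∈-map⁺ +_ (∈.∈-upTo⁺ (s≤s m≤n)))
∈-interval { -[1+ m ]} {n} m<n = ∈.∈-++⁺ʳ (map +_ (List.upTo (suc n))) (∈.∈-map⁺ (λ k → ℤ.- + k) (∈.∈-upTo⁺ (s≤s m<n)))

-- A nonzero root divides the lowest nonzero coefficient. The list covers every place where that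
-- coefficient may stand, so it contains all roots, along with other integers.
roots : ℤ[x] → List ℤ
roots []      = []
roots (c ∷ p) = + 0 ∷ interval ∣ c ∣ ++ roots p

∈-roots : ∀ p {k x} → coeff p k ≢ + 0 → eval p x ≡ + 0 → x ∈ roots p
∈-roots []      pₖ≢0 _ = contradiction refl pₖ≢0
∈-roots (c ∷ p) {k} {x} pₖ≢0 root with c ℤ.≟ + 0
... | no c≢0 = there (∈.∈-++⁺ˡ (∈-interval (ℕ.∣⇒≤ ⦃ ℕ.≢-nonZero (c≢0 ∘ ℤ.∣i∣≡0⇒i≡0) ⦄
    (ℤ.∣⇒∣ᵤ (ℤ.∣m+n∣n⇒∣m {x} {c} {x ℤ.* eval p x} (ℤ.divides (+ 0) root) (ℤ.divides (eval p x) (ℤ.*-comm x (eval p x))))))))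
... | yes c≡0 with ℤ.i*j≡0⇒i≡0∨j≡0 x (≡.trans (≡.sym (ℤ.+-identityˡ _)) (≡.trans (cong (λ z → z ℤ.+ x ℤ.* eval p x) (≡.sym c≡0)) root))
...   | inj₁ x≡0 = here x≡0
∈-roots (c ∷ p) {zero}  pₖ≢0 root | yes c≡0 | inj₂ _      = contradiction c≡0 pₖ≢0
∈-roots (c ∷ p) {suc k} pₖ≢0 root | yes c≡0 | inj₂ p[x]≡0 = there (∈.∈-++⁺ʳ (interval ∣ c ∣) (∈-roots p pₖ≢0 p[x]≡0))

boundedVectors : ℕ → ∀ r → List (Vec ℕ r)
boundedVectors N zero    = [] ∷ []
boundedVectors N (suc r) = List.cartesianProductWith _∷_ (List.upTo N) (boundedVectors N r)

∈-boundedVectors : ∀ {N r} (n : Vec ℕ r) → (∀ i → Vec.lookup n i < N) → n ∈ boundedVectors N r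
∈-boundedVectors []      _     = here refl
∈-boundedVectors (m ∷ n) bound = ∈.∈-cartesianProductWith⁺ _∷_ (∈.∈-upTo⁺ (bound zero)) (∈-boundedVectors n (bound ∘ suc))

theorem1 : (P : ℤ[x]) (d : ℕ) → HasDegree P d → 2 ≤ d → IrreducibleOverℚ P →
    (r : ℕ) → 1 ≤ r →
    (A : Fin r → ℕ) → (∀ i → 0 < A i) →
    (κ : Fin r → Kind) →
    FinitelyMany (IsSolution P κ A)
theorem1 P (suc δ) degree (s≤s 1≤δ) irreducible r _ A _ κ =
    finite (PrimeWithoutRoot.noOddPrimeRoot P δ degree 1≤δ irreducible)
  where
  value : Vec ℕ r → ℕ
  value n = ℕ.product (List.tabulate λ i → H (κ i) (A i) (Vec.lookup n i))

  -- Subtracting a constant does not touch the coefficient in degree suc δ, so this is never the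
  -- zero polynomial and each n leaves finitely many x.
  difference : Vec ℕ r → ℤ[x]
  difference n = P +ₚ -ₚ (+ value n ∷ [])

  candidates : ℕ → List (ℤ × Vec ℕ r)
  candidates N = List.concatMap (λ n → map (_, n) (roots (difference n))) (boundedVectors N r)

  root-of-difference : ∀ {x n} → eval P x ≡ + value n → eval (difference n) x ≡ + 0
  root-of-difference {x} {n} eq = begin
    eval (difference n) x                        ≡⟨ evalₚ-+ P (-ₚ (+ value n ∷ [])) x ⟩
    eval P x ℤ.+ (ℤ.- + value n ℤ.+ x ℤ.* + 0)   ≡⟨ cong (λ y → y ℤ.+ (ℤ.- + value n ℤ.+ x ℤ.* + 0)) eq ⟩
    + value n ℤ.+ (ℤ.- + value n ℤ.+ x ℤ.* + 0)  ≡⟨ identity (+ value n) x ⟩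
    + 0                                          ∎
    where
    open ≡-Reasoning
    identity : ∀ v x → v ℤ.+ (ℤ.- v ℤ.+ x ℤ.* + 0) ≡ + 0
    identity = ℤSolver.solve-∀

  difference≢0 : ∀ n → coeff (difference n) (suc δ) ≢ + 0
  difference≢0 n eq = proj₁ degree (≡.trans (≡.sym (≡.trans (coeff-+ P (-ₚ (+ value n ∷ [])) (suc δ)) (ℤ.+-identityʳ _))) eq)

  finite : NoOddPrimeRoot P → FinitelyMany (IsSolution P κ A)
  finite (q , pr , 2<q , noRoot) = candidates (q ℕ.+ q) , λ { {x , n} (_ , eq) →
    ∈.∈-concatMap⁺ (λ n → map (_, n) (roots (difference n)))
      (Any.map (λ { refl → ∈.∈-map⁺ (_, n) (∈-roots (difference n) {suc δ} (difference≢0 n) (root-of-difference {x} {n} eq)) })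
        (∈-boundedVectors n λ i → ℕ.≰⇒> λ 2q≤nᵢ → noRoot x (subst (+ q ℤ.∣_) (≡.sym eq)
          (∣⇒∣ℤ (ℕ.∣-trans (OddPrimeDivides.∣H q pr 2<q (κ i) (A i) (Vec.lookup n i) 2q≤nᵢ)
            (ℕ.∈⇒∣product (∈.∈-tabulate⁺ i))))))) }
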